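{- Let $n>c_1>c_2$ be positive integers and let $\Sigma$ be an even positive integer. Put $Q=(c_1-c_2+1)^2-4c_2(n-1-c_1)$. Suppose $\beta>0$, $r\in\mathbb N$ and $\varepsilon=\frac{3(r+3)}{\beta(c_1-c_2)}$. If $$(1-\beta)(c_1-c_2+1)^2\ge 4c_2(n-1-c_1)$$ and $$\left|\frac{\Sigma-nc_2}{(c_1-c_2)/2}-(1+c_1+c_2)\right|\le(1-\varepsilon)\sqrt{Q},$$ then the simple region $\mathbb D(n,\Sigma,c_1,c_2)$ contains a (graphic) degree sequence $D$ such that $$\partial^{++}(D)\ge 2^{r/2}.$$
   Context: A degree sequence of length $n$ is a sequence $D=(d_1,\dots,d_n)$ of positive integers, each at most $n-1$, with even sum. It is graphic if there is a simple graph on vertex set $\{1,\dots,n\}$ in which vertex $i$ has degree $d_i$ for every $i$; such a graph is called a realization of $D$. $\mathcal G(D)$ denotes the set of all (labelled) realizations of $D$; it is empty if $D$ (an arbitrary integer vector) has no realization. For positive integers $n>c_1\ge c_2$ and even $\Sigma$, $\mathbb D(n,\Sigma,c_1,c_2)$ is the set of all degree sequences $(d_1,\dots,d_n)$ of length $n$ with $c_1\ge d_i\ge c_2$ for all $i$ and $\sum_i d_i=\Sigma$. For $1\le i,j\le n$, $1^{+i}_{+j}$ denotes the integer vector $e_i+e_j$ of length $n$, where $e_i$ is the $i$th standard unit vector. For a graphic degree sequence $D$ of length $n$ (the quantity is defined only for graphic $D$), $$\partial^{++}(D)=\sum_{1\le i<j\le n}\frac{|\mathcal G(D+1^{+i}_{+j})|}{|\mathcal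 G(D)|}.$$ -}

module Defs where

open import Algebra.Properties.CommutativeMonoid.Sum using (sum)
open import Data.Bool using (if_then_else_)
open import Data.Fin as Fin using (Fin)
import Data.Fin.Properties as Finₚ
open import Data.Fin.Subset using (Subset; inside; outside; _∈_; _∉_; ∣_∣)
open import Data.Fin.Subset.Properties using (_∈?_)
open import Data.Integer as ℤ using (ℤ; +_)
import Data.Integer.Properties as ℤₚ
open import Data.List as List using (List; []; _∷_; filter; length; cartesianProductWith)
import Data.List.Membership.Propositional as Mem
import Data.List.Membership.Propositional.Properties as Memₚ
open import Data.List.Relation.Unary.All using ([]; _∷_)
open import Data.List.Relation.Unary.AllPairs using ([]; _∷_)
open import Data.List.Relation.Unary.Any using (here; there)
open import Data.List.Relation.Unary.Unique.Propositional using (Unique)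
import Data.List.Relation.Unary.Unique.Propositional.Properties as Uniqueₚ
open import Data.Nat as ℕ using (ℕ; zero; suc)
open import Data.Nat.Divisibility using (_∣_)
import Data.Nat.DivMod as ℕ
import Data.Nat.Properties as ℕₚ
open import Data.Product using (∃; ∃-syntax; _×_; _,_; proj₁; proj₂)
open import Data.Rational as ℚ using (ℚ; 0ℚ; 1ℚ; ½; *<*)
import Data.Rational.Properties as ℚₚ
open import Data.Rational.Solver using (module +-*-Solver)
open import Data.Rational.Unnormalised as ℚᵘ using (mkℚᵘ; *≡*; *≤*)
import Data.Rational.Unnormalised.Properties as ℚᵘₚ
open import Data.Sum using (inj₁; inj₂)
open import Data.Vec as Vec using (Vec; []; _∷_; lookup)
open import Data.Vec.Properties using (∷-injective)
open import Function using (_∘_)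
open import Relation.Binary.PropositionalEquality
  using (_≡_; refl; sym; trans; cong; cong₂; subst; subst₂)
open import Relation.Nullary using (does; yes; no; contradiction)
open import Relation.Nullary.Decidable using (_×-dec_; _→-dec_; ¬?)
open import Relation.Unary using (Decidable)

open +-*-Solver using (solve; _:=_; _:+_; _:*_; _:-_; :-_; con)

ι : ℕ → ℚ
ι a = + a ℚ./ 1

toℚᵘ-ι : ∀ a → ℚ.toℚᵘ (ι a) ℚᵘ.≃ mkℚᵘ (+ a) 0
toℚᵘ-ι a = ℚₚ.toℚᵘ-fromℚᵘ (mkℚᵘ (+ a) 0)

ι-+ : ∀ a b → ι (a ℕ.+ b) ≡ ι a ℚ.+ ι b
ι-+ a b = ℚₚ.toℚᵘ-injective (ℚᵘₚ.≃-trans (toℚᵘ-ι (a ℕ.+ b)) (ℚᵘₚ.≃-sym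
  (ℚᵘₚ.≃-trans (ℚₚ.toℚᵘ-homo-+ (ι a) (ι b))
  (ℚᵘₚ.≃-trans (ℚᵘₚ.+-cong (toℚᵘ-ι a) (toℚᵘ-ι b))
    (*≡* (cong (ℤ._* + 1) (trans (cong₂ ℤ._+_ (ℤₚ.*-identityʳ (+ a)) (ℤₚ.*-identityʳ (+ b)))
                                 (sym (ℤₚ.pos-+ a b)))))))))

ι-* : ∀ a b → ι (a ℕ.* b) ≡ ι a ℚ.* ι b
ι-* a b = ℚₚ.toℚᵘ-injective (ℚᵘₚ.≃-trans (toℚᵘ-ι (a ℕ.* b)) (ℚᵘₚ.≃-sym
  (ℚᵘₚ.≃-trans (ℚₚ.toℚᵘ-homo-* (ι a) (ι b))
  (ℚᵘₚ.≃-trans (ℚᵘₚ.*-cong (toℚᵘ-ι a) (toℚᵘ-ι b))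
    (*≡* (cong (ℤ._* + 1) (sym (ℤₚ.pos-* a b))))))))

ι-mono : ∀ {a b} → a ℕ.≤ b → ι a ℚ.≤ ι b
ι-mono {a} {b} a≤b = ℚₚ.toℚᵘ-cancel-≤
  (ℚᵘₚ.≤-respˡ-≃ (ℚᵘₚ.≃-sym (toℚᵘ-ι a)) (ℚᵘₚ.≤-respʳ-≃ (ℚᵘₚ.≃-sym (toℚᵘ-ι b))
    (*≤* (ℤₚ.*-monoʳ-≤-nonNeg (+ 1) (ℤ.+≤+ a≤b)))))

0<1 : 0ℚ ℚ.< 1ℚ
0<1 = *<* (ℤ.+<+ (ℕ.s≤s ℕ.z≤n))

0<½ : 0ℚ ℚ.< ½
0<½ = *<* (ℤ.+<+ (ℕ.s≤s ℕ.z≤n))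

ι-pos : ∀ a → 0ℚ ℚ.< ι (suc a)
ι-pos a = ℚₚ.<-≤-trans 0<1 (ι-mono {1} {suc a} (ℕ.s≤s ℕ.z≤n))

ι-nonneg : ∀ a → 0ℚ ℚ.≤ ι a
ι-nonneg a = ι-mono {0} {a} ℕ.z≤n

0<*< : ∀ {p q} → 0ℚ ℚ.< p → 0ℚ ℚ.< q → 0ℚ ℚ.< p ℚ.* q
0<*< {p} {q} 0<p 0<q =
  subst (ℚ._< p ℚ.* q) (ℚₚ.*-zeroʳ p) (ℚₚ.*-monoʳ-<-pos p {{ℚ.positive 0<p}} 0<q)

*-mono-≤ : ∀ {p q u v} → 0ℚ ℚ.≤ p → 0ℚ ℚ.≤ v → p ℚ.≤ q → u ℚ.≤ v → p ℚ.* u ℚ.≤ q ℚ.* v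
*-mono-≤ {p} {q} {u} {v} 0≤p 0≤v p≤q u≤v = ℚₚ.≤-trans
  (ℚₚ.*-monoˡ-≤-nonNeg p {{ℚ.nonNegative 0≤p}} u≤v)
  (ℚₚ.*-monoʳ-≤-nonNeg v {{ℚ.nonNegative 0≤v}} p≤q)

0≤*≤ : ∀ {p q} → 0ℚ ℚ.≤ p → 0ℚ ℚ.≤ q → 0ℚ ℚ.≤ p ℚ.* q
0≤*≤ {p} {q} 0≤p 0≤q =
  subst (ℚ._≤ p ℚ.* q) (ℚₚ.*-zeroʳ p) (ℚₚ.*-monoˡ-≤-nonNeg p {{ℚ.nonNegative 0≤p}} 0≤q)

inv : (p : ℚ) → 0ℚ ℚ.< p → ℚ
inv p 0<p = (ℚ.1/ p) {{ℚ.>-nonZero 0<p}}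

inv-pos : ∀ p 0<p → 0ℚ ℚ.< inv p 0<p
inv-pos p 0<p = ℚₚ.positive⁻¹ _ {{ℚₚ.1/pos⇒pos p {{ℚ.positive 0<p}}}}

*-inv : ∀ p 0<p → p ℚ.* inv p 0<p ≡ 1ℚ
*-inv p 0<p = ℚₚ.*-inverseʳ p {{ℚ.>-nonZero 0<p}}

∣∣≤ : ∀ {p q} → p ℚ.≤ q → ℚ.- p ℚ.≤ q → ℚ.∣ p ∣ ℚ.≤ q
∣∣≤ {p} {q} h₁ h₂ with ℚₚ.∣p∣≡p∨∣p∣≡-p p
... | inj₁ e = subst (ℚ._≤ q) (sym e) h₁
... | inj₂ e = subst (ℚ._≤ q) (sym e) h₂

p≤∣p∣ : ∀ p → p ℚ.≤ ℚ.∣ p ∣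
p≤∣p∣ p with ℚₚ.≤-total 0ℚ p
... | inj₁ 0≤p = ℚₚ.≤-reflexive (sym (ℚₚ.0≤p⇒∣p∣≡p 0≤p))
... | inj₂ p≤0 = ℚₚ.≤-trans p≤0 (ℚₚ.0≤∣p∣ p)

minus-≤ : ∀ {p q r} → p ℚ.≤ q ℚ.+ r → p ℚ.- q ℚ.≤ r
minus-≤ {p} {q} {r} h = subst (p ℚ.- q ℚ.≤_)
  (solve 2 (λ q r → (q :+ r) :- q := r) refl q r) (ℚₚ.+-monoˡ-≤ (ℚ.- q) h)

≤-plus : ∀ {p q r} → p ℚ.- q ℚ.≤ r → p ℚ.≤ q ℚ.+ r
≤-plus {p} {q} {r} h = subst₂ ℚ._≤_
  (solve 2 (λ p q → (p :- q) :+ q := p) refl p q) (ℚₚ.+-comm r q) (ℚₚ.+-monoˡ-≤ q h)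

half+half : ∀ p → ½ ℚ.* p ℚ.+ ½ ℚ.* p ≡ p
half+half p = trans (sym (ℚₚ.*-distribʳ-+ p ½ ½)) (ℚₚ.*-identityˡ p)

IsCauchy : (ℕ → ℚ) → Set
IsCauchy x = ∀ ε → 0ℚ ℚ.< ε →
  ∃[ N ] (∀ {m n} → N ℕ.≤ m → N ℕ.≤ n → ℚ.∣ x m ℚ.- x n ∣ ℚ.≤ ε)

-- No quotient is taken: distinct representatives of the same real number are
-- identified by _≤_ in both directions.
record ℝ : Set where
  constructor real
  field
    seq    : ℕ → ℚ
    cauchy : IsCauchy seq

open ℝ public

-- m and n range over the same set, so the one-sided bound is the absolute one.
oneSided : ∀ (x : ℕ → ℚ) {N ε} →
  (∀ {m n} → N ℕ.≤ m → N ℕ.≤ n → x m ℚ.≤ x n ℚ.+ ε) →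
  (∀ {m n} → N ℕ.≤ m → N ℕ.≤ n → ℚ.∣ x m ℚ.- x n ∣ ℚ.≤ ε)
oneSided x {N} {ε} h {m} {n} N≤m N≤n = ∣∣≤ (minus-≤ (h N≤m N≤n))
  (subst (ℚ._≤ ε) (solve 2 (λ a b → b :- a := :- (a :- b)) refl (x m) (x n)) (minus-≤ (h N≤n N≤m)))

infix 4 _<_ _≤_

_<_ : ℝ → ℝ → Set
x < y = ∃[ δ ] 0ℚ ℚ.< δ × ∃[ N ] (∀ {n} → N ℕ.≤ n → seq x n ℚ.+ δ ℚ.≤ seq y n)

_≤_ : ℝ → ℝ → Set
x ≤ y = ∀ ε → 0ℚ ℚ.< ε → ∃[ N ] (∀ {n} → N ℕ.≤ n → seq x n ℚ.≤ seq y n ℚ.+ ε)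

fromℚ : ℚ → ℝ
fromℚ q = real (λ _ → q) λ ε 0<ε → 0 , λ _ _ →
  subst (λ z → ℚ.∣ z ∣ ℚ.≤ ε) (sym (ℚₚ.+-inverseʳ q)) (ℚₚ.<⇒≤ 0<ε)

fromℕ : ℕ → ℝ
fromℕ = fromℚ ∘ ι

0ℝ 1ℝ ½ℝ : ℝ
0ℝ = fromℚ 0ℚ
1ℝ = fromℚ 1ℚ
½ℝ = fromℚ ½

infixl 6 _+_ _-_
infixl 7 _*_ _/_[_]
infix  8 -_
infix  9 _²

_+_ : ℝ → ℝ → ℝ
x + y = real (λ k → seq x k ℚ.+ seq y k) λ ε 0<ε →
  let 0<½ε = 0<*< 0<½ 0<ε
      (M , hx) = cauchy x (½ ℚ.* ε) 0<½ε
      (N , hy) = cauchy y (½ ℚ.* ε) 0<½ε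
  in M ℕ.⊔ N , λ {m} {n} hm hn →
     ℚₚ.≤-trans
       (subst (λ z → ℚ.∣ z ∣ ℚ.≤ ℚ.∣ seq x m ℚ.- seq x n ∣ ℚ.+ ℚ.∣ seq y m ℚ.- seq y n ∣)
         (solve 4 (λ a b c d → (a :- b) :+ (c :- d) := (a :+ c) :- (b :+ d)) refl
           (seq x m) (seq x n) (seq y m) (seq y n))
         (ℚₚ.∣p+q∣≤∣p∣+∣q∣ (seq x m ℚ.- seq x n) (seq y m ℚ.- seq y n)))
       (subst (_ ℚ.≤_) (half+half ε)
         (ℚₚ.+-mono-≤ (hx (ℕₚ.m⊔n≤o⇒m≤o M N hm) (ℕₚ.m⊔n≤o⇒m≤o M N hn))
                      (hy (ℕₚ.m⊔n≤o⇒n≤o M N hm) (ℕₚ.m⊔n≤o⇒n≤o M N hn))))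

-_ : ℝ → ℝ
- x = real (λ k → ℚ.- seq x k) λ ε 0<ε →
  let (N , h) = cauchy x ε 0<ε
  in N , λ {m} {n} hm hn → subst (λ z → ℚ.∣ z ∣ ℚ.≤ ε)
       (solve 2 (λ a b → b :- a := :- a :- :- b) refl (seq x m) (seq x n)) (h hn hm)

_-_ : ℝ → ℝ → ℝ
x - y = x + - y

∣_∣ᴿ : ℝ → ℝ
∣ x ∣ᴿ = real (λ k → ℚ.∣ seq x k ∣) λ ε 0<ε →
  let (N , h) = cauchy x ε 0<ε
  in N , oneSided (λ k → ℚ.∣ seq x k ∣) λ {m} {n} hm hn → ℚₚ.≤-trans
       (subst (λ z → ℚ.∣ z ∣ ℚ.≤ ℚ.∣ seq x n ∣ ℚ.+ ℚ.∣ seq x m ℚ.- seq x n ∣)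
         (solve 2 (λ a b → b :+ (a :- b) := a) refl (seq x m) (seq x n))
         (ℚₚ.∣p+q∣≤∣p∣+∣q∣ (seq x n) (seq x m ℚ.- seq x n)))
       (ℚₚ.+-monoʳ-≤ ℚ.∣ seq x n ∣ (h hm hn))

eventuallyBounded : ∀ x → ∃[ B ] 0ℚ ℚ.< B × ∃[ N ] (∀ {n} → N ℕ.≤ n → ℚ.∣ seq x n ∣ ℚ.≤ B)
eventuallyBounded x =
  let (N , h) = cauchy x 1ℚ 0<1
      a = seq x N
  in ℚ.∣ a ∣ ℚ.+ 1ℚ
   , ℚₚ.<-≤-trans 0<1 (subst (ℚ._≤ ℚ.∣ a ∣ ℚ.+ 1ℚ) (ℚₚ.+-identityˡ 1ℚ)
       (ℚₚ.+-monoˡ-≤ 1ℚ (ℚₚ.0≤∣p∣ a)))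
   , N , λ {n} N≤n → ℚₚ.≤-trans
       (subst (λ z → ℚ.∣ z ∣ ℚ.≤ ℚ.∣ a ∣ ℚ.+ ℚ.∣ seq x n ℚ.- a ∣)
         (solve 2 (λ a b → b :+ (a :- b) := a) refl (seq x n) a)
         (ℚₚ.∣p+q∣≤∣p∣+∣q∣ a (seq x n ℚ.- a)))
       (ℚₚ.+-monoʳ-≤ ℚ.∣ a ∣ (h N≤n ℕₚ.≤-refl))

_*_ : ℝ → ℝ → ℝ
x * y = real (λ k → seq x k ℚ.* seq y k) λ ε 0<ε →
  let (A , 0<A , Nx , hx) = eventuallyBounded x
      (B , 0<B , Ny , hy) = eventuallyBounded y
      0<½ε = 0<*< 0<½ 0<ε
      (Mx , cx) = cauchy x (½ ℚ.* ε ℚ.* inv B 0<B) (0<*< 0<½ε (inv-pos B 0<B))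
      (My , cy) = cauchy y (½ ℚ.* ε ℚ.* inv A 0<A) (0<*< 0<½ε (inv-pos A 0<A))
      K = (Nx ℕ.⊔ Ny) ℕ.⊔ (Mx ℕ.⊔ My)
      ≥Nx = λ {k} (h : K ℕ.≤ k) → ℕₚ.m⊔n≤o⇒m≤o Nx Ny (ℕₚ.m⊔n≤o⇒m≤o (Nx ℕ.⊔ Ny) (Mx ℕ.⊔ My) h)
      ≥Ny = λ {k} (h : K ℕ.≤ k) → ℕₚ.m⊔n≤o⇒n≤o Nx Ny (ℕₚ.m⊔n≤o⇒m≤o (Nx ℕ.⊔ Ny) (Mx ℕ.⊔ My) h)
      ≥Mx = λ {k} (h : K ℕ.≤ k) → ℕₚ.m⊔n≤o⇒m≤o Mx My (ℕₚ.m⊔n≤o⇒n≤o (Nx ℕ.⊔ Ny) (Mx ℕ.⊔ My) h)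
      ≥My = λ {k} (h : K ℕ.≤ k) → ℕₚ.m⊔n≤o⇒n≤o Mx My (ℕₚ.m⊔n≤o⇒n≤o (Nx ℕ.⊔ Ny) (Mx ℕ.⊔ My) h)
      cancel : ∀ C (0<C : 0ℚ ℚ.< C) → C ℚ.* (½ ℚ.* ε ℚ.* inv C 0<C) ≡ ½ ℚ.* ε
      cancel C 0<C = trans
        (solve 3 (λ c e i → c :* (e :* i) := e :* (c :* i)) refl C (½ ℚ.* ε) (inv C 0<C))
        (trans (cong (½ ℚ.* ε ℚ.*_) (*-inv C 0<C)) (ℚₚ.*-identityʳ _))
  in K , λ {m} {n} hm hn →
    let a = seq x m ; b = seq x n ; c = seq y m ; d = seq y n
        first : ℚ.∣ a ℚ.* (c ℚ.- d) ∣ ℚ.≤ ½ ℚ.* ε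
        first = subst₂ ℚ._≤_ (sym (ℚₚ.∣p*q∣≡∣p∣*∣q∣ a (c ℚ.- d))) (cancel A 0<A)
          (*-mono-≤ (ℚₚ.0≤∣p∣ a) (ℚₚ.<⇒≤ (0<*< 0<½ε (inv-pos A 0<A)))
            (hx (≥Nx hm)) (cy (≥My hm) (≥My hn)))
        second : ℚ.∣ d ℚ.* (a ℚ.- b) ∣ ℚ.≤ ½ ℚ.* ε
        second = subst₂ ℚ._≤_ (sym (ℚₚ.∣p*q∣≡∣p∣*∣q∣ d (a ℚ.- b))) (cancel B 0<B)
          (*-mono-≤ (ℚₚ.0≤∣p∣ d) (ℚₚ.<⇒≤ (0<*< 0<½ε (inv-pos B 0<B)))
            (hy (≥Ny hn)) (cx (≥Mx hm) (≥Mx hn)))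
    in ℚₚ.≤-trans
      (subst (λ z → ℚ.∣ z ∣ ℚ.≤ ℚ.∣ a ℚ.* (c ℚ.- d) ∣ ℚ.+ ℚ.∣ d ℚ.* (a ℚ.- b) ∣)
        (solve 4 (λ a b c d → a :* (c :- d) :+ d :* (a :- b) := a :* c :- b :* d) refl a b c d)
        (ℚₚ.∣p+q∣≤∣p∣+∣q∣ (a ℚ.* (c ℚ.- d)) (d ℚ.* (a ℚ.- b))))
      (subst (_ ℚ.≤_) (half+half ε) (ℚₚ.+-mono-≤ first second))

_² : ℝ → ℝ
x ² = x * x

⊔-cauchy : ∀ x q → IsCauchy x → IsCauchy (λ k → x k ℚ.⊔ q)
⊔-cauchy x q cx ε 0<ε =
  let (N , h) = cx ε 0<ε
  in N , oneSided (λ k → x k ℚ.⊔ q) λ {m} {n} hm hn → ℚₚ.⊔-lub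
       (ℚₚ.≤-trans (≤-plus {x m} (ℚₚ.≤-trans (p≤∣p∣ _) (h hm hn))) (ℚₚ.+-monoˡ-≤ ε (ℚₚ.p≤p⊔q (x n) q)))
       (ℚₚ.≤-trans (subst (ℚ._≤ q ℚ.+ ε) (ℚₚ.+-identityʳ q) (ℚₚ.+-monoʳ-≤ q (ℚₚ.<⇒≤ 0<ε)))
                   (ℚₚ.+-monoˡ-≤ ε (ℚₚ.p≤q⊔p (x n) q)))

-- Cutting off at the positive lower bound δ of x changes only finitely many terms.
recip : (x : ℝ) → 0ℝ < x → ℝ
recip x (δ , 0<δ , _) = real u λ ε 0<ε →
  let (N , h) = ⊔-cauchy (seq x) δ (cauchy x) (ε ℚ.* (δ ℚ.* δ)) (0<*< 0<ε (0<*< 0<δ 0<δ))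
  in N , oneSided u λ {m} {n} hm hn → ≤-plus {u m} (ℚₚ.*-cancelʳ-≤-pos (y m ℚ.* y n)
    {{ℚ.positive (0<*< (0<y m) (0<y n))}}
    (ℚₚ.≤-trans
      (subst (ℚ._≤ ε ℚ.* (δ ℚ.* δ)) (sym (clear m n)) (ℚₚ.≤-trans (p≤∣p∣ _) (h hn hm)))
      (ℚₚ.*-monoˡ-≤-nonNeg ε {{ℚ.nonNegative (ℚₚ.<⇒≤ 0<ε)}}
        (*-mono-≤ (ℚₚ.<⇒≤ 0<δ) (ℚₚ.<⇒≤ (0<y n)) (δ≤y m) (δ≤y n)))))
  where
  y : ℕ → ℚ
  y k = seq x k ℚ.⊔ δ

  δ≤y : ∀ k → δ ℚ.≤ y k
  δ≤y k = ℚₚ.p≤q⊔p (seq x k) δ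

  0<y : ∀ k → 0ℚ ℚ.< y k
  0<y k = ℚₚ.<-≤-trans 0<δ (δ≤y k)

  u : ℕ → ℚ
  u k = inv (y k) (0<y k)

  clear : ∀ m n → (u m ℚ.- u n) ℚ.* (y m ℚ.* y n) ≡ y n ℚ.- y m
  clear m n = trans
    (solve 4 (λ p q a b → (p :- q) :* (a :* b) := (a :* p) :* b :- (b :* q) :* a) refl
      (u m) (u n) (y m) (y n))
    (cong₂ ℚ._-_
      (trans (cong (ℚ._* y n) (*-inv (y m) (0<y m))) (ℚₚ.*-identityˡ (y n)))
      (trans (cong (ℚ._* y m) (*-inv (y n) (0<y n))) (ℚₚ.*-identityˡ (y m))))

_/_[_] : ℝ → (y : ℝ) → 0ℝ < y → ℝ
x / y [ 0<y ] = x * recip y 0<y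

*-pos : ∀ x y → 0ℝ < x → 0ℝ < y → 0ℝ < x * y
*-pos x y (δ , 0<δ , M , h) (η , 0<η , N , k) =
  δ ℚ.* η , 0<*< 0<δ 0<η , M ℕ.⊔ N , λ {n} hn →
    let δ≤x = subst (ℚ._≤ seq x n) (ℚₚ.+-identityˡ δ) (h (ℕₚ.m⊔n≤o⇒m≤o M N hn))
        η≤y = subst (ℚ._≤ seq y n) (ℚₚ.+-identityˡ η) (k (ℕₚ.m⊔n≤o⇒n≤o M N hn))
    in subst (ℚ._≤ seq x n ℚ.* seq y n) (sym (ℚₚ.+-identityˡ (δ ℚ.* η)))
         (*-mono-≤ (ℚₚ.<⇒≤ 0<δ) (ℚₚ.≤-trans (ℚₚ.<⇒≤ 0<η) η≤y) δ≤x η≤y)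

½-pos : 0ℝ < ½ℝ
½-pos = ½ , 0<½ , 0 , λ _ → ℚₚ.≤-reflexive (ℚₚ.+-identityˡ ½)

diff-pos : ∀ a b → a ℕ.< b → 0ℝ < fromℕ b - fromℕ a
diff-pos a b a<b = 1ℚ , 0<1 , 0 , λ _ →
  subst (ℚ._≤ ι b ℚ.- ι a)
    (trans (cong (ℚ._- ι a) (ι-+ 1 a))
      (solve 2 (λ u v → (u :+ v) :- v := con 0ℚ :+ u) refl 1ℚ (ι a)))
    (ℚₚ.+-monoˡ-≤ (ℚ.- ι a) (ι-mono a<b))

√-step : ℕ → ℕ → ℕ
√-step n s with suc s ℕ.* suc s ℕ.≤? suc n
... | yes _ = suc s
... | no  _ = s

⌊√_⌋ : ℕ → ℕ
⌊√ zero ⌋  = 0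
⌊√ suc n ⌋ = √-step n ⌊√ n ⌋

√-step-spec : ∀ n s → s ℕ.* s ℕ.≤ n × n ℕ.< suc s ℕ.* suc s →
  let t = √-step n s in t ℕ.* t ℕ.≤ suc n × suc n ℕ.< suc t ℕ.* suc t
√-step-spec n s (lo , hi) with suc s ℕ.* suc s ℕ.≤? suc n
... | yes p = p , ℕₚ.≤-<-trans hi (ℕₚ.*-mono-< {suc s} {suc (suc s)} ℕₚ.≤-refl ℕₚ.≤-refl)
... | no ¬p = ℕₚ.m≤n⇒m≤1+n lo , ℕₚ.≰⇒> ¬p

⌊√⌋-spec : ∀ n → ⌊√ n ⌋ ℕ.* ⌊√ n ⌋ ℕ.≤ n × n ℕ.< suc ⌊√ n ⌋ ℕ.* suc ⌊√ n ⌋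
⌊√⌋-spec zero    = ℕ.z≤n , ℕ.s≤s ℕ.z≤n
⌊√⌋-spec (suc n) = √-step-spec n ⌊√ n ⌋ (⌊√⌋-spec n)

1/1+_ : ℕ → ℚ
1/1+ k = inv (ι (suc k)) (ι-pos k)

-- √≈ k q = ⌊√(q(k+1)²)⌋/(k+1) for q ≥ 0, within 1/(k+1) of √q.
√≈ : ℕ → ℚ → ℚ
√≈ k q = ι ⌊√ (ℤ.∣ ℚ.↥ q ∣ ℕ.* (suc k ℕ.* suc k)) ℕ./ ℚ.↧ₙ q ⌋ ℚ.* 1/1+ k

q*denom : ∀ q → 0ℚ ℚ.≤ q → q ℚ.* ι (ℚ.↧ₙ q) ≡ ι ℤ.∣ ℚ.↥ q ∣
q*denom q 0≤q = ℚₚ.toℚᵘ-injective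
  (ℚᵘₚ.≃-trans (ℚₚ.toℚᵘ-homo-* q (ι D))
  (ℚᵘₚ.≃-trans (ℚᵘₚ.*-cong (ℚᵘₚ.≃-refl {ℚ.toℚᵘ q}) (toℚᵘ-ι D))
  (ℚᵘₚ.≃-trans (eq q 0≤q) (ℚᵘₚ.≃-sym (toℚᵘ-ι ℤ.∣ ℚ.↥ q ∣)))))
  where
  D : ℕ
  D = ℚ.↧ₙ q

  eq : ∀ q → 0ℚ ℚ.≤ q → ℚ.toℚᵘ q ℚᵘ.* mkℚᵘ (+ ℚ.↧ₙ q) 0 ℚᵘ.≃ mkℚᵘ (+ ℤ.∣ ℚ.↥ q ∣) 0
  eq (ℚ.mkℚ (+ a) d _) _ = *≡* (trans (ℤₚ.*-identityʳ _)
    (cong (λ z → + a ℤ.* + z) (sym (ℕₚ.*-identityʳ (suc d)))))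
  eq (ℚ.mkℚ (ℤ.-[1+ _ ]) _ _) (ℚ.*≤* ())

√≈-nonneg : ∀ k q → 0ℚ ℚ.≤ √≈ k q
√≈-nonneg k q = 0≤*≤ (ι-nonneg ⌊√ (ℤ.∣ ℚ.↥ q ∣ ℕ.* (suc k ℕ.* suc k)) ℕ./ ℚ.↧ₙ q ⌋) (ℚₚ.<⇒≤ (inv-pos _ (ι-pos k)))

module _ (k : ℕ) (q : ℚ) (0≤q : 0ℚ ℚ.≤ q) where
  private
    K P D F t : ℕ
    K = suc k
    P = ℤ.∣ ℚ.↥ q ∣
    D = ℚ.↧ₙ q
    F = (P ℕ.* (K ℕ.* K)) ℕ./ D
    t = ⌊√ F ⌋

    κ e w : ℚ
    κ = ι K
    e = 1/1+ k
    w = ι D ℚ.* (κ ℚ.* κ)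

    0<w : 0ℚ ℚ.< w
    0<w = 0<*< (ι-pos (ℚ.denominator-1 q)) (0<*< (ι-pos k) (ι-pos k))

    qw : q ℚ.* w ≡ ι (P ℕ.* (K ℕ.* K))
    qw = trans (sym (ℚₚ.*-assoc q (ι D) (κ ℚ.* κ)))
      (trans (cong₂ ℚ._*_ (q*denom q 0≤q) (sym (ι-* K K))) (sym (ι-* P (K ℕ.* K))))

    scaled : ∀ a → (ι a ℚ.* e) ℚ.* (ι a ℚ.* e) ℚ.* w ≡ ι (a ℕ.* a ℕ.* D)
    scaled a = trans
      (solve 4 (λ a e d κ → (a :* e) :* (a :* e) :* (d :* (κ :* κ))
                  := ((κ :* e) :* (κ :* e)) :* ((a :* a) :* d)) refl (ι a) e (ι D) κ)
      (trans (cong₂ (λ u v → (u ℚ.* v) ℚ.* ((ι a ℚ.* ι a) ℚ.* ι D)) (*-inv κ (ι-pos k)) (*-inv κ (ι-pos k)))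
        (trans (ℚₚ.*-identityˡ _)
          (trans (cong (ℚ._* ι D) (sym (ι-* a a))) (sym (ι-* (a ℕ.* a) D)))))

  √≈-lower : √≈ k q ℚ.* √≈ k q ℚ.≤ q
  √≈-lower = ℚₚ.*-cancelʳ-≤-pos w {{ℚ.positive 0<w}}
    (subst₂ ℚ._≤_ (sym (scaled t)) (sym qw) (ι-mono
      (ℕₚ.≤-trans (ℕₚ.*-monoˡ-≤ D (proj₁ (⌊√⌋-spec F))) (ℕ.m/n*n≤m (P ℕ.* (K ℕ.* K)) D))))

  √≈-upper : q ℚ.≤ (√≈ k q ℚ.+ 1/1+ k) ℚ.* (√≈ k q ℚ.+ 1/1+ k)
  √≈-upper = subst (λ z → q ℚ.≤ z ℚ.* z)
    (trans (cong (ℚ._* e) (ι-+ 1 t)) (solve 2 (λ t e → (con 1ℚ :+ t) :* e := t :* e :+ e) refl (ι t) e))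
    (ℚₚ.*-cancelʳ-≤-pos w {{ℚ.positive 0<w}}
      (subst₂ ℚ._≤_ (sym qw) (sym (scaled (suc t))) (ι-mono
        (ℕₚ.≤-trans (subst (ℕ._≤ suc F ℕ.* D) (sym (ℕ.m≡m%n+[m/n]*n (P ℕ.* (K ℕ.* K)) D))
            (ℕₚ.+-monoˡ-≤ (F ℕ.* D) (ℕₚ.<⇒≤ (ℕ.m%n<n (P ℕ.* (K ℕ.* K)) D))))
          (ℕₚ.*-monoˡ-≤ D (proj₂ (⌊√⌋-spec F)))))))

1/1+-anti : ∀ {a b} → a ℕ.≤ b → 1/1+ b ℚ.≤ 1/1+ a
1/1+-anti {a} {b} a≤b = ℚₚ.*-cancelˡ-≤-pos (ι (suc b)) {{ℚ.positive (ι-pos b)}}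
  (subst (ℚ._≤ ι (suc b) ℚ.* 1/1+ a)
    (trans (*-inv (ι (suc a)) (ι-pos a)) (sym (*-inv (ι (suc b)) (ι-pos b))))
    (ℚₚ.*-monoʳ-≤-nonNeg (1/1+ a) {{ℚ.nonNegative (ℚₚ.<⇒≤ (inv-pos _ (ι-pos a)))}}
      (ι-mono (ℕ.s≤s a≤b))))

archimedean : ∀ δ → 0ℚ ℚ.< δ → ∃[ N ] 1/1+ N ℚ.≤ δ
archimedean δ 0<δ = N , ℚₚ.*-cancelʳ-≤-pos (ι (suc N)) {{ℚ.positive (ι-pos N)}}
  (subst₂ ℚ._≤_ (trans (sym (*-inv (ι (suc N)) (ι-pos N))) (ℚₚ.*-comm (ι (suc N)) (1/1+ N)))
    (sym (q*denom δ (ℚₚ.<⇒≤ 0<δ))) (ι-mono {1} (1≤num δ 0<δ)))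
  where
  N : ℕ
  N = ℚ.denominator-1 δ

  1≤num : ∀ δ → 0ℚ ℚ.< δ → 1 ℕ.≤ ℤ.∣ ℚ.↥ δ ∣
  1≤num (ℚ.mkℚ (+ suc _) _ _)    _                = ℕ.s≤s ℕ.z≤n
  1≤num (ℚ.mkℚ (+ zero) _ _)     (*<* (ℤ.+<+ ()))
  1≤num (ℚ.mkℚ ℤ.-[1+ _ ] _ _)   (*<* ())

square-cancel : ∀ {p q} → 0ℚ ℚ.≤ p → 0ℚ ℚ.≤ q → p ℚ.* p ℚ.≤ q ℚ.* q → p ℚ.≤ q
square-cancel {p} {q} 0≤p 0≤q h with p ℚₚ.≤? q
... | yes p≤q = p≤q
... | no  p≰q =
  let q<p = ℚₚ.≰⇒> p≰q
      0<p = ℚₚ.≤-<-trans 0≤q q<p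
      q²≤pq = ℚₚ.*-monoʳ-≤-nonNeg q {{ℚ.nonNegative 0≤q}} (ℚₚ.<⇒≤ q<p)
      pq<p² = ℚₚ.*-monoʳ-<-pos p {{ℚ.positive 0<p}} q<p
  in contradiction refl (ℚₚ.<⇒≢ (ℚₚ.<-≤-trans (ℚₚ.≤-<-trans q²≤pq pq<p²) h))

-- Total: √ x is the square root of max(x, 0).
√_ : ℝ → ℝ
√ x = real s λ ε 0<ε →
  let δ = ½ ℚ.* ε
      0<δ = 0<*< 0<½ 0<ε
      (M , h) = ⊔-cauchy (seq x) 0ℚ (cauchy x) (δ ℚ.* δ) (0<*< 0<δ 0<δ)
      (N , 1/N≤δ) = archimedean δ 0<δ
  in M ℕ.⊔ N , oneSided s λ {m} {n} hm hn →
    let u = 1/1+ n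
        0≤u = ℚₚ.<⇒≤ (inv-pos _ (ι-pos n))
        0≤v = 0≤+≤ (√≈-nonneg n (a n)) 0≤u
        0≤δ = ℚₚ.<⇒≤ 0<δ
        a≤ : a m ℚ.≤ a n ℚ.+ δ ℚ.* δ
        a≤ = ≤-plus {a m} (ℚₚ.≤-trans (p≤∣p∣ _) (h (ℕₚ.m⊔n≤o⇒m≤o M N hm) (ℕₚ.m⊔n≤o⇒m≤o M N hn)))
        s²≤ : s m ℚ.* s m ℚ.≤ (s n ℚ.+ u) ℚ.* (s n ℚ.+ u) ℚ.+ δ ℚ.* δ
        s²≤ = ℚₚ.≤-trans (√≈-lower m (a m) (0≤a m)) (ℚₚ.≤-trans a≤
                (ℚₚ.+-monoˡ-≤ (δ ℚ.* δ) (√≈-upper n (a n) (0≤a n))))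
        s≤ : s m ℚ.≤ s n ℚ.+ u ℚ.+ δ
        s≤ = square-cancel (√≈-nonneg m (a m)) (0≤+≤ 0≤v 0≤δ)
               (ℚₚ.≤-trans s²≤ (sum-squares 0≤v 0≤δ))
        u≤δ = ℚₚ.≤-trans (1/1+-anti (ℕₚ.m⊔n≤o⇒n≤o M N hn)) 1/N≤δ
    in ℚₚ.≤-trans s≤ (subst₂ ℚ._≤_ (sym (ℚₚ.+-assoc (s n) u δ)) (cong (s n ℚ.+_) (half+half ε))
         (ℚₚ.+-monoʳ-≤ (s n) (ℚₚ.+-monoˡ-≤ δ u≤δ)))
  where
  a : ℕ → ℚ
  a k = seq x k ℚ.⊔ 0ℚ

  0≤a : ∀ k → 0ℚ ℚ.≤ a k
  0≤a k = ℚₚ.p≤q⊔p (seq x k) 0ℚ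

  s : ℕ → ℚ
  s k = √≈ k (a k)

  0≤+≤ : ∀ {p q} → 0ℚ ℚ.≤ p → 0ℚ ℚ.≤ q → 0ℚ ℚ.≤ p ℚ.+ q
  0≤+≤ = ℚₚ.+-mono-≤

  sum-squares : ∀ {p q} → 0ℚ ℚ.≤ p → 0ℚ ℚ.≤ q →
    p ℚ.* p ℚ.+ q ℚ.* q ℚ.≤ (p ℚ.+ q) ℚ.* (p ℚ.+ q)
  sum-squares {p} {q} 0≤p 0≤q = subst₂ ℚ._≤_ (ℚₚ.+-identityʳ _)
    (solve 2 (λ p q → (p :* p :+ q :* q) :+ (p :* q :+ p :* q) := (p :+ q) :* (p :+ q)) refl p q)
    (ℚₚ.+-monoʳ-≤ (p ℚ.* p ℚ.+ q ℚ.* q) (0≤+≤ (0≤*≤ 0≤p 0≤q) (0≤*≤ 0≤p 0≤q)))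

-- The vertices are Fin n, so vertex i of {1,…,n} is i - 1 here.
-- A graph is given by the neighbourhoods of its vertices.
Adjacency : ℕ → Set
Adjacency n = Vec (Subset n) n

IsSimple : ∀ {n} → Adjacency n → Set
IsSimple A = (∀ i → i ∉ lookup A i) × (∀ i j → j ∈ lookup A i → i ∈ lookup A j)

degree : ∀ {n} → Adjacency n → Fin n → ℕ
degree A i = ∣ lookup A i ∣

Realizes : ∀ {n} → (Fin n → ℕ) → Adjacency n → Set
Realizes D A = IsSimple A × (∀ i → degree A i ≡ D i)

realizes? : ∀ {n} (D : Fin n → ℕ) → Decidable (Realizes D)
realizes? D A =
  (Finₚ.all? (λ i → ¬? (i ∈? lookup A i)) ×-dec
   Finₚ.all? (λ i → Finₚ.all? (λ j → (j ∈? lookup A i) →-dec (i ∈? lookup A j))))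
  ×-dec Finₚ.all? (λ i → degree A i ℕ.≟ D i)

vectors : ∀ {A : Set} → List A → ∀ n → List (Vec A n)
vectors xs zero    = [] ∷ []
vectors xs (suc n) = cartesianProductWith _∷_ xs (vectors xs n)

adjacencies : ∀ n → List (Adjacency n)
adjacencies n = vectors (vectors (inside ∷ outside ∷ []) n) n

-- By ∈-adjacencies and adjacencies-unique below, each realization occurs exactly once.
𝒢 : ∀ {n} → (Fin n → ℕ) → List (Adjacency n)
𝒢 {n} D = filter (realizes? D) (adjacencies n)

∣𝒢_∣ : ∀ {n} → (Fin n → ℕ) → ℕ
∣𝒢 D ∣ = length (𝒢 D)

Graphic : ∀ {n} → (Fin n → ℕ) → Set
Graphic D = ∃ (Realizes D)

∈-vectors : ∀ {A : Set} {xs : List A} → (∀ x → x Mem.∈ xs) → ∀ {n} (v : Vec A n) → v Mem.∈ vectors xs n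
∈-vectors all []      = here refl
∈-vectors all (x ∷ v) = Memₚ.∈-cartesianProductWith⁺ _∷_ (all x) (∈-vectors all v)

∈-adjacencies : ∀ {n} (A : Adjacency n) → A Mem.∈ adjacencies n
∈-adjacencies = ∈-vectors (∈-vectors λ { inside → here refl ; outside → there (here refl) })

vectors-unique : ∀ {A : Set} {xs : List A} → Unique xs → ∀ n → Unique (vectors xs n)
vectors-unique u zero    = [] ∷ []
vectors-unique u (suc n) = Uniqueₚ.cartesianProductWith⁺ _∷_ ∷-injective u (vectors-unique u n)

adjacencies-unique : ∀ n → Unique (adjacencies n)
adjacencies-unique n = vectors-unique (vectors-unique (((λ ()) ∷ []) ∷ [] ∷ []) n) n

graphic⇒nonZero : ∀ {n} {D : Fin n → ℕ} → Graphic D → ℕ.NonZero ∣𝒢 D ∣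
graphic⇒nonZero {D = D} (A , r) with 𝒢 D | Memₚ.∈-filter⁺ (realizes? D) (∈-adjacencies A) r
... | _ ∷ _ | _ = _

total : ∀ {n} → (Fin n → ℕ) → ℕ
total = sum ℕₚ.+-0-commutativeMonoid

record IsDegreeSequence (n : ℕ) (D : Fin n → ℕ) : Set where
  field
    positive : ∀ i → 1 ℕ.≤ D i
    ≤n-1     : ∀ i → D i ℕ.≤ n ℕ.∸ 1
    even     : 2 ∣ total D

record 𝔻 (n Σ c₁ c₂ : ℕ) (D : Fin n → ℕ) : Set where
  field
    isDegreeSequence : IsDegreeSequence n D
    upper            : ∀ i → D i ℕ.≤ c₁
    lower            : ∀ i → c₂ ℕ.≤ D i
    total≡Σ          : total D ≡ Σ

unitVector : ∀ {n} → Fin n → Fin n → ℕ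
unitVector i k = if does (i Fin.≟ k) then 1 else 0

_+1[_,_] : ∀ {n} → (Fin n → ℕ) → Fin n → Fin n → Fin n → ℕ
(D +1[ i , j ]) k = D k ℕ.+ (unitVector i k ℕ.+ unitVector j k)

sumℚ : ∀ {n} → (Fin n → ℚ) → ℚ
sumℚ = sum ℚₚ.+-0-commutativeMonoid

∂⁺⁺ : ∀ {n} (D : Fin n → ℕ) → Graphic D → ℚ
∂⁺⁺ D g = sumℚ λ i → sumℚ λ j →
  if does (i Fin.<? j) then (+ ∣𝒢 D +1[ i , j ] ∣ ℚ./ ∣𝒢 D ∣) {{graphic⇒nonZero g}} else 0ℚ

{-# OPTIONS --safe #-}
-- Put ℓ = ⌈r/2⌉ + 1. The sequence D is read off a graph made of a clique 𝐚 ∪ 𝐮, an independent set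
-- 𝐯 ∪ 𝐛, all edges between 𝐚 and 𝐮 ∪ 𝐯, the half graph i < j between 𝐮 and 𝐯 (ℓ vertices each), and
-- any bipartite graph between 𝐚 and 𝐛. Every other realization of D differs from it between 𝐚 and 𝐛
-- only, since the half graph is cut out by vertex weights and D fixes the total weight of the edges.
-- Raising the degree of the last 𝐮 and of the first 𝐯 allows 2^⌈r/2⌉ graphs between 𝐮 and 𝐯.
--
-- Write g = c₁ − c₂, d = n − 1 − c₁, M = g + 2ℓ and N = 2(Σ − n c₂) − g(1 + c₁ + c₂). The hypotheses
-- on β and ε give N² + 3(r+3)g(g+1)² ≤ g²Q. Let ∣𝐚∣ = c₂ + z and ∣𝐛∣ = a + d with z + a = g + 1 − 2ℓ.
-- All degrees can be kept in [c₂ , c₁] if the number e of edges between 𝐚 and 𝐛, which is determined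
-- by Σ, lies between c₂∣𝐛∣ and ∣𝐚∣a, an interval of length za − c₂d. The distance from e to its
-- midpoint is ∣M(z − a) − N − 2ℓ∣/4; rounding makes it at most M/4, and then the inequality for N gives
-- (z − a)² + 2M + 4c₂d ≤ (z + a)², that is M/2 ≤ za − c₂d.
module Submission where

-- The edges between 𝐚 and 𝐛 can be placed in an unknown number of ways, so neither count of
-- realizations is computed. Their ratio is bounded by an injection from pairs of a bit vector and a
-- realization of D: the rewiring touches only the block between 𝐮 and 𝐯, where all realizations of
-- D agree, and copies everything else.
--
-- The inequality for N arises as follows. The left side of the second hypothesis is x = ∣N∣/g, so
-- x² ≤ (1 - ε)² Q ≤ Q - εQ. The first hypothesis says β(g + 1)² ≤ Q, hence εQ ≥ εβ(g + 1)². Since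
-- εβg = 3(r + 3), multiplication by g² removes β and ε together. For Cauchy sequences each link
-- holds only up to an error, and the errors have to be collected with a coefficient that does not
-- depend on the index.
--
-- The obstacle in the choice of z is that z + a is fixed, so z - a changes in steps of 2 and e
-- moves relative to the midpoint of its interval in steps of M/2. A distance of M/4 is what
-- rounding can guarantee; the term 3(r + 3) pays for an interval long enough for that.

module Graphs where

  open import Data.Bool using (Bool; true; false; if_then_else_; not)
  open import Data.Fin as Fin using (Fin; zero; suc; toℕ; _↑ˡ_; _↑ʳ_)
  import Data.Fin.Properties as Finₚ
  open import Data.Fin.Subset using (Subset; inside; outside; ∣_∣)
  open import Data.List as List using (List; []; _∷_; length)
  import Data.List.Membership.Propositional as Mem
  import Data.List.Membership.Propositional.Properties as Memₚ
  import Data.List.Membership.Setoid.Properties as MemSₚ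
  import Data.List.Properties as Listₚ
  open import Data.List.Relation.Unary.All as All using ([]; _∷_)
  open import Data.List.Relation.Unary.AllPairs using ([]; _∷_)
  import Data.List.Relation.Unary.Any as Any
  open import Data.List.Relation.Unary.Unique.Propositional using (Unique)
  import Data.List.Relation.Unary.Unique.Propositional.Properties as Uniqueₚ
  open import Data.Nat
  open import Data.Nat.Divisibility using (∣-refl)
  open import Data.Nat.DivMod
  open import Data.Nat.Properties
  open import Data.Nat.Solver using (module +-*-Solver)
  open import Data.Product using (_×_; _,_; proj₁; proj₂)
  open import Data.Sum using (inj₁; inj₂)
  open import Data.Vec using (Vec; []; _∷_; lookup; tabulate)
  import Data.Vec.Properties as Vecₚ
  open import Function using (_∘_)
  open import Relation.Binary.Definitions using (tri<; tri≈; tri>)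
  open import Relation.Binary.PropositionalEquality
  open import Relation.Nullary using (does; yes; no; contradiction; ofʸ; ofⁿ)
  open import Algebra.Properties.CommutativeMonoid.Sum +-0-commutativeMonoid
    using (sum-cong-≗; sum-init-last; sum-replicate-zero; ∑-distrib-+; ∑-comm)
  open import Algebra.Properties.Semiring.Sum +-*-semiring using (*-distribˡ-sum)
  open import Defs using
    ( total; unitVector; _+1[_,_]; Adjacency; IsSimple; Realizes; realizes?; 𝒢; ∣𝒢_∣
    ; vectors; vectors-unique; adjacencies; adjacencies-unique; ∈-adjacencies )
  open +-*-Solver using (solve; _:=_; _:+_; _:*_; con)

  -- Finite sums of natural numbers

  [_]ᵇ : Bool → ℕ
  [ b ]ᵇ = if b then 1 else 0

  []ᵇ≤1 : ∀ b → [ b ]ᵇ ≤ 1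
  []ᵇ≤1 true  = ≤-refl
  []ᵇ≤1 false = z≤n

  total-mono : ∀ {n} {f g : Fin n → ℕ} → (∀ i → f i ≤ g i) → total f ≤ total g
  total-mono {zero}  h = z≤n
  total-mono {suc n} h = +-mono-≤ (h zero) (total-mono (h ∘ suc))

  total-const : ∀ n c → total {n} (λ _ → c) ≡ n * c
  total-const zero    c = refl
  total-const (suc n) c = cong (c +_) (total-const n c)

  total≤ : ∀ {n} (f : Fin n → ℕ) c → (∀ i → f i ≤ c) → total f ≤ n * c
  total≤ {n} f c h = ≤-trans (total-mono h) (≤-reflexive (total-const n c))

  total-++ : ∀ m {n} (f : Fin (m + n) → ℕ) →
    total f ≡ total (f ∘ (_↑ˡ n)) + total (f ∘ (m ↑ʳ_))
  total-++ zero    f = refl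
  total-++ (suc m) f = trans (cong (f zero +_) (total-++ m (f ∘ suc))) (sym (+-assoc (f zero) _ _))

  total-squeeze : ∀ {n} {f g : Fin n → ℕ} → (∀ i → f i ≤ g i) → total f ≡ total g → ∀ i → f i ≡ g i
  total-squeeze {suc n} {f} {g} f≤g eq = λ where
      zero    → ≤-antisym (f≤g zero) (+-cancelʳ-≤ _ (g zero) (f zero)
                  (≤-trans (≤-reflexive (sym eq)) (+-monoʳ-≤ (f zero) (total-mono (f≤g ∘ suc)))))
      (suc i) → total-squeeze (f≤g ∘ suc) tails i
    where
    tails : total (f ∘ suc) ≡ total (g ∘ suc)
    tails = ≤-antisym (total-mono (f≤g ∘ suc)) (+-cancelˡ-≤ (f zero) _ _
      (≤-trans (+-monoˡ-≤ _ (f≤g zero)) (≤-reflexive (sym eq))))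

  telescope : ∀ {n} (F : ℕ → ℕ) (δ : Fin n → ℕ) →
    (∀ j → δ j + F (toℕ j) ≡ F (suc (toℕ j))) → total δ + F 0 ≡ F n
  telescope {zero}  F δ h = refl
  telescope {suc n} F δ h = trans
    (trans (cong (_+ F 0) (+-comm (δ zero) _)) (+-assoc _ (δ zero) (F 0)))
    (trans (cong (total (δ ∘ suc) +_) (h zero)) (telescope (F ∘ suc) (δ ∘ suc) (h ∘ suc)))

  -- Bipartite graphs with nearly equal row sums

  -- Hermite's identity.
  total-/ : ∀ p .{{_ : NonZero p}} T → total {p} (λ i → (T + toℕ i) / p) ≡ T
  total-/ p@(suc p′) zero = trans (sum-cong-≗ {p} (λ i → m<n⇒m/n≡0 (Finₚ.toℕ<n i))) (sum-replicate-zero p)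
  total-/ p@(suc p′) (suc T) = begin
    total {p} (λ i → (suc T + toℕ i) / p)
      ≡⟨ sum-init-last {p′} (λ i → (suc T + toℕ i) / p) ⟩
    total {p′} (λ i → (suc T + toℕ (Fin.inject₁ i)) / p) + (suc T + toℕ (Fin.fromℕ p′)) / p
      ≡⟨ cong₂ _+_ (sum-cong-≗ {p′} (λ i → cong (_/ p) (trans (cong (suc T +_) (Finₚ.toℕ-inject₁ i)) (sym (+-suc T _)))))
           (trans (cong (_/ p) (trans (cong (suc T +_) (Finₚ.toℕ-fromℕ p′)) (sym (+-suc T p′)))) (trans ([m+n]/n T) refl)) ⟩
    total {p′} (λ i → (T + suc (toℕ i)) / p) + suc (T / p)
      ≡⟨ +-suc _ _ ⟩
    suc (total {p′} (λ i → (T + suc (toℕ i)) / p) + T / p)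
      ≡⟨ cong suc (+-comm _ (T / p)) ⟩
    suc (T / p + total {p′} (λ i → (T + suc (toℕ i)) / p))
      ≡⟨ cong (λ u → suc (u / p + total {p′} (λ i → (T + suc (toℕ i)) / p))) (sym (+-identityʳ T)) ⟩
    suc (total {p} (λ i → (T + toℕ i) / p))
      ≡⟨ cong suc (total-/ p T) ⟩
    suc T ∎
    where
    open ≡-Reasoning
    [m+n]/n : ∀ m → (m + p) / p ≡ suc (m / p)
    [m+n]/n m = trans (+-distrib-/-∣ʳ m {p} {p} ∣-refl) (trans (cong (m / p +_) (n/n≡1 p)) (+-comm (m / p) 1))

  -- Turns the increments of a function that grows by at most one per step into matrix entries, so
  -- that sums of entries telescope.
  <ᵇ-difference : ∀ {u v} → u ≤ v → v ≤ suc u → [ u <ᵇ v ]ᵇ + u ≡ v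
  <ᵇ-difference {u} {v} u≤v v≤1+u with u <ᵇ v | <ᵇ-reflects-< u v
  ... | true  | ofʸ u<v = ≤-antisym u<v v≤1+u
  ... | false | ofⁿ u≮v = ≤-antisym u≤v (≮⇒≥ u≮v)

  -- The columns take the rows in cyclic order: c rows each, and up to z further rows each from the
  -- left as long as edges remain. S j counts the edges in the first j columns.
  module _ (c z q e : ℕ) .{{_ : NonZero (c + z)}} (c*q≤e : c * q ≤ e) (e≤p*q : e ≤ (c + z) * q) where
    private
      p x : ℕ
      p = c + z
      x = e ∸ c * q

      S : ℕ → ℕ
      S j = c * j + (x ⊓ (z * j))

      -- The number of the first T edges that land in row i when edges are dealt to the p rows
      -- cyclically, the last row first.
      F : ℕ → ℕ → ℕ
      F i T = (T + i) / p

      S-step-lower : ∀ j → S j + c ≤ S (suc j)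
      S-step-lower j = ≤-trans (≤-reflexive
        (solve 3 (λ c j m → c :* j :+ m :+ c := c :* (con 1 :+ j) :+ m) refl c j (x ⊓ (z * j))))
        (+-monoʳ-≤ (c * suc j) (⊓-monoʳ-≤ x (*-monoʳ-≤ z (n≤1+n j))))

      -- A column of at most p edges meets no row twice in the cyclic order; this makes the
      -- increments of `F` single bits.
      S-step-upper : ∀ j → S (suc j) ≤ S j + p
      S-step-upper j = ≤-trans (+-monoʳ-≤ (c * suc j)
        (≤-trans (⊓-mono-≤ (m≤m+n x z) (≤-reflexive (trans (*-suc z j) (+-comm z _))))
          (≤-reflexive (sym (+-distribʳ-⊓ z x (z * j))))))
        (≤-reflexive (solve 4 (λ c z j m → c :* (con 1 :+ j) :+ (m :+ z) := c :* j :+ m :+ (c :+ z)) refl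
          c z j (x ⊓ (z * j))))

      S-end : S q ≡ e
      S-end = trans (cong (c * q +_) (m≤n⇒m⊓n≡m (+-cancelˡ-≤ (c * q) _ _
        (≤-trans (≤-reflexive (m+[n∸m]≡n c*q≤e)) (≤-trans e≤p*q (≤-reflexive (*-distribʳ-+ q c z)))))))
        (m+[n∸m]≡n c*q≤e)

      S-start : S 0 ≡ 0
      S-start = trans (cong₂ (λ u v → u + (x ⊓ v)) (*-zeroʳ c) (*-zeroʳ z)) (⊓-zeroʳ x)

      step : ∀ (i : Fin p) (j : Fin q) →
        [ F (toℕ i) (S (toℕ j)) <ᵇ F (toℕ i) (S (suc (toℕ j))) ]ᵇ + F (toℕ i) (S (toℕ j))
          ≡ F (toℕ i) (S (suc (toℕ j)))
      step i j = <ᵇ-difference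
        (/-monoˡ-≤ p (+-monoˡ-≤ (toℕ i) (m+n≤o⇒m≤o (S (toℕ j)) (S-step-lower (toℕ j)))))
        (≤-trans (/-monoˡ-≤ p (+-monoˡ-≤ (toℕ i) (S-step-upper (toℕ j))))
          (≤-reflexive (trans (cong (_/ p) (solve 3 (λ s p i → s :+ p :+ i := s :+ i :+ p) refl (S (toℕ j)) p (toℕ i)))
            (trans (+-distrib-/-∣ʳ (S (toℕ j) + toℕ i) {p} {p} ∣-refl)
              (trans (cong (F (toℕ i) (S (toℕ j)) +_) (n/n≡1 p)) (+-comm _ 1))))))

    balanced : Fin p → Fin q → Bool
    balanced i j = F (toℕ i) (S (toℕ j)) <ᵇ F (toℕ i) (S (suc (toℕ j)))

    private
      row-total : ∀ i → total (λ j → [ balanced i j ]ᵇ) ≡ (e + toℕ i) / p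
      row-total i = trans (sym (+-identityʳ _)) (trans
        (cong (total (λ j → [ balanced i j ]ᵇ) +_)
          (sym (trans (cong (F (toℕ i)) S-start) (m<n⇒m/n≡0 (Finₚ.toℕ<n i)))))
        (trans (telescope (λ j → F (toℕ i) (S j)) (λ j → [ balanced i j ]ᵇ) (step i))
          (cong (F (toℕ i)) S-end)))

    balanced-row : ∀ {a} → e ≤ p * a → ∀ i → total (λ j → [ balanced i j ]ᵇ) ≤ a
    balanced-row {a} e≤p*a i = ≤-trans (≤-reflexive (row-total i)) (≤-pred (m<n*o⇒m/o<n
      (≤-trans (+-mono-≤-< e≤p*a (Finₚ.toℕ<n i))
        (≤-reflexive (trans (cong (_+ p) (*-comm p a)) (+-comm (a * p) p))))))

    balanced-total : total (λ i → total (λ j → [ balanced i j ]ᵇ)) ≡ e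
    balanced-total = trans (sum-cong-≗ row-total) (total-/ p e)

    -- Hermite's identity at two consecutive prefixes: the column sum is the difference of
    -- `S (suc j)` and `S j`, which contains the c guaranteed edges.
    balanced-column : ∀ j → c ≤ total (λ i → [ balanced i j ]ᵇ)
    balanced-column j = +-cancelʳ-≤ (S (toℕ j)) _ _
      (≤-trans (≤-reflexive (+-comm c _)) (≤-trans (S-step-lower (toℕ j)) (≤-reflexive (sym eq))))
      where
      eq : total (λ i → [ balanced i j ]ᵇ) + S (toℕ j) ≡ S (suc (toℕ j))
      eq = trans (cong (total (λ i → [ balanced i j ]ᵇ) +_) (sym (total-/ p (S (toℕ j)))))
        (trans (sym (∑-distrib-+ (λ i → [ balanced i j ]ᵇ) (λ i → F (toℕ i) (S (toℕ j)))))
          (trans (sum-cong-≗ (λ i → step i j)) (total-/ p (S (suc (toℕ j))))))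

  -- Alternating paths in the half graph

  -- The strict half graph {(i , j) ∣ i < j} changed along an alternating path from the last row
  -- to the first column; the bits choose the path.
  rerouted : ∀ {m} → Vec Bool m → Fin (suc m) → Fin (suc m) → Bool
  rerouted []          _       _       = true
  rerouted (true  ∷ b) zero    (suc zero)     = false
  rerouted (true  ∷ b) zero    _       = true
  rerouted (true  ∷ b) (suc i) zero    = false
  rerouted (true  ∷ b) (suc i) (suc j) = rerouted b i j
  rerouted (false ∷ b) zero    zero    = false
  rerouted (false ∷ b) zero    (suc j) = true
  rerouted (false ∷ b) (suc i) zero    = rerouted b i zero
  rerouted (false ∷ b) (suc i) (suc zero)     = false
  rerouted (false ∷ b) (suc i) (suc (suc j))  = rerouted b i (suc j)

  rerouted-row : ∀ {m} (b : Vec Bool m) i → total (λ j → [ rerouted b i j ]ᵇ)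
    ≡ total {suc m} (λ j → [ toℕ i <ᵇ toℕ j ]ᵇ) + unitVector (Fin.fromℕ m) i
  rerouted-row []          zero    = refl
  rerouted-row (true  ∷ b) zero    = sym (+-identityʳ _)
  rerouted-row (true  ∷ b) (suc i) = rerouted-row b i
  rerouted-row (false ∷ b) zero    = sym (+-identityʳ _)
  rerouted-row (false ∷ b) (suc i) = rerouted-row b i

  rerouted-column : ∀ {m} (b : Vec Bool m) j → total (λ i → [ rerouted b i j ]ᵇ)
    ≡ total {suc m} (λ i → [ toℕ i <ᵇ toℕ j ]ᵇ) + unitVector zero j
  rerouted-column []          zero   = refl
  rerouted-column {suc m} (true ∷ b) zero = +-comm 1 (total {suc m} (λ _ → 0))
  rerouted-column (true  ∷ b) (suc zero)    = trans (rerouted-column b zero) (trans (+-comm _ 1) (sym (+-identityʳ _)))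
  rerouted-column (true  ∷ b) (suc (suc j)) = cong suc (rerouted-column b (suc j))
  rerouted-column (false ∷ b) zero   = rerouted-column b zero
  rerouted-column (false ∷ b) (suc zero)    = sym (+-identityʳ _)
  rerouted-column (false ∷ b) (suc (suc j)) = cong suc (rerouted-column b (suc j))

  -- The corner entry is the first bit. After `true` the rest of the path lives in the matrix
  -- without row 0 and column 0. After `false` column 0 takes over the role of column 1 in the rows
  -- below, hence the different indices in that case.
  rerouted-injective : ∀ {m} (b b′ : Vec Bool m) → (∀ i j → rerouted b i j ≡ rerouted b′ i j) → b ≡ b′
  rerouted-injective []          []           h = refl
  rerouted-injective (true  ∷ b) (true  ∷ b′) h =
    cong (true ∷_) (rerouted-injective b b′ (λ i j → h (suc i) (suc j)))
  rerouted-injective (false ∷ b) (false ∷ b′) h = cong (false ∷_) (rerouted-injective b b′ λ where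
    i zero    → h (suc i) zero
    i (suc j) → h (suc i) (suc (suc j)))
  rerouted-injective (true  ∷ b) (false ∷ b′) h = contradiction (h zero zero) λ ()
  rerouted-injective (false ∷ b) (true  ∷ b′) h = contradiction (h zero zero) λ ()

  -- Adjacency matrices, and edges forced by vertex weights

  adj : ∀ {n} → Adjacency n → Fin n → Fin n → Bool
  adj A x y = lookup (lookup A x) y

  ∣∣≡total : ∀ {n} (p : Subset n) → ∣ p ∣ ≡ total (λ i → [ lookup p i ]ᵇ)
  ∣∣≡total []            = refl
  ∣∣≡total (inside  ∷ p) = cong suc (∣∣≡total p)
  ∣∣≡total (outside ∷ p) = ∣∣≡total p

  adj-sym : ∀ {n} (A : Adjacency n) → IsSimple A → ∀ x y → adj A x y ≡ adj A y x
  adj-sym A (_ , symmetric) x y = helper (implies x y) (implies y x)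
    where
    implies : ∀ x y → adj A x y ≡ true → adj A y x ≡ true
    implies x y h = Vecₚ.[]=⇒lookup (symmetric x y (Vecₚ.lookup⇒[]= y (lookup A x) h))

    helper : ∀ {a b : Bool} → (a ≡ true → b ≡ true) → (b ≡ true → a ≡ true) → a ≡ b
    helper {true}  {b}     f _ = sym (f refl)
    helper {false} {true}  _ g = g refl
    helper {false} {false} _ _ = refl

  adj-irrefl : ∀ {n} (A : Adjacency n) → IsSimple A → ∀ x → adj A x x ≡ false
  adj-irrefl A (irreflexive , _) x with adj A x x in eq
  ... | false = refl
  ... | true  = contradiction (Vecₚ.lookup⇒[]= x (lookup A x) eq) (irreflexive x)

  adj-degree : ∀ {n} {D : Fin n → ℕ} A → Realizes D A → ∀ x → total (λ y → [ adj A x y ]ᵇ) ≡ D x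
  adj-degree A (_ , degrees) x = trans (sym (∣∣≡total (lookup A x))) (degrees x)

  fromMatrix : ∀ {n} → (Fin n → Fin n → Bool) → Adjacency n
  fromMatrix f = tabulate (tabulate ∘ f)

  adj-fromMatrix : ∀ {n} (f : Fin n → Fin n → Bool) x y → adj (fromMatrix f) x y ≡ f x y
  adj-fromMatrix f x y = trans (cong (λ v → lookup v y) (Vecₚ.lookup∘tabulate (tabulate ∘ f) x))
                               (Vecₚ.lookup∘tabulate (f x) y)

  adj-injective : ∀ {n} {A B : Adjacency n} → (∀ x y → adj A x y ≡ adj B x y) → A ≡ B
  adj-injective {A = A} {B} h = trans (sym (rebuild A))
    (trans (Vecₚ.tabulate-cong (λ x → Vecₚ.tabulate-cong (h x))) (rebuild B))
    where
    rebuild : ∀ A → fromMatrix (adj A) ≡ A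
    rebuild A = trans (Vecₚ.tabulate-cong (λ x → Vecₚ.tabulate∘lookup (lookup A x))) (Vecₚ.tabulate∘lookup A)

  fromMatrix-realizes : ∀ {n} {D : Fin n → ℕ} (f : Fin n → Fin n → Bool) →
    (∀ x → f x x ≡ false) → (∀ x y → f x y ≡ f y x) → (∀ x → total (λ y → [ f x y ]ᵇ) ≡ D x) →
    Realizes D (fromMatrix f)
  fromMatrix-realizes f irreflexive symmetric degrees =
    ( (λ x x∈ → contradiction (trans (sym (Vecₚ.[]=⇒lookup x∈)) (trans (adj-fromMatrix f x x) (irreflexive x))) λ ())
    , (λ x y y∈ → Vecₚ.lookup⇒[]= x (lookup (fromMatrix f) y) (trans (adj-fromMatrix f y x)
        (trans (symmetric y x) (trans (sym (adj-fromMatrix f x y)) (Vecₚ.[]=⇒lookup y∈))))))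
    , (λ x → trans (∣∣≡total (lookup (fromMatrix f) x))
        (trans (sum-cong-≗ (λ y → cong [_]ᵇ (adj-fromMatrix f x y))) (degrees x)))

  -- Regroups the sum by endpoints, using symmetry for the second half. The right side sees `A` only
  -- through `D`, so the left side is an invariant of the realizations.
  weighted-total : ∀ {n} (ω : Fin n → ℕ) {D} A → Realizes D A →
    total (λ x → total (λ y → (ω x + ω y) * [ adj A x y ]ᵇ)) ≡ total (λ x → ω x * D x) + total (λ x → ω x * D x)
  weighted-total {n} ω {D} A R = begin
    total (λ x → total (λ y → (ω x + ω y) * m x y))
      ≡⟨ sum-cong-≗ (λ x → trans (sum-cong-≗ (λ y → *-distribʳ-+ (m x y) (ω x) (ω y)))
                                 (∑-distrib-+ (λ y → ω x * m x y) (λ y → ω y * m x y))) ⟩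
    total (λ x → total (λ y → ω x * m x y) + total (λ y → ω y * m x y))
      ≡⟨ ∑-distrib-+ (λ x → total (λ y → ω x * m x y)) (λ x → total (λ y → ω y * m x y)) ⟩
    total (λ x → total (λ y → ω x * m x y)) + total (λ x → total (λ y → ω y * m x y))
      ≡⟨ cong (total (λ x → total (λ y → ω x * m x y)) +_) (trans (∑-comm (λ x y → ω y * m x y))
           (sum-cong-≗ (λ y → sum-cong-≗ (λ x → cong (λ b → ω y * [ b ]ᵇ) (adj-sym A (proj₁ R) x y))))) ⟩
    total (λ x → total (λ y → ω x * m x y)) + total (λ x → total (λ y → ω x * m x y))
      ≡⟨ cong₂ _+_ rows rows ⟩
    total (λ x → ω x * D x) + total (λ x → ω x * D x) ∎
    where
    open ≡-Reasoning
    m : Fin n → Fin n → ℕ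
    m x y = [ adj A x y ]ᵇ

    rows : total (λ x → total (λ y → ω x * m x y)) ≡ total (λ x → ω x * D x)
    rows = sum-cong-≗ (λ x → trans (sym (*-distribˡ-sum (ω x) (m x))) (cong (ω x *_) (adj-degree A R x)))

  -- Among all graphs with degrees D, a graph whose edges have weight ≥ C and whose non-edges have
  -- weight ≤ C maximises the sum of (weight − C) over the edges; that sum depends on D only.
  module _ {n} (ω : Fin n → ℕ) (C : ℕ) {D : Fin n → ℕ} (A B : Adjacency n) (RA : Realizes D A) (RB : Realizes D B)
    (heavy : ∀ x y → x ≢ y → C < ω x + ω y → adj A x y ≡ true)
    (light : ∀ x y → ω x + ω y < C → adj A x y ≡ false) where
    private
      a b : Fin n → Fin n → ℕ
      a x y = [ adj A x y ]ᵇ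
      b x y = [ adj B x y ]ᵇ

      w : Fin n → Fin n → ℕ
      w x y = ω x + ω y

      light-≤ : ∀ {w} → w ≤ C → ∀ q → w * [ q ]ᵇ + C * 0 ≤ w * 0 + C * [ q ]ᵇ
      light-≤ {w} w≤C false = ≤-refl
      light-≤ {w} w≤C true  rewrite *-zeroʳ C | *-zeroʳ w | +-identityʳ (w * 1) = *-monoˡ-≤ 1 w≤C

      heavy-≤ : ∀ {w} → C ≤ w → ∀ q → w * [ q ]ᵇ + C * 1 ≤ w * 1 + C * [ q ]ᵇ
      heavy-≤ {w} C≤w true  = ≤-refl
      heavy-≤ {w} C≤w false rewrite *-zeroʳ C | *-zeroʳ w | +-identityʳ (w * 1) = *-monoˡ-≤ 1 C≤w

      -- This is (w - C)(a - b) ≥ 0 without subtraction: the sign of w - C dictates the entry a, and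
      -- b lies between 0 and 1. On the diagonal both entries vanish.
      termwise : ∀ x y → w x y * b x y + C * a x y ≤ w x y * a x y + C * b x y
      termwise x y with x Fin.≟ y
      ... | yes refl rewrite adj-irrefl A (proj₁ RA) x | adj-irrefl B (proj₁ RB) x = ≤-refl
      ... | no x≢y with <-cmp (w x y) C
      ... | tri≈ _ w≡C _ rewrite w≡C = ≤-reflexive (+-comm (C * b x y) _)
      ... | tri< w<C _ _ rewrite light x y w<C =
        light-≤ (<⇒≤ w<C) (adj B x y)
      ... | tri> _ _ C<w rewrite heavy x y x≢y C<w = heavy-≤ (<⇒≤ C<w) (adj B x y)

      split : ∀ (u v : Fin n → Fin n → ℕ) → total (λ x → total (λ y → w x y * u x y + C * v x y))
        ≡ total (λ x → total (λ y → w x y * u x y)) + total (λ x → C * total (v x))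
      split u v = trans
        (sum-cong-≗ (λ x → trans (∑-distrib-+ (λ y → w x y * u x y) (λ y → C * v x y))
          (cong (total (λ y → w x y * u x y) +_) (sym (*-distribˡ-sum C (v x))))))
        (∑-distrib-+ (λ x → total (λ y → w x y * u x y)) (λ x → C * total (v x)))

      totals : total (λ x → total (λ y → w x y * b x y + C * a x y))
             ≡ total (λ x → total (λ y → w x y * a x y + C * b x y))
      totals = trans (split b a) (trans
        (cong₂ _+_ (trans (weighted-total ω B RB) (sym (weighted-total ω A RA)))
          (sum-cong-≗ (λ x → cong (C *_) (trans (adj-degree A RA x) (sym (adj-degree B RB x))))))
        (sym (split a b)))

      tight : ∀ x y → w x y * b x y + C * a x y ≡ w x y * a x y + C * b x y
      tight x = total-squeeze (termwise x) (total-squeeze (λ x → total-mono (termwise x)) totals x)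

      cancel : ∀ {w} → w ≢ C → ∀ p q → w * [ q ]ᵇ + C * [ p ]ᵇ ≡ w * [ p ]ᵇ + C * [ q ]ᵇ → q ≡ p
      cancel w≢C true  true  _ = refl
      cancel w≢C false false _ = refl
      cancel {w} w≢C true  false h rewrite *-zeroʳ w | *-zeroʳ C | +-identityʳ (w * 1) | *-identityʳ w | *-identityʳ C =
        contradiction (sym h) w≢C
      cancel {w} w≢C false true  h rewrite *-zeroʳ w | *-zeroʳ C | +-identityʳ (w * 1) | *-identityʳ w | *-identityʳ C =
        contradiction h w≢C

    weights-force : ∀ x y → ω x + ω y ≢ C → adj B x y ≡ adj A x y
    weights-force x y w≢C = cancel w≢C (adj A x y) (adj B x y) (tight x y)

  -- Counting by injections, and indicator functions

  lookup-injective : ∀ {X : Set} {xs : List X} → Unique xs →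
    ∀ i j → List.lookup xs i ≡ List.lookup xs j → i ≡ j
  lookup-injective (x∉ ∷ u) zero    zero    _  = refl
  lookup-injective (x∉ ∷ u) zero    (suc j) eq = contradiction eq (All.lookup x∉ (Memₚ.∈-lookup j))
  lookup-injective (x∉ ∷ u) (suc i) zero    eq = contradiction (sym eq) (All.lookup x∉ (Memₚ.∈-lookup i))
  lookup-injective (x∉ ∷ u) (suc i) (suc j) eq = cong suc (lookup-injective u i j eq)

  -- Passing to positions in the lists reduces this to injections between finite ordinals.
  -- Injectivity is asked on `xs` alone because `switched` overwrites a block and can be inverted
  -- only where that block is known.
  length-injection : ∀ {X Y : Set} {xs : List X} {ys : List Y} → Unique xs → (f : X → Y) →
    (∀ {x} → x Mem.∈ xs → f x Mem.∈ ys) →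
    (∀ {x x′} → x Mem.∈ xs → x′ Mem.∈ xs → f x ≡ f x′ → x ≡ x′) → length xs ≤ length ys
  length-injection {Y = Y} u f f∈ f-inj = Finₚ.injective⇒≤ {f = λ i → Any.index (f∈ (Memₚ.∈-lookup i))}
    λ {i} {j} eq → lookup-injective u i j (f-inj (Memₚ.∈-lookup i) (Memₚ.∈-lookup j)
      (MemSₚ.index-injective (setoid Y) (f∈ (Memₚ.∈-lookup i)) (f∈ (Memₚ.∈-lookup j)) eq))

  length-cartesianProductWith : ∀ {X Y Z : Set} (f : X → Y → Z) xs ys →
    length (List.cartesianProductWith f xs ys) ≡ length xs * length ys
  length-cartesianProductWith f []       ys = refl
  length-cartesianProductWith f (x ∷ xs) ys = trans (Listₚ.length-++ (List.map (f x) ys))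
    (cong₂ _+_ (Listₚ.length-map (f x) ys) (length-cartesianProductWith f xs ys))

  length-vectors : ∀ {X : Set} (xs : List X) n → length (vectors xs n) ≡ length xs ^ n
  length-vectors xs zero    = refl
  length-vectors xs (suc n) = trans (length-cartesianProductWith _∷_ xs (vectors xs n))
    (cong (length xs *_) (length-vectors xs n))

  unitVector-≢ : ∀ {n} {x y : Fin n} → x ≢ y → unitVector x y ≡ 0
  unitVector-≢ {x = x} {y} x≢y with x Fin.≟ y
  ... | yes x≡y = contradiction x≡y x≢y
  ... | no  _   = refl

  unitVector-image : ∀ {k n} (f : Fin k → Fin n) → (∀ {a b} → f a ≡ f b → a ≡ b) →
    ∀ a b → unitVector (f a) (f b) ≡ unitVector a b
  unitVector-image f f-inj a b with f a Fin.≟ f b | a Fin.≟ b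
  ... | yes _   | yes _   = refl
  ... | no  _   | no  _   = refl
  ... | yes eq  | no a≢b  = contradiction (f-inj eq) a≢b
  ... | no  neq | yes eq  = contradiction (cong f eq) neq

  _≠ᵇ_ : ∀ {n} → Fin n → Fin n → Bool
  i ≠ᵇ j = not (does (i Fin.≟ j))

  ≠ᵇ-irrefl : ∀ {n} (i : Fin n) → i ≠ᵇ i ≡ false
  ≠ᵇ-irrefl zero    = refl
  ≠ᵇ-irrefl (suc i) = ≠ᵇ-irrefl i

  ≢⇒≠ᵇ : ∀ {n} {i j : Fin n} → i ≢ j → i ≠ᵇ j ≡ true
  ≢⇒≠ᵇ {i = i} {j} i≢j with i Fin.≟ j
  ... | yes i≡j = contradiction i≡j i≢j
  ... | no  _   = refl

  ≠ᵇ-sym : ∀ {n} (i j : Fin n) → i ≠ᵇ j ≡ j ≠ᵇ i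
  ≠ᵇ-sym zero    zero    = refl
  ≠ᵇ-sym zero    (suc j) = refl
  ≠ᵇ-sym (suc i) zero    = refl
  ≠ᵇ-sym (suc i) (suc j) = ≠ᵇ-sym i j

  total-≠ᵇ : ∀ {m} (i : Fin (suc m)) → total (λ j → [ i ≠ᵇ j ]ᵇ) ≡ m
  total-≠ᵇ {m}     zero    = trans (total-const m 1) (*-identityʳ m)
  total-≠ᵇ {suc m} (suc i) = cong suc (total-≠ᵇ i)

  _<ᶠ_ : ∀ {n} → Fin n → Fin n → Bool
  i <ᶠ j = toℕ i <ᵇ toℕ j

  <ᶠ-trichotomy : ∀ {n} (i j : Fin n) → [ i <ᶠ j ]ᵇ + [ j <ᶠ i ]ᵇ ≡ [ i ≠ᵇ j ]ᵇ
  <ᶠ-trichotomy zero    zero    = refl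
  <ᶠ-trichotomy zero    (suc j) = refl
  <ᶠ-trichotomy (suc i) zero    = refl
  <ᶠ-trichotomy (suc i) (suc j) = <ᶠ-trichotomy i j

  <ᶠ-true : ∀ {n} {i j : Fin n} → toℕ i < toℕ j → i <ᶠ j ≡ true
  <ᶠ-true {i = i} {j} i<j with toℕ i <ᵇ toℕ j | <ᵇ-reflects-< (toℕ i) (toℕ j)
  ... | true  | _       = refl
  ... | false | ofⁿ i≮j = contradiction i<j i≮j

  <ᶠ-false : ∀ {n} {i j : Fin n} → toℕ j ≤ toℕ i → i <ᶠ j ≡ false
  <ᶠ-false {i = i} {j} j≤i with toℕ i <ᵇ toℕ j | <ᵇ-reflects-< (toℕ i) (toℕ j)
  ... | false | _       = refl
  ... | true  | ofʸ i<j = contradiction i<j (≤⇒≯ j≤i)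

  -- Row k and column k of the half graph together meet every index other than k exactly once. Both
  -- sums occur because its edges count for the degrees in 𝐮 and again for those in 𝐯.
  half-total : ∀ m → total {suc m} (λ i → total {suc m} (λ j → [ i <ᶠ j ]ᵇ)) +
                     total {suc m} (λ j → total {suc m} (λ i → [ i <ᶠ j ]ᵇ)) ≡ suc m * m
  half-total m = begin
    total row + total col                                  ≡⟨ sym (∑-distrib-+ row col) ⟩
    total (λ k → row k + col k)                            ≡⟨ sum-cong-≗ {suc m} (λ k → trans
        (sym (∑-distrib-+ (λ j → [ k <ᶠ j ]ᵇ) (λ i → [ i <ᶠ k ]ᵇ)))
        (trans (sum-cong-≗ {suc m} (<ᶠ-trichotomy k)) (total-≠ᵇ {m} k))) ⟩
    total {suc m} (λ _ → m)                                ≡⟨ total-const (suc m) m ⟩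
    suc m * m                                              ∎
    where
    open ≡-Reasoning
    row col : Fin (suc m) → ℕ
    row i = total {suc m} (λ j → [ i <ᶠ j ]ᵇ)
    col j = total {suc m} (λ i → [ i <ᶠ j ]ᵇ)

  -- The composed graph and its threshold weights

  module Composition (p m q : ℕ) (cross : Fin p → Fin q → Bool) where

    ℓ n : ℕ
    ℓ = suc m
    n = p + (ℓ + (ℓ + q))

    data Kind : Set where
      𝐚 : Fin p → Kind
      𝐮 : Fin ℓ → Kind
      𝐯 : Fin ℓ → Kind
      𝐛 : Fin q → Kind

    vertex : Kind → Fin n
    vertex (𝐚 i) = i ↑ˡ (ℓ + (ℓ + q))
    vertex (𝐮 i) = p ↑ʳ (i ↑ˡ (ℓ + q))
    vertex (𝐯 i) = p ↑ʳ (ℓ ↑ʳ (i ↑ˡ q))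
    vertex (𝐛 i) = p ↑ʳ (ℓ ↑ʳ (ℓ ↑ʳ i))

    kind : Fin n → Kind
    kind x with Fin.splitAt p x
    ... | inj₁ i = 𝐚 i
    ... | inj₂ x with Fin.splitAt ℓ x
    ...   | inj₁ i = 𝐮 i
    ...   | inj₂ x with Fin.splitAt ℓ x
    ...     | inj₁ i = 𝐯 i
    ...     | inj₂ i = 𝐛 i

    kind-vertex : ∀ κ → kind (vertex κ) ≡ κ
    kind-vertex (𝐚 i) rewrite Finₚ.splitAt-↑ˡ p i (ℓ + (ℓ + q)) = refl
    kind-vertex (𝐮 i) rewrite Finₚ.splitAt-↑ʳ p (ℓ + (ℓ + q)) (i ↑ˡ (ℓ + q))
      | Finₚ.splitAt-↑ˡ ℓ i (ℓ + q) = refl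
    kind-vertex (𝐯 i) rewrite Finₚ.splitAt-↑ʳ p (ℓ + (ℓ + q)) (ℓ ↑ʳ (i ↑ˡ q))
      | Finₚ.splitAt-↑ʳ ℓ (ℓ + q) (i ↑ˡ q) | Finₚ.splitAt-↑ˡ ℓ i q = refl
    kind-vertex (𝐛 i) rewrite Finₚ.splitAt-↑ʳ p (ℓ + (ℓ + q)) (ℓ ↑ʳ (ℓ ↑ʳ i))
      | Finₚ.splitAt-↑ʳ ℓ (ℓ + q) (ℓ ↑ʳ i) | Finₚ.splitAt-↑ʳ ℓ q i = refl

    vertex-kind : ∀ x → vertex (kind x) ≡ x
    vertex-kind x with Fin.splitAt p x in eq₁
    ... | inj₁ i = Finₚ.splitAt⁻¹-↑ˡ eq₁
    ... | inj₂ y with Fin.splitAt ℓ y in eq₂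
    ...   | inj₁ i = trans (cong (p ↑ʳ_) (Finₚ.splitAt⁻¹-↑ˡ eq₂)) (Finₚ.splitAt⁻¹-↑ʳ {m = p} eq₁)
    ...   | inj₂ z with Fin.splitAt ℓ z in eq₃
    ...     | inj₁ i = trans (cong (λ z → p ↑ʳ (ℓ ↑ʳ z)) (Finₚ.splitAt⁻¹-↑ˡ eq₃))
                        (trans (cong (p ↑ʳ_) (Finₚ.splitAt⁻¹-↑ʳ {m = ℓ} eq₂)) (Finₚ.splitAt⁻¹-↑ʳ {m = p} eq₁))
    ...     | inj₂ i = trans (cong (λ z → p ↑ʳ (ℓ ↑ʳ z)) (Finₚ.splitAt⁻¹-↑ʳ {m = ℓ} eq₃))
                        (trans (cong (p ↑ʳ_) (Finₚ.splitAt⁻¹-↑ʳ {m = ℓ} eq₂)) (Finₚ.splitAt⁻¹-↑ʳ {m = p} eq₁))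

    vertex-injective : ∀ {κ λ′} → vertex κ ≡ vertex λ′ → κ ≡ λ′
    vertex-injective eq = trans (sym (kind-vertex _)) (trans (cong kind eq) (kind-vertex _))

    by-kind : (P : Fin n → Set) → (∀ κ → P (vertex κ)) → ∀ x → P x
    by-kind P h x = subst P (vertex-kind x) (h (kind x))

    total-kinds : ∀ (f : Fin n → ℕ) → total f ≡
      total (f ∘ vertex ∘ 𝐚) + (total (f ∘ vertex ∘ 𝐮) + (total (f ∘ vertex ∘ 𝐯) + total (f ∘ vertex ∘ 𝐛)))
    total-kinds f = trans (total-++ p f) (cong (total (f ∘ vertex ∘ 𝐚) +_)
      (trans (total-++ ℓ (f ∘ (p ↑ʳ_))) (cong (total (f ∘ vertex ∘ 𝐮) +_) (total-++ ℓ (f ∘ (p ↑ʳ_) ∘ (ℓ ↑ʳ_))))))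

    join : Kind → Kind → Bool
    join (𝐚 i) (𝐚 j) = i ≠ᵇ j
    join (𝐚 _) (𝐮 _) = true
    join (𝐚 _) (𝐯 _) = true
    join (𝐚 i) (𝐛 j) = cross i j
    join (𝐮 _) (𝐚 _) = true
    join (𝐮 i) (𝐮 j) = i ≠ᵇ j
    join (𝐮 i) (𝐯 j) = i <ᶠ j
    join (𝐮 _) (𝐛 _) = false
    join (𝐯 _) (𝐚 _) = true
    join (𝐯 j) (𝐮 i) = i <ᶠ j
    join (𝐯 _) (𝐯 _) = false
    join (𝐯 _) (𝐛 _) = false
    join (𝐛 j) (𝐚 i) = cross i j
    join (𝐛 _) (𝐮 _) = false
    join (𝐛 _) (𝐯 _) = false
    join (𝐛 _) (𝐛 _) = false

    join-irrefl : ∀ κ → join κ κ ≡ false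
    join-irrefl (𝐚 i) = ≠ᵇ-irrefl i
    join-irrefl (𝐮 i) = ≠ᵇ-irrefl i
    join-irrefl (𝐯 i) = refl
    join-irrefl (𝐛 i) = refl

    join-sym : ∀ κ λ′ → join κ λ′ ≡ join λ′ κ
    join-sym (𝐚 i) (𝐚 j) = ≠ᵇ-sym i j
    join-sym (𝐚 _) (𝐮 _) = refl
    join-sym (𝐚 _) (𝐯 _) = refl
    join-sym (𝐚 _) (𝐛 _) = refl
    join-sym (𝐮 _) (𝐚 _) = refl
    join-sym (𝐮 i) (𝐮 j) = ≠ᵇ-sym i j
    join-sym (𝐮 _) (𝐯 _) = refl
    join-sym (𝐮 _) (𝐛 _) = refl
    join-sym (𝐯 _) (𝐚 _) = refl
    join-sym (𝐯 _) (𝐮 _) = refl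
    join-sym (𝐯 _) (𝐯 _) = refl
    join-sym (𝐯 _) (𝐛 _) = refl
    join-sym (𝐛 _) (𝐚 _) = refl
    join-sym (𝐛 _) (𝐮 _) = refl
    join-sym (𝐛 _) (𝐯 _) = refl
    join-sym (𝐛 _) (𝐛 _) = refl

    matrix : Fin n → Fin n → Bool
    matrix x y = join (kind x) (kind y)

    graph : Adjacency n
    graph = fromMatrix matrix

    D : Fin n → ℕ
    D x = total (λ y → [ matrix x y ]ᵇ)

    graph-realizes : Realizes D graph
    graph-realizes = fromMatrix-realizes matrix (λ x → join-irrefl (kind x)) (λ x y → join-sym (kind x) (kind y)) (λ _ → refl)

    private
      -- The sum of the weights of 𝐮 i and 𝐯 j is K + 1 + 2(j - i), which exceeds C = K + 2 exactly
      -- when i < j and never equals it, by parity. The summand 4ℓ in K lets every 𝐮 weigh at least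
      -- C/2 while every 𝐯 weighs at most K/2. A vertex of 𝐚 with one of 𝐛 gives C exactly, so the
      -- weights leave the cross edges free.
      K C : ℕ
      K = 2 + 4 * ℓ
      C = 2 + K

      weight : Kind → ℕ
      weight (𝐚 _) = C
      weight (𝐮 i) = K ∸ 2 * toℕ i
      weight (𝐯 j) = 1 + 2 * toℕ j
      weight (𝐛 _) = 0

      2i≤2ℓ : (i : Fin ℓ) → 2 * toℕ i ≤ 2 * ℓ
      2i≤2ℓ i = *-monoʳ-≤ 2 (<⇒≤ (Finₚ.toℕ<n i))

      K-split : K ≡ 2 * ℓ + (2 + 2 * ℓ)
      K-split = solve 1 (λ l → con 2 :+ con 4 :* l := con 2 :* l :+ (con 2 :+ con 2 :* l)) refl ℓ

      2i≤K : (i : Fin ℓ) → 2 * toℕ i ≤ K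
      2i≤K i = ≤-trans (2i≤2ℓ i) (≤-trans (m≤m+n _ _) (≤-reflexive (sym K-split)))

      weight-𝐮 : ∀ i → weight (𝐮 i) + 2 * toℕ i ≡ K
      weight-𝐮 i = m∸n+n≡m (2i≤K i)

      weight-𝐮𝐯 : ∀ i j → weight (𝐮 i) + weight (𝐯 j) + 2 * toℕ i ≡ K + (1 + 2 * toℕ j)
      weight-𝐮𝐯 i j = trans (solve 3 (λ u v w → u :+ v :+ w := u :+ w :+ v) refl (weight (𝐮 i)) (weight (𝐯 j)) (2 * toℕ i))
        (cong (_+ (1 + 2 * toℕ j)) (weight-𝐮 i))

      C-shift : ∀ i → C + 2 * toℕ {ℓ} i ≡ K + (2 + 2 * toℕ i)
      C-shift i = solve 2 (λ k i → con 2 :+ k :+ i := k :+ (con 2 :+ i)) refl K (2 * toℕ i)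

      heavy-𝐮𝐯 : ∀ i j → C < weight (𝐮 i) + weight (𝐯 j) → toℕ i < toℕ j
      heavy-𝐮𝐯 i j C<w = *-cancelˡ-< 2 _ _ (≤-trans (≤-reflexive refl) (≤-pred (<⇒≤ (+-cancelˡ-< K _ _
        (subst₂ _<_ (C-shift i) (weight-𝐮𝐯 i j) (+-monoˡ-< (2 * toℕ i) C<w))))))

      light-𝐮𝐯 : ∀ i j → weight (𝐮 i) + weight (𝐯 j) < C → toℕ j ≤ toℕ i
      light-𝐮𝐯 i j w<C = *-cancelˡ-≤ 2 (≤-pred (≤-pred (+-cancelˡ-< K _ _
        (subst₂ _<_ (weight-𝐮𝐯 i j) (C-shift i) (+-monoˡ-< (2 * toℕ i) w<C)))))

      ≢-𝐮𝐯 : ∀ i j → weight (𝐮 i) + weight (𝐯 j) ≢ C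
      ≢-𝐮𝐯 i j eq = even≢odd (toℕ j) (toℕ i) (suc-injective (+-cancelˡ-≡ K _ _
        (trans (sym (weight-𝐮𝐯 i j)) (trans (cong (_+ 2 * toℕ i) eq) (C-shift i)))))

      weight-𝐮≤ : ∀ i → weight (𝐮 i) ≤ K
      weight-𝐮≤ i = m∸n≤m K (2 * toℕ i)

      weight-𝐯≤ : ∀ i → weight (𝐯 i) ≤ 1 + 2 * ℓ
      weight-𝐯≤ i = s≤s (2i≤2ℓ i)

      weight-𝐮≥ : ∀ i → 2 + 2 * ℓ ≤ weight (𝐮 i)
      weight-𝐮≥ i = +-cancelʳ-≤ (2 * toℕ i) _ _ (≤-trans (+-monoʳ-≤ (2 + 2 * ℓ) (2i≤2ℓ i))
        (≤-reflexive (trans (trans (+-comm _ (2 * ℓ)) (sym K-split)) (sym (weight-𝐮 i)))))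

      K-𝐯𝐯 : (1 + 2 * ℓ) + (1 + 2 * ℓ) ≡ K
      K-𝐯𝐯 = solve 1 (λ l → (con 1 :+ con 2 :* l) :+ (con 1 :+ con 2 :* l) := con 2 :+ con 4 :* l) refl ℓ

      C-𝐮𝐮 : C ≡ (2 + 2 * ℓ) + (2 + 2 * ℓ)
      C-𝐮𝐮 = solve 1 (λ l → con 2 :+ (con 2 :+ con 4 :* l) := (con 2 :+ con 2 :* l) :+ (con 2 :+ con 2 :* l)) refl ℓ

      ≤K⇒≯C : ∀ {w} {X : Set} → w ≤ K → C < w → X
      ≤K⇒≯C w≤K C<w = contradiction (≤-trans C<w (≤-trans w≤K (m≤n+m K 2))) (<-irrefl refl)

      heavy : ∀ κ λ′ → κ ≢ λ′ → C < weight κ + weight λ′ → join κ λ′ ≡ true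
      heavy (𝐚 i) (𝐚 j) κ≢ _ = ≢⇒≠ᵇ (λ i≡j → κ≢ (cong 𝐚 i≡j))
      heavy (𝐚 _) (𝐮 _) _ _ = refl
      heavy (𝐚 _) (𝐯 _) _ _ = refl
      heavy (𝐚 i) (𝐛 j) _ h = contradiction (subst (C <_) (+-identityʳ C) h) (<-irrefl refl)
      heavy (𝐮 _) (𝐚 _) _ _ = refl
      heavy (𝐮 i) (𝐮 j) κ≢ _ = ≢⇒≠ᵇ (λ i≡j → κ≢ (cong 𝐮 i≡j))
      heavy (𝐮 i) (𝐯 j) _ h = <ᶠ-true (heavy-𝐮𝐯 i j h)
      heavy (𝐮 i) (𝐛 _) _ h = ≤K⇒≯C (≤-trans (≤-reflexive (+-identityʳ _)) (weight-𝐮≤ i)) h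
      heavy (𝐯 _) (𝐚 _) _ _ = refl
      heavy (𝐯 j) (𝐮 i) _ h = <ᶠ-true (heavy-𝐮𝐯 i j (subst (C <_) (+-comm (weight (𝐯 j)) _) h))
      heavy (𝐯 i) (𝐯 j) _ h = ≤K⇒≯C (≤-trans (+-mono-≤ (weight-𝐯≤ i) (weight-𝐯≤ j)) (≤-reflexive K-𝐯𝐯)) h
      heavy (𝐯 i) (𝐛 _) _ h = ≤K⇒≯C (≤-trans (+-mono-≤ (weight-𝐯≤ i) z≤n) (≤-reflexive K-𝐯𝐯)) h
      heavy (𝐛 j) (𝐚 i) _ h = contradiction h (<-irrefl refl)
      heavy (𝐛 _) (𝐮 i) _ h = ≤K⇒≯C (weight-𝐮≤ i) h
      heavy (𝐛 _) (𝐯 i) _ h = ≤K⇒≯C (≤-trans (weight-𝐯≤ i) (≤-trans (m≤m+n _ (1 + 2 * ℓ)) (≤-reflexive K-𝐯𝐯))) h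
      heavy (𝐛 _) (𝐛 _) _ ()

      ≥C⇒≮C : ∀ {w} {X : Set} → C ≤ w → w < C → X
      ≥C⇒≮C C≤w w<C = contradiction (≤-trans w<C C≤w) (<-irrefl refl)

      light : ∀ κ λ′ → weight κ + weight λ′ < C → join κ λ′ ≡ false
      light (𝐚 i) λ′ h = ≥C⇒≮C (m≤m+n C (weight λ′)) h
      light κ@(𝐮 _) (𝐚 _) h = ≥C⇒≮C (m≤n+m C (weight κ)) h
      light κ@(𝐯 _) (𝐚 _) h = ≥C⇒≮C (m≤n+m C (weight κ)) h
      light κ@(𝐛 _) (𝐚 _) h = ≥C⇒≮C (m≤n+m C (weight κ)) h
      light (𝐮 i) (𝐮 j) h = ≥C⇒≮C (≤-trans (≤-reflexive C-𝐮𝐮) (+-mono-≤ (weight-𝐮≥ i) (weight-𝐮≥ j))) h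
      light (𝐮 i) (𝐯 j) h = <ᶠ-false (light-𝐮𝐯 i j h)
      light (𝐮 _) (𝐛 _) _ = refl
      light (𝐯 j) (𝐮 i) h = <ᶠ-false (light-𝐮𝐯 i j (subst (_< C) (+-comm (weight (𝐯 j)) _) h))
      light (𝐯 _) (𝐯 _) _ = refl
      light (𝐯 _) (𝐛 _) _ = refl
      light (𝐛 _) (𝐮 _) _ = refl
      light (𝐛 _) (𝐯 _) _ = refl
      light (𝐛 _) (𝐛 _) _ = refl

    -- By parity the pairs between 𝐮 and 𝐯 never lie at the threshold, so there every realization
    -- agrees with `graph`.
    half-forced : ∀ B → Realizes D B → ∀ i j → adj B (vertex (𝐮 i)) (vertex (𝐯 j)) ≡ i <ᶠ j
    half-forced B RB i j = trans
      (weights-force (weight ∘ kind) C graph B graph-realizes RB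
        (λ x y x≢y h → trans (adj-fromMatrix matrix x y) (heavy (kind x) (kind y)
          (λ eq → x≢y (trans (sym (vertex-kind x)) (trans (cong vertex eq) (vertex-kind y)))) h))
        (λ x y h → trans (adj-fromMatrix matrix x y) (light (kind x) (kind y) h))
        (vertex (𝐮 i)) (vertex (𝐯 j))
        (subst₂ (λ κ λ′ → weight κ + weight λ′ ≢ C) (sym (kind-vertex (𝐮 i))) (sym (kind-vertex (𝐯 j))) (≢-𝐮𝐯 i j)))
      (trans (adj-fromMatrix matrix (vertex (𝐮 i)) (vertex (𝐯 j)))
        (cong₂ join (kind-vertex (𝐮 i)) (kind-vertex (𝐯 j))))

    -- Switching along an alternating path

    switch : Vec Bool m → Kind → Kind → Bool → Bool
    switch b (𝐮 i) (𝐯 j) _ = rerouted b i j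
    switch b (𝐯 j) (𝐮 i) _ = rerouted b i j
    switch b _     _     t = t

    switched : Vec Bool m → Adjacency n → Adjacency n
    switched b B = fromMatrix (λ x y → switch b (kind x) (kind y) (adj B x y))

    private
      switch-irrefl : ∀ b κ t → switch b κ κ t ≡ t
      switch-irrefl b (𝐚 _) t = refl
      switch-irrefl b (𝐮 _) t = refl
      switch-irrefl b (𝐯 _) t = refl
      switch-irrefl b (𝐛 _) t = refl

      switch-sym : ∀ b κ λ′ t → switch b κ λ′ t ≡ switch b λ′ κ t
      switch-sym b (𝐚 _) (𝐚 _) t = refl
      switch-sym b (𝐚 _) (𝐮 _) t = refl
      switch-sym b (𝐚 _) (𝐯 _) t = refl
      switch-sym b (𝐚 _) (𝐛 _) t = refl
      switch-sym b (𝐮 _) (𝐚 _) t = refl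
      switch-sym b (𝐮 _) (𝐮 _) t = refl
      switch-sym b (𝐮 _) (𝐯 _) t = refl
      switch-sym b (𝐮 _) (𝐛 _) t = refl
      switch-sym b (𝐯 _) (𝐚 _) t = refl
      switch-sym b (𝐯 _) (𝐮 _) t = refl
      switch-sym b (𝐯 _) (𝐯 _) t = refl
      switch-sym b (𝐯 _) (𝐛 _) t = refl
      switch-sym b (𝐛 _) (𝐚 _) t = refl
      switch-sym b (𝐛 _) (𝐮 _) t = refl
      switch-sym b (𝐛 _) (𝐯 _) t = refl
      switch-sym b (𝐛 _) (𝐛 _) t = refl

    unitVector-kinds : ∀ κ λ′ → κ ≢ λ′ → unitVector (vertex κ) (vertex λ′) ≡ 0
    unitVector-kinds κ λ′ κ≢λ′ = unitVector-≢ {x = vertex κ} {vertex λ′} (κ≢λ′ ∘ vertex-injective)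

    source sink : Fin n
    source = vertex (𝐮 (Fin.fromℕ m))
    sink   = vertex (𝐯 zero)

    -- `∂⁺⁺` runs over ordered pairs i < j; placing the block 𝐮 before 𝐯 makes this pair one of
    -- them.
    source<sink : source Fin.< sink
    source<sink = subst₂ _<_ (sym (Finₚ.toℕ-↑ʳ p (Fin.fromℕ m ↑ˡ (ℓ + q)))) (sym (Finₚ.toℕ-↑ʳ p (ℓ ↑ʳ zero {m + q})))
      (+-monoʳ-< p (subst₂ _<_ (sym (Finₚ.toℕ-↑ˡ (Fin.fromℕ m) (ℓ + q))) (sym (Finₚ.toℕ-↑ʳ ℓ (zero {m + q})))
        (≤-trans (Finₚ.toℕ<n (Fin.fromℕ m)) (m≤m+n ℓ 0))))

    module _ (B : Adjacency n) (RB : Realizes D B) (b : Vec Bool m) where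
      private
        M : Fin n → Fin n → ℕ
        M x y = [ switch b (kind x) (kind y) (adj B x y) ]ᵇ

        M-vertex : ∀ κ λ′ → M (vertex κ) (vertex λ′) ≡ [ switch b κ λ′ (adj B (vertex κ) (vertex λ′)) ]ᵇ
        M-vertex κ λ′ = cong₂ (λ κ′ λ″ → [ switch b κ′ λ″ (adj B (vertex κ) (vertex λ′)) ]ᵇ) (kind-vertex κ) (kind-vertex λ′)

        increment : Fin n → ℕ
        increment x = unitVector source x + unitVector sink x

        no-increment : ∀ κ → (∀ i → κ ≢ 𝐮 i) → (∀ i → κ ≢ 𝐯 i) → increment (vertex κ) ≡ 0
        no-increment κ ≢𝐮 ≢𝐯 = cong₂ _+_
          (unitVector-kinds (𝐮 (Fin.fromℕ m)) κ (≢𝐮 _ ∘ sym)) (unitVector-kinds (𝐯 zero) κ (≢𝐯 _ ∘ sym))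

        unchanged : ∀ κ → (∀ λ′ t → switch b κ λ′ t ≡ t) → increment (vertex κ) ≡ 0 →
          total (M (vertex κ)) ≡ D (vertex κ) + increment (vertex κ)
        unchanged κ h z = trans (sum-cong-≗ {n} (λ y → cong [_]ᵇ
            (trans (cong (λ κ′ → switch b κ′ (kind y) (adj B (vertex κ) y)) (kind-vertex κ)) (h (kind y) _))))
          (trans (adj-degree B RB (vertex κ)) (trans (sym (+-identityʳ _)) (cong (D (vertex κ) +_) (sym z))))

        half-forced′ : ∀ i j → adj B (vertex (𝐯 j)) (vertex (𝐮 i)) ≡ i <ᶠ j
        half-forced′ i j = trans (adj-sym B (proj₁ RB) _ _) (half-forced B RB i j)

        increment-𝐮 : ∀ i → increment (vertex (𝐮 i)) ≡ unitVector (Fin.fromℕ m) i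
        increment-𝐮 i = trans (cong₂ _+_
          (unitVector-image (vertex ∘ 𝐮) (λ eq → 𝐮-injective (vertex-injective eq)) (Fin.fromℕ m) i)
          (unitVector-kinds (𝐯 zero) (𝐮 i) λ ())) (+-identityʳ _)
          where
          𝐮-injective : ∀ {a b} → 𝐮 a ≡ 𝐮 b → a ≡ b
          𝐮-injective refl = refl

        increment-𝐯 : ∀ i → increment (vertex (𝐯 i)) ≡ unitVector zero i
        increment-𝐯 i = cong₂ _+_ (unitVector-kinds (𝐮 (Fin.fromℕ m)) (𝐯 i) λ ())
          (unitVector-image (vertex ∘ 𝐯) (λ eq → 𝐯-injective (vertex-injective eq)) zero i)
          where
          𝐯-injective : ∀ {a b} → 𝐯 a ≡ 𝐯 b → a ≡ b
          𝐯-injective refl = refl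

        -- Rows of 𝐚 and 𝐛 are copied. In a row of 𝐮 or 𝐯 one block is replaced, and since `B`
        -- carries the half graph there, the sums of `rerouted` exceed the old ones by exactly the
        -- required unit vector.
        degrees : ∀ κ → total (M (vertex κ)) ≡ D (vertex κ) + increment (vertex κ)
        degrees (𝐚 i) = unchanged (𝐚 i) (λ _ _ → refl) (no-increment (𝐚 i) (λ _ ()) (λ _ ()))
        degrees (𝐛 i) = unchanged (𝐛 i) (λ _ _ → refl) (no-increment (𝐛 i) (λ _ ()) (λ _ ()))
        degrees (𝐮 i) = begin
          total (M x)
            ≡⟨ total-kinds (M x) ⟩
          total (M x ∘ vertex ∘ 𝐚) + (total (M x ∘ vertex ∘ 𝐮) + (total (M x ∘ vertex ∘ 𝐯) + total (M x ∘ vertex ∘ 𝐛)))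
            ≡⟨ cong₂ _+_ (sum-cong-≗ (M-vertex (𝐮 i) ∘ 𝐚)) (cong₂ _+_ (sum-cong-≗ {ℓ} (M-vertex (𝐮 i) ∘ 𝐮))
                 (cong₂ _+_ (sum-cong-≗ {ℓ} (M-vertex (𝐮 i) ∘ 𝐯)) (sum-cong-≗ (M-vertex (𝐮 i) ∘ 𝐛)))) ⟩
          total (d ∘ 𝐚) + (total (d ∘ 𝐮) + (total (λ j → [ rerouted b i j ]ᵇ) + total (d ∘ 𝐛)))
            ≡⟨ cong (λ t → total (d ∘ 𝐚) + (total (d ∘ 𝐮) + (t + total (d ∘ 𝐛)))) (trans (rerouted-row b i)
                 (cong (_+ unitVector (Fin.fromℕ m) i) (sum-cong-≗ {ℓ} (λ j → cong [_]ᵇ (sym (half-forced B RB i j)))))) ⟩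
          total (d ∘ 𝐚) + (total (d ∘ 𝐮) + (total (d ∘ 𝐯) + unitVector (Fin.fromℕ m) i + total (d ∘ 𝐛)))
            ≡⟨ solve 5 (λ a u v e b → a :+ (u :+ (v :+ e :+ b)) := a :+ (u :+ (v :+ b)) :+ e) refl
                 (total (d ∘ 𝐚)) (total (d ∘ 𝐮)) (total (d ∘ 𝐯)) (unitVector (Fin.fromℕ m) i) (total (d ∘ 𝐛)) ⟩
          total (d ∘ 𝐚) + (total (d ∘ 𝐮) + (total (d ∘ 𝐯) + total (d ∘ 𝐛))) + unitVector (Fin.fromℕ m) i
            ≡⟨ cong₂ _+_ (trans (sym (total-kinds (λ y → [ adj B x y ]ᵇ))) (adj-degree B RB x)) (sym (increment-𝐮 i)) ⟩
          D x + increment x ∎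
          where
          open ≡-Reasoning
          x : Fin n
          x = vertex (𝐮 i)
          d : Kind → ℕ
          d κ = [ adj B x (vertex κ) ]ᵇ
        degrees (𝐯 j) = begin
          total (M x)
            ≡⟨ total-kinds (M x) ⟩
          total (M x ∘ vertex ∘ 𝐚) + (total (M x ∘ vertex ∘ 𝐮) + (total (M x ∘ vertex ∘ 𝐯) + total (M x ∘ vertex ∘ 𝐛)))
            ≡⟨ cong₂ _+_ (sum-cong-≗ (M-vertex (𝐯 j) ∘ 𝐚)) (cong₂ _+_ (sum-cong-≗ {ℓ} (M-vertex (𝐯 j) ∘ 𝐮))
                 (cong₂ _+_ (sum-cong-≗ {ℓ} (M-vertex (𝐯 j) ∘ 𝐯)) (sum-cong-≗ (M-vertex (𝐯 j) ∘ 𝐛)))) ⟩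
          total (d ∘ 𝐚) + (total (λ i → [ rerouted b i j ]ᵇ) + (total (d ∘ 𝐯) + total (d ∘ 𝐛)))
            ≡⟨ cong (λ t → total (d ∘ 𝐚) + (t + (total (d ∘ 𝐯) + total (d ∘ 𝐛)))) (trans (rerouted-column b j)
                 (cong (_+ unitVector zero j) (sum-cong-≗ {ℓ} (λ i → cong [_]ᵇ (sym (half-forced′ i j)))))) ⟩
          total (d ∘ 𝐚) + (total (d ∘ 𝐮) + unitVector zero j + (total (d ∘ 𝐯) + total (d ∘ 𝐛)))
            ≡⟨ solve 4 (λ a u e r → a :+ (u :+ e :+ r) := a :+ (u :+ r) :+ e) refl
                 (total (d ∘ 𝐚)) (total (d ∘ 𝐮)) (unitVector zero j) (total (d ∘ 𝐯) + total (d ∘ 𝐛)) ⟩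
          total (d ∘ 𝐚) + (total (d ∘ 𝐮) + (total (d ∘ 𝐯) + total (d ∘ 𝐛))) + unitVector zero j
            ≡⟨ cong₂ _+_ (trans (sym (total-kinds (λ y → [ adj B x y ]ᵇ))) (adj-degree B RB x)) (sym (increment-𝐯 j)) ⟩
          D x + increment x ∎
          where
          open ≡-Reasoning
          x : Fin n
          x = vertex (𝐯 j)
          d : Kind → ℕ
          d κ = [ adj B x (vertex κ) ]ᵇ

      switched-realizes : Realizes (D +1[ source , sink ]) (switched b B)
      switched-realizes = fromMatrix-realizes (λ x y → switch b (kind x) (kind y) (adj B x y))
        (λ x → trans (switch-irrefl b (kind x) (adj B x x)) (adj-irrefl B (proj₁ RB) x))
        (λ x y → trans (switch-sym b (kind x) (kind y) _)
          (cong (switch b (kind y) (kind x)) (adj-sym B (proj₁ RB) x y)))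
        (by-kind (λ x → total (M x) ≡ D x + increment x) degrees)

    -- The block between 𝐮 and 𝐯 of the image reveals the bits. Outside it the image is a copy of
    -- `B`, and inside it `B` has no freedom.
    switched-injective : ∀ {b b′ B B′} → Realizes D B → Realizes D B′ →
      switched b B ≡ switched b′ B′ → b ≡ b′ × B ≡ B′
    switched-injective {b} {b′} {B} {B′} RB RB′ eq =
        rerouted-injective b b′ (λ i j → entries (𝐮 i) (𝐯 j))
      , adj-injective {A = B} {B′} (by-kind _ λ κ → by-kind _ λ λ′ → same κ λ′)
      where
      at : ∀ b B κ λ′ → adj (switched b B) (vertex κ) (vertex λ′) ≡ switch b κ λ′ (adj B (vertex κ) (vertex λ′))
      at b B κ λ′ = trans (adj-fromMatrix (λ x y → switch b (kind x) (kind y) (adj B x y)) (vertex κ) (vertex λ′))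
        (cong₂ (λ κ′ λ″ → switch b κ′ λ″ (adj B (vertex κ) (vertex λ′))) (kind-vertex κ) (kind-vertex λ′))

      entries : ∀ κ λ′ → switch b κ λ′ (adj B (vertex κ) (vertex λ′)) ≡ switch b′ κ λ′ (adj B′ (vertex κ) (vertex λ′))
      entries κ λ′ = trans (sym (at b B κ λ′))
        (trans (cong (λ G → adj G (vertex κ) (vertex λ′)) eq) (at b′ B′ κ λ′))

      same : ∀ κ λ′ → adj B (vertex κ) (vertex λ′) ≡ adj B′ (vertex κ) (vertex λ′)
      same (𝐮 i) (𝐯 j) = trans (half-forced B RB i j) (sym (half-forced B′ RB′ i j))
      same (𝐯 j) (𝐮 i) = trans (adj-sym B (proj₁ RB) _ _) (trans (same (𝐮 i) (𝐯 j)) (adj-sym B′ (proj₁ RB′) _ _))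
      same (𝐚 i) λ′    = entries (𝐚 i) λ′
      same (𝐛 i) λ′    = entries (𝐛 i) λ′
      same (𝐮 i) (𝐚 j) = entries (𝐮 i) (𝐚 j)
      same (𝐮 i) (𝐮 j) = entries (𝐮 i) (𝐮 j)
      same (𝐮 i) (𝐛 j) = entries (𝐮 i) (𝐛 j)
      same (𝐯 i) (𝐚 j) = entries (𝐯 i) (𝐚 j)
      same (𝐯 i) (𝐯 j) = entries (𝐯 i) (𝐯 j)
      same (𝐯 i) (𝐛 j) = entries (𝐯 i) (𝐛 j)

    many-realizations : 2 ^ m * ∣𝒢 D ∣ ≤ ∣𝒢 D +1[ source , sink ] ∣
    many-realizations = ≤-trans
      (≤-reflexive (sym (trans (length-cartesianProductWith _,_ bits (𝒢 D)) (cong (_* ∣𝒢 D ∣) (length-vectors _ m)))))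
      (length-injection
        (Uniqueₚ.cartesianProduct⁺ (vectors-unique (((λ ()) ∷ []) ∷ [] ∷ []) m)
          (Uniqueₚ.filter⁺ (realizes? D) (adjacencies-unique n)))
        (λ (b , B) → switched b B)
        (λ {bB} ∈ → Memₚ.∈-filter⁺ (realizes? (D +1[ source , sink ])) (∈-adjacencies (switched (proj₁ bB) (proj₂ bB)))
          (switched-realizes (proj₂ bB) (realizes ∈) (proj₁ bB)))
        (λ ∈ ∈′ eq → let (b≡ , B≡) = switched-injective (realizes ∈) (realizes ∈′) eq in cong₂ _,_ b≡ B≡))
      where
      bits : List.List (Vec Bool m)
      bits = vectors (inside ∷ outside ∷ []) m

      realizes : ∀ {bB} → bB Mem.∈ List.cartesianProduct bits (𝒢 D) → Realizes D (proj₂ bB)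
      realizes ∈ = proj₂ (Memₚ.∈-filter⁻ (realizes? D) {xs = adjacencies n} (proj₂ (Memₚ.∈-cartesianProduct⁻ bits (𝒢 D) ∈)))

    -- Degrees of the composed graph

    private
      row : Fin p → ℕ
      row i = total (λ j → [ cross i j ]ᵇ)

      column : Fin q → ℕ
      column j = total (λ i → [ cross i j ]ᵇ)

      above below : Fin ℓ → ℕ
      above i = total {ℓ} (λ j → [ i <ᶠ j ]ᵇ)
      below j = total {ℓ} (λ i → [ i <ᶠ j ]ᵇ)

      others : ∀ {k} → Fin k → ℕ
      others i = total (λ j → [ i ≠ᵇ j ]ᵇ)

      suc-others : ∀ {k} (i : Fin k) → suc (others i) ≡ k
      suc-others {suc k} i = cong suc (total-≠ᵇ i)

      ones : ∀ k → total {k} (λ _ → 1) ≡ k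
      ones k = trans (total-const k 1) (*-identityʳ k)

      D-kinds : ∀ κ → D (vertex κ) ≡ total (λ i → [ join κ (𝐚 i) ]ᵇ)
        + (total (λ i → [ join κ (𝐮 i) ]ᵇ) + (total (λ i → [ join κ (𝐯 i) ]ᵇ) + total (λ i → [ join κ (𝐛 i) ]ᵇ)))
      D-kinds κ = trans (total-kinds (λ y → [ matrix (vertex κ) y ]ᵇ))
        (cong₂ _+_ (sum-cong-≗ (eq ∘ 𝐚)) (cong₂ _+_ (sum-cong-≗ {ℓ} (eq ∘ 𝐮))
          (cong₂ _+_ (sum-cong-≗ {ℓ} (eq ∘ 𝐯)) (sum-cong-≗ (eq ∘ 𝐛)))))
        where
        eq : ∀ λ′ → [ matrix (vertex κ) (vertex λ′) ]ᵇ ≡ [ join κ λ′ ]ᵇ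
        eq λ′ = cong₂ (λ κ λ″ → [ join κ λ″ ]ᵇ) (kind-vertex κ) (kind-vertex λ′)

      zeros : ∀ k → total {k} (λ _ → 0) ≡ 0
      zeros = sum-replicate-zero

      -- Shifted by one so that the clique contributes p instead of a truncated p - 1. Summed over
      -- 𝐚, the shift becomes the summand p beside `total D` in `D-total`.
      D-𝐚 : ∀ i → suc (D (vertex (𝐚 i))) ≡ p + 2 * ℓ + row i
      D-𝐚 i = trans (cong suc (D-kinds (𝐚 i))) (trans
        (cong₂ (λ u v → u + (v + (v + row i))) (suc-others i) (ones ℓ))
        (solve 3 (λ p l r → p :+ (l :+ (l :+ r)) := p :+ con 2 :* l :+ r) refl p ℓ (row i)))

      D-𝐮 : ∀ i → D (vertex (𝐮 i)) ≡ p + m + above i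
      D-𝐮 i = trans (D-kinds (𝐮 i)) (trans
        (cong₂ _+_ (ones p) (cong₂ _+_ (total-≠ᵇ i) (trans (cong (above i +_) (zeros q)) (+-identityʳ _))))
        (sym (+-assoc p m (above i))))

      D-𝐯 : ∀ j → D (vertex (𝐯 j)) ≡ p + below j
      D-𝐯 j = trans (D-kinds (𝐯 j)) (cong₂ _+_ (ones p)
        (trans (cong (below j +_) (cong₂ _+_ (zeros ℓ) (zeros q))) (+-identityʳ _)))

      D-𝐛 : ∀ j → D (vertex (𝐛 j)) ≡ column j
      D-𝐛 j = trans (D-kinds (𝐛 j))
        (trans (cong (column j +_) (cong₂ _+_ (zeros ℓ) (cong₂ _+_ (zeros ℓ) (zeros q)))) (+-identityʳ _))

      above≤ : ∀ i → above i ≤ ℓ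
      above≤ i = ≤-trans (total≤ {ℓ} _ 1 (λ j → []ᵇ≤1 (i <ᶠ j))) (≤-reflexive (*-identityʳ ℓ))

      below≤ : ∀ j → below j ≤ ℓ
      below≤ j = ≤-trans (total≤ {ℓ} _ 1 (λ i → []ᵇ≤1 (i <ᶠ j))) (≤-reflexive (*-identityʳ ℓ))

    -- Every vertex outside 𝐛 has degree at least p: a vertex of 𝐚 misses itself but sees all of 𝐮
    -- and 𝐯. Only 𝐛 depends on the columns of `cross`.
    D-lower : ∀ {c} → c ≤ p → (∀ j → c ≤ total (λ i → [ cross i j ]ᵇ)) → ∀ x → c ≤ D x
    D-lower {c} c≤p c≤column = by-kind (λ x → c ≤ D x) λ where
      (𝐚 i) → ≤-pred (≤-trans (s≤s c≤p) (≤-trans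
        (≤-trans (≤-reflexive (+-comm 1 p)) (≤-trans (+-monoʳ-≤ p (s≤s z≤n)) (m≤m+n _ (row i))))
        (≤-reflexive (sym (D-𝐚 i)))))
      (𝐮 i) → ≤-trans c≤p (≤-trans (m≤m+n p m) (≤-trans (m≤m+n _ _) (≤-reflexive (sym (D-𝐮 i)))))
      (𝐯 i) → ≤-trans c≤p (≤-trans (m≤m+n p _) (≤-reflexive (sym (D-𝐯 i))))
      (𝐛 i) → ≤-trans (c≤column i) (≤-reflexive (sym (D-𝐛 i)))

    -- The bound is set by 𝐚, with degrees up to (p - 1) + 2ℓ + a. The other kinds stay within p +
    -- 2m + 1.
    D-upper : ∀ {a} → (∀ i → total (λ j → [ cross i j ]ᵇ) ≤ a) → ∀ x → D x ≤ p + (2 * m + 1) + a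
    D-upper {a} row≤a = by-kind (λ x → D x ≤ p + (2 * m + 1) + a) λ where
      (𝐚 i) → ≤-pred (≤-trans (≤-reflexive (D-𝐚 i)) (≤-trans (+-monoʳ-≤ (p + 2 * ℓ) (row≤a i))
        (≤-reflexive (solve 3 (λ p m a → p :+ con 2 :* (con 1 :+ m) :+ a := con 1 :+ (p :+ (con 2 :* m :+ con 1) :+ a)) refl p m a))))
      (𝐮 i) → ≤-trans (≤-reflexive (D-𝐮 i)) (≤-trans (+-monoʳ-≤ (p + m) (above≤ i))
        (≤-trans (≤-reflexive (solve 2 (λ p m → p :+ m :+ (con 1 :+ m) := p :+ (con 2 :* m :+ con 1)) refl p m)) (m≤m+n _ a)))
      (𝐯 i) → ≤-trans (≤-reflexive (D-𝐯 i)) (≤-trans (+-monoʳ-≤ p (≤-trans (below≤ i)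
        (≤-trans (m≤n+m ℓ m) (≤-reflexive (solve 1 (λ m → m :+ (con 1 :+ m) := con 2 :* m :+ con 1) refl m))))) (m≤m+n _ a))
      (𝐛 i) → ≤-trans (≤-reflexive (D-𝐛 i)) (≤-trans (total≤ _ 1 (λ k → []ᵇ≤1 (cross k i)))
        (≤-trans (≤-reflexive (*-identityʳ p)) (≤-trans (m≤m+n p _) (m≤m+n _ a))))

    D-total : total D + p ≡ p * p + 4 * ℓ * p + 2 * ℓ * m + 2 * total (λ i → total (λ j → [ cross i j ]ᵇ))
    D-total = begin
      total D + p
        ≡⟨ cong (_+ p) (total-kinds D) ⟩
      total (D ∘ vertex ∘ 𝐚) + (total (D ∘ vertex ∘ 𝐮) + (total (D ∘ vertex ∘ 𝐯) + total (D ∘ vertex ∘ 𝐛))) + p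
        ≡⟨ solve 3 (λ a r p → a :+ r :+ p := p :+ a :+ r) refl (total (D ∘ vertex ∘ 𝐚)) _ p ⟩
      p + total (D ∘ vertex ∘ 𝐚) + (total (D ∘ vertex ∘ 𝐮) + (total (D ∘ vertex ∘ 𝐯) + total (D ∘ vertex ∘ 𝐛)))
        ≡⟨ cong₂ _+_ heads (cong₂ _+_ uppers (cong₂ _+_ lowers tails)) ⟩
      p * (p + 2 * ℓ) + e + (ℓ * (p + m) + U + (ℓ * p + V + e))
        ≡⟨ solve 6 (λ p l m U V e → p :* (p :+ con 2 :* l) :+ e :+ (l :* (p :+ m) :+ U :+ (l :* p :+ V :+ e))
             := p :* p :+ con 4 :* l :* p :+ l :* m :+ (U :+ V) :+ con 2 :* e) refl p ℓ m U V e ⟩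
      p * p + 4 * ℓ * p + ℓ * m + (U + V) + 2 * e
        ≡⟨ cong (λ t → p * p + 4 * ℓ * p + ℓ * m + t + 2 * e) (half-total m) ⟩
      p * p + 4 * ℓ * p + ℓ * m + ℓ * m + 2 * e
        ≡⟨ solve 4 (λ p l m e → p :* p :+ con 4 :* l :* p :+ l :* m :+ l :* m :+ con 2 :* e
             := p :* p :+ con 4 :* l :* p :+ con 2 :* l :* m :+ con 2 :* e) refl p ℓ m e ⟩
      p * p + 4 * ℓ * p + 2 * ℓ * m + 2 * e ∎
      where
      open ≡-Reasoning
      e U V : ℕ
      e = total row
      U = total above
      V = total below

      add-const : ∀ {k} (f : Fin k → ℕ) c → total (λ i → c + f i) ≡ k * c + total f
      add-const {k} f c = trans (∑-distrib-+ (λ _ → c) f) (cong (_+ total f) (total-const k c))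

      heads : p + total (D ∘ vertex ∘ 𝐚) ≡ p * (p + 2 * ℓ) + e
      heads = trans (cong (_+ total (D ∘ vertex ∘ 𝐚)) (sym (*-identityʳ p)))
        (trans (sym (add-const (D ∘ vertex ∘ 𝐚) 1)) (trans (sum-cong-≗ D-𝐚) (add-const row (p + 2 * ℓ))))

      uppers : total (D ∘ vertex ∘ 𝐮) ≡ ℓ * (p + m) + U
      uppers = trans (sum-cong-≗ {ℓ} D-𝐮) (add-const above (p + m))

      lowers : total (D ∘ vertex ∘ 𝐯) ≡ ℓ * p + V
      lowers = trans (sum-cong-≗ {ℓ} D-𝐯) (add-const below p)

      tails : total (D ∘ vertex ∘ 𝐛) ≡ e
      tails = trans (sum-cong-≗ D-𝐛) (∑-comm (λ j i → [ cross i j ]ᵇ))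

-- Choosing z and a by rounding

module Arithmetic where

  open import Data.Integer as ℤ using (ℤ; +_)
  import Data.Integer.DivMod as ℤD
  import Data.Integer.Properties as ℤₚ
  import Data.Integer.Solver as ℤS
  open import Data.Nat
  open import Data.Nat.Divisibility
    using (_∣_; divides; quotient; m∣n⇒n≡m*quotient; ∣m+n∣m⇒∣n; ∣m∣n⇒∣m+n; m∣m*n)
  open import Data.Nat.Properties
  open import Data.Nat.Solver using (module +-*-Solver)
  open import Data.Product using (∃-syntax; _×_; _,_; proj₁; proj₂)
  open import Data.Sum using (inj₁; inj₂)
  open import Relation.Binary.PropositionalEquality
  open import Relation.Nullary using (contradiction; yes; no)
  module ℤSolver = ℤS.+-*-Solver
  open ℤSolver using () renaming (_:+_ to _⊕_; _:*_ to _⊗_; _:-_ to _⊝_; _:=_ to _⩴_)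
  open +-*-Solver using (solve; _:=_; _:+_; _:*_; con)

  ≤-from-+ : ∀ {x y} k → x + k ≡ y → x ≤ y
  ≤-from-+ k refl = m≤m+n _ k

  square-cancel-≤ : ∀ {x y} → x * x ≤ y * y → x ≤ y
  square-cancel-≤ {x} {y} h with x ≤? y
  ... | yes x≤y = x≤y
  ... | no  x≰y = contradiction (*-mono-< (≰⇒> x≰y) (≰⇒> x≰y)) (≤⇒≯ h)

  module _ (c g d R N m : ℕ) .{{_ : NonZero g}} (3≤R : 3 ≤ R) (2ℓ≤R : 2 * suc m ≤ R)
    (key : N * N + 3 * R * g * (suc g * suc g) + 4 * (g * g) * (c * d) ≤ (g * g) * (suc g * suc g)) where
    private
      -- k = M + 2ℓ is the total error in `M * Y ≤ N + k`: M from rounding and 2ℓ from the offset of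
      -- the midpoint. L = 2M + 4ℓh collects the desired margin 2M and the mixed term of (h - 2ℓ)².
      -- W clears the denominators g and M.
      ℓ h k M W L : ℕ
      ℓ = suc m
      h = suc g
      k = g + 4 * ℓ
      M = g + 2 * ℓ
      W = (g * g) * (M * M)
      L = 2 * g + 4 * ℓ * (g + 2)

      instance
        M≢0 : NonZero M
        M≢0 = >-nonZero (≤-trans (s≤s z≤n) (m≤n+m (2 * ℓ) g))
        g²≢0 : NonZero (g * g)
        g²≢0 = m*n≢0 g g
        M²≢0 : NonZero (M * M)
        M²≢0 = m*n≢0 M M
        W≢0 : NonZero W
        W≢0 = m*n≢0 (g * g) (M * M)
        gh²≢0 : NonZero (g * (h * h))
        gh²≢0 = m*n≢0 g (h * h)

    -- The middle term of `key` alone must fit under the right side. As 2ℓ ≤ R, this leaves room for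
    -- both halves of the half graph and keeps the subtraction in `t` from truncating.
    3R≤g : 3 * R ≤ g
    3R≤g = *-cancelʳ-≤ (3 * R) g (g * (h * h)) (≤-trans
      (≤-trans (≤-reflexive (sym (*-assoc (3 * R) g (h * h))))
        (≤-trans (m≤n+m _ (N * N)) (m≤m+n _ (4 * (g * g) * (c * d)))))
      (≤-trans key (≤-reflexive (*-assoc g g (h * h)))))

    private
      N≤gh : N ≤ g * h
      N≤gh = square-cancel-≤ (≤-trans (≤-trans (≤-trans (m≤m+n (N * N) _) (m≤m+n _ _)) key)
        (≤-reflexive (solve 2 (λ g h → (g :* g) :* (h :* h) := (g :* h) :* (g :* h)) refl g h)))

      -- Here the constant 3(r + 3) is spent. For ℓ ≥ 2, 3R ≥ 6ℓ leaves 2ℓ(g + 2) ≥ 4(g + 2) beyond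
      -- the term 4ℓ(g + 2) of `L`, enough for the remaining terms. For ℓ = 1 the bound 2ℓ ≤ R is
      -- too weak and 3 ≤ R takes its place.
      slope : ∀ m → 2 * suc m ≤ R → 2 * g + 4 * suc m * (g + 2) + (2 * g + 4) ≤ 3 * R * (g + 2) + 4 * (suc m * suc m)
      slope zero _ = ≤-trans (≤-from-+ (g + 10) (solve 1 (λ g →
          con 2 :* g :+ con 4 :* (g :+ con 2) :+ (con 2 :* g :+ con 4) :+ (g :+ con 10)
            := con 9 :* (g :+ con 2) :+ con 4) refl g))
        (+-monoˡ-≤ 4 (*-monoˡ-≤ (g + 2) (*-monoʳ-≤ 3 3≤R)))
      slope (suc m) 2ℓ≤R = ≤-trans (≤-from-+ (2 * m * g + 4 * m + 4 + 4 * ((2 + m) * (2 + m))) (solve 2 (λ g m →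
          con 2 :* g :+ con 4 :* (con 2 :+ m) :* (g :+ con 2) :+ (con 2 :* g :+ con 4)
            :+ (con 2 :* m :* g :+ con 4 :* m :+ con 4 :+ con 4 :* ((con 2 :+ m) :* (con 2 :+ m)))
            := con 3 :* (con 2 :* (con 2 :+ m)) :* (g :+ con 2) :+ con 4 :* ((con 2 :+ m) :* (con 2 :+ m))) refl g m))
        (+-monoˡ-≤ (4 * ((2 + m) * (2 + m))) (*-monoˡ-≤ (g + 2) (*-monoʳ-≤ 3 2ℓ≤R)))

      -- The left side is the excess (N + k)² - N² with N replaced by its maximum gh. The factor M²
      -- on the right is the one that `bound` divides out.
      cubic : 2 * k * (g * h) + k * k ≤ (M * M) * (2 * g + 4)
      cubic = ≤-from-+ (8 * (ℓ * ℓ) * g + g * g) (solve 2 (λ g l →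
        con 2 :* (g :+ con 4 :* l) :* (g :* (con 1 :+ g)) :+ (g :+ con 4 :* l) :* (g :+ con 4 :* l)
          :+ (con 8 :* (l :* l) :* g :+ g :* g)
          := ((g :+ con 2 :* l) :* (g :+ con 2 :* l)) :* (con 2 :* g :+ con 4)) refl g ℓ)

      quartic : 2 * k * (g * h) + k * k + (M * M) * L ≤ (M * M) * (3 * R * (g + 2) + 4 * (ℓ * ℓ))
      quartic = ≤-trans (+-monoˡ-≤ ((M * M) * L) cubic) (≤-trans
        (≤-reflexive (trans (+-comm _ ((M * M) * L)) (sym (*-distribˡ-+ (M * M) L (2 * g + 4)))))
        (*-monoʳ-≤ (M * M) (slope m 2ℓ≤R)))

      gh²-lower : g * g * (g + 2) ≤ g * (h * h)
      gh²-lower = ≤-from-+ g (solve 1 (λ g → g :* g :* (g :+ con 2) :+ g := g :* ((con 1 :+ g) :* (con 1 :+ g))) refl g)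

    -- Multiplied by g²M², the square of M Y is at most (N + k)². The coefficient of N² is raised
    -- from g² to M² to fit M² times `key`; by `quartic`, the rest of the square together with `L`
    -- is paid by the term 3Rgh² of `key` and by 4ℓ².
    bound : ∀ {Y} → M * Y ≤ N + k → Y * Y + L + 4 * (c * d) ≤ h * h + 4 * (ℓ * ℓ)
    bound {Y} MY≤ = *-cancelˡ-≤ W (begin
      W * (Y * Y + L + 4 * (c * d))
        ≡⟨ solve 5 (λ g M Y L x → (g :* g) :* (M :* M) :* (Y :* Y :+ L :+ con 4 :* x)
             := g :* g :* ((M :* Y) :* (M :* Y)) :+ (g :* g) :* (M :* M) :* L :+ M :* M :* (con 4 :* (g :* g) :* x)) refl g M Y L (c * d) ⟩
      g * g * ((M * Y) * (M * Y)) + W * L + M * M * Z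
        ≤⟨ +-monoˡ-≤ (M * M * Z) (+-monoˡ-≤ (W * L) (*-monoʳ-≤ (g * g) (*-mono-≤ MY≤ MY≤))) ⟩
      g * g * ((N + k) * (N + k)) + W * L + M * M * Z
        ≡⟨ cong (λ u → u + W * L + M * M * Z) (solve 3 (λ g N k → g :* g :* ((N :+ k) :* (N :+ k))
             := g :* g :* (N :* N) :+ g :* g :* (con 2 :* k :* N :+ k :* k)) refl g N k) ⟩
      g * g * (N * N) + g * g * (2 * k * N + k * k) + W * L + M * M * Z
        ≤⟨ +-monoˡ-≤ (M * M * Z) (+-monoˡ-≤ (W * L) (+-mono-≤
             (*-monoˡ-≤ (N * N) (*-mono-≤ (m≤m+n g (2 * ℓ)) (m≤m+n g (2 * ℓ))))
             (*-monoʳ-≤ (g * g) (+-monoˡ-≤ (k * k) (*-monoʳ-≤ (2 * k) N≤gh))))) ⟩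
      M * M * (N * N) + g * g * (2 * k * (g * h) + k * k) + W * L + M * M * Z
        ≡⟨ solve 6 (λ M N g u L Z → M :* M :* (N :* N) :+ g :* g :* u :+ (g :* g) :* (M :* M) :* L :+ M :* M :* Z
             := M :* M :* (N :* N) :+ g :* g :* (u :+ (M :* M) :* L) :+ M :* M :* Z) refl M N g (2 * k * (g * h) + k * k) L Z ⟩
      M * M * (N * N) + g * g * (2 * k * (g * h) + k * k + (M * M) * L) + M * M * Z
        ≤⟨ +-monoˡ-≤ (M * M * Z) (+-monoʳ-≤ (M * M * (N * N)) (*-monoʳ-≤ (g * g) quartic)) ⟩
      M * M * (N * N) + g * g * ((M * M) * (3 * R * (g + 2) + 4 * (ℓ * ℓ))) + M * M * Z
        ≡⟨ solve 6 (λ M N g R l Z → M :* M :* (N :* N) :+ g :* g :* ((M :* M) :* (R :* (g :+ con 2) :+ l)) :+ M :* M :* Z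
             := M :* M :* (N :* N :+ R :* (g :* g :* (g :+ con 2)) :+ Z) :+ (g :* g) :* (M :* M) :* l) refl
             M N g (3 * R) (4 * (ℓ * ℓ)) Z ⟩
      M * M * (N * N + 3 * R * (g * g * (g + 2)) + Z) + W * (4 * (ℓ * ℓ))
        ≤⟨ +-monoˡ-≤ (W * (4 * (ℓ * ℓ))) (*-monoʳ-≤ (M * M) (+-monoˡ-≤ Z (+-monoʳ-≤ (N * N) (≤-trans
             (*-monoʳ-≤ (3 * R) gh²-lower) (≤-reflexive (sym (*-assoc (3 * R) g (h * h)))))))) ⟩
      M * M * (N * N + 3 * R * g * (h * h) + Z) + W * (4 * (ℓ * ℓ))
        ≤⟨ +-monoˡ-≤ (W * (4 * (ℓ * ℓ))) (*-monoʳ-≤ (M * M) key) ⟩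
      M * M * ((g * g) * (h * h)) + W * (4 * (ℓ * ℓ))
        ≡⟨ solve 4 (λ M g h l → M :* M :* ((g :* g) :* (h :* h)) :+ (g :* g) :* (M :* M) :* l
             := (g :* g) :* (M :* M) :* (h :* h :+ l)) refl M g h (4 * (ℓ * ℓ)) ⟩
      W * (h * h + 4 * (ℓ * ℓ)) ∎)
      where
      open ≤-Reasoning
      Z : ℕ
      Z = 4 * (g * g) * (c * d)

    private
      t : ℕ
      t = g ∸ (2 * m + 1)

      t+2m+1≡g : t + (2 * m + 1) ≡ g
      t+2m+1≡g = m∸n+n≡m (≤-trans (≤-trans (≤-from-+ 1 (solve 1 (λ m → con 2 :* m :+ con 1 :+ con 1 := con 2 :* (con 1 :+ m)) refl m)) 2ℓ≤R)
        (≤-trans (≤-trans (≤-reflexive (sym (*-identityˡ R))) (*-monoˡ-≤ R (s≤s {0} {2} z≤n))) 3R≤g))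

    -- With h = t + 2ℓ one has h² + 4ℓ² = t² + 4ℓh, so the summand 4ℓh of `L` cancels.
    narrow : ∀ {Y} → M * Y ≤ N + k → Y * Y + (2 * M + 4 * (c * d)) ≤ t * t
    narrow {Y} MY≤ = +-cancelʳ-≤ (4 * ℓ * h) _ _ (≤-trans
      (≤-reflexive (solve 4 (λ Y g l x → Y :+ (con 2 :* (g :+ con 2 :* l) :+ x) :+ con 4 :* l :* (con 1 :+ g)
        := Y :+ (con 2 :* g :+ con 4 :* l :* (g :+ con 2)) :+ x) refl (Y * Y) g ℓ (4 * (c * d))))
      (≤-trans (bound MY≤) (≤-reflexive (subst (λ g → suc g * suc g + 4 * (ℓ * ℓ) ≡ t * t + 4 * ℓ * suc g) t+2m+1≡g
        (solve 2 (λ t m → (con 1 :+ (t :+ (con 2 :* m :+ con 1))) :* (con 1 :+ (t :+ (con 2 :* m :+ con 1)))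
            :+ con 4 :* ((con 1 :+ m) :* (con 1 :+ m))
          := t :* t :+ con 4 :* (con 1 :+ m) :* (con 1 :+ (t :+ (con 2 :* m :+ con 1)))) refl t m)))))

    -- The signed rounding error is M - ρ; recording it through ρ between 0 and 2M keeps the
    -- relation within the natural numbers.
    rounding : ∀ A B → N ≡ ℤ.∣ + A ℤ.- + B ∣ → ∃[ z ] ∃[ a ] ∃[ ρ ]
      z + a + (2 * m + 1) ≡ g × ρ ≤ 2 * M × A + 2 * ℓ + M + M * a ≡ B + M * z + ρ × 2 * M + 4 * (c * d) ≤ 4 * (z * a)
    rounding A B N≡ = z , a , ρ , trans (cong (_+ (2 * m + 1)) z+a≡t) t+2m+1≡g , ρ≤2M , relation , area
      where
      instance
        2M≢0 : NonZero (2 * M)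
        2M≢0 = m*n≢0 2 M

      I dividend ζ y : ℤ
      I = + A ℤ.- + B ℤ.+ + (2 * ℓ)
      -- As z - a = 2z - t, the best z is the integer nearest to (I/M + t)/2; the last summand M
      -- turns the floor into rounding.
      dividend = I ℤ.+ + M ℤ.* + t ℤ.+ + M
      ζ = dividend ℤD./ℕ (2 * M)
      y = ζ ℤ.+ ζ ℤ.- + t

      ρ : ℕ
      ρ = dividend ℤD.%ℕ (2 * M)

      ρ≤2M : ρ ≤ 2 * M
      ρ≤2M = <⇒≤ (ℤD.n%ℕd<d dividend (2 * M))

      My : + M ℤ.* y ≡ I ℤ.+ (+ M ℤ.- + ρ)
      My = trans
        (ℤSolver.solve 3 (λ M ζ t → M ⊗ (ζ ⊕ ζ ⊝ t) ⩴ ζ ⊗ (M ⊕ M) ⊝ M ⊗ t) refl (+ M) ζ (+ t))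
        (trans (cong (λ u → ζ ℤ.* u ℤ.- + M ℤ.* + t) (cong (λ u → + (M + u)) (sym (+-identityʳ M))))
        (trans (ℤSolver.solve 3 (λ q w r → q ⊝ w ⩴ (r ⊕ q) ⊝ r ⊝ w) refl (ζ ℤ.* + (2 * M)) (+ M ℤ.* + t) (+ ρ))
        (trans (cong (λ u → u ℤ.- + ρ ℤ.- + M ℤ.* + t) (sym (ℤD.a≡a%ℕn+[a/ℕn]*n dividend (2 * M))))
          (ℤSolver.solve 4 (λ I w M r → (I ⊕ w ⊕ M) ⊝ r ⊝ w ⩴ I ⊕ (M ⊝ r)) refl I (+ M ℤ.* + t) (+ M) (+ ρ)))))

      ∣M-ρ∣≤M : ℤ.∣ + M ℤ.- + ρ ∣ ≤ M
      ∣M-ρ∣≤M with ≤-total ρ M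
      ... | inj₁ ρ≤M = ≤-trans (≤-reflexive (cong ℤ.∣_∣ (trans (ℤₚ.m-n≡m⊖n M ρ) (ℤₚ.⊖-≥ ρ≤M)))) (m∸n≤m M ρ)
      ... | inj₂ M≤ρ = ≤-trans (≤-reflexive (trans (cong ℤ.∣_∣ (ℤₚ.m-n≡m⊖n M ρ)) (ℤₚ.∣⊖∣-≤ M≤ρ)))
        (m≤n+o⇒m∸n≤o ρ M (≤-trans ρ≤2M (≤-reflexive (cong (λ u → M + u) (+-identityʳ M)))))

      MY≤ : M * ℤ.∣ y ∣ ≤ N + k
      MY≤ = begin
        M * ℤ.∣ y ∣                               ≡⟨ sym (ℤₚ.abs-* (+ M) y) ⟩
        ℤ.∣ + M ℤ.* y ∣                           ≡⟨ cong ℤ.∣_∣ My ⟩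
        ℤ.∣ I ℤ.+ (+ M ℤ.- + ρ) ∣                 ≤⟨ ℤₚ.∣i+j∣≤∣i∣+∣j∣ I _ ⟩
        ℤ.∣ I ∣ + ℤ.∣ + M ℤ.- + ρ ∣               ≤⟨ +-mono-≤ (ℤₚ.∣i+j∣≤∣i∣+∣j∣ (+ A ℤ.- + B) (+ (2 * ℓ))) ∣M-ρ∣≤M ⟩
        ℤ.∣ + A ℤ.- + B ∣ + 2 * ℓ + M             ≡⟨ cong (λ u → u + 2 * ℓ + M) (sym N≡) ⟩
        N + 2 * ℓ + M                             ≡⟨ solve 3 (λ N l g → N :+ con 2 :* l :+ (g :+ con 2 :* l) := N :+ (g :+ con 4 :* l)) refl N ℓ g ⟩
        N + k                                     ∎
        where open ≤-Reasoning

      -- The rounding is done in ℤ without regard to range. The narrowness estimate itself gives ∣z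
      -- - a∣ ≤ z + a, which makes z and a natural numbers.
      Y≤t : ℤ.∣ y ∣ ≤ t
      Y≤t = square-cancel-≤ (≤-trans (m≤m+n _ _) (narrow MY≤))

      nonneg : ∀ i s → ℤ.∣ i ℤ.+ i ℤ.- + s ∣ ≤ s → ∃[ z ] i ≡ + z × z ≤ s
      nonneg (+ z) s h with z ≤? s
      ... | yes z≤s = z , refl , z≤s
      ... | no  z≰s = contradiction (≤-trans (≤-reflexive (sym (cong ℤ.∣_∣ (trans (ℤₚ.m-n≡m⊖n (z + z) s)
                        (ℤₚ.⊖-≥ (≤-trans (<⇒≤ (≰⇒> z≰s)) (m≤m+n z z))))))) h)
                        (<⇒≱ (m+n≤o⇒m≤o∸n (suc s) (+-mono-≤ (≰⇒> z≰s) (<⇒≤ (≰⇒> z≰s)))))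
      nonneg ℤ.-[1+ z ] zero    ()
      nonneg ℤ.-[1+ z ] (suc s) h = contradiction h (<⇒≱ (s≤s (s≤s (≤-trans (m≤n+m s (z + z)) (n≤1+n _)))))

      z : ℕ
      z = proj₁ (nonneg ζ t Y≤t)

      ζ≡z : ζ ≡ + z
      ζ≡z = proj₁ (proj₂ (nonneg ζ t Y≤t))

      a : ℕ
      a = t ∸ z

      z+a≡t : z + a ≡ t
      z+a≡t = m+[n∸m]≡n (proj₂ (proj₂ (nonneg ζ t Y≤t)))

      y≡z-a : y ≡ + z ℤ.- + a
      y≡z-a = trans (cong₂ (λ i s → i ℤ.+ i ℤ.- + s) ζ≡z (sym z+a≡t))
        (ℤSolver.solve 2 (λ z a → z ⊕ z ⊝ (z ⊕ a) ⩴ z ⊝ a) refl (+ z) (+ a))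

      relation : A + 2 * ℓ + M + M * a ≡ B + M * z + ρ
      relation = ℤₚ.+-injective (trans (cong (λ u → + (A + 2 * ℓ + M) ℤ.+ u) (ℤₚ.pos-* M a))
        (trans (ℤSolver.solve 6 (λ A B l M a r → (A ⊕ l ⊕ M) ⊕ M ⊗ a ⩴ (A ⊝ B ⊕ l ⊕ (M ⊝ r)) ⊕ (B ⊕ r ⊕ M ⊗ a)) refl
            (+ A) (+ B) (+ (2 * ℓ)) (+ M) (+ a) (+ ρ))
        (trans (cong (λ u → u ℤ.+ (+ B ℤ.+ + ρ ℤ.+ + M ℤ.* + a)) (trans (sym My) (cong (λ u → + M ℤ.* u) y≡z-a)))
        (trans (ℤSolver.solve 5 (λ B M z a r → M ⊗ (z ⊝ a) ⊕ (B ⊕ r ⊕ M ⊗ a) ⩴ B ⊕ M ⊗ z ⊕ r) refl (+ B) (+ M) (+ z) (+ a) (+ ρ))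
          (cong (λ u → + B ℤ.+ u ℤ.+ + ρ) (sym (ℤₚ.pos-* M z)))))))

      difference-square : ∀ z a → ℤ.∣ + z ℤ.- + a ∣ * ℤ.∣ + z ℤ.- + a ∣ + 4 * (z * a) ≡ (z + a) * (z + a)
      difference-square z a rewrite ℤₚ.m-n≡m⊖n z a with ≤-total a z
      ... | inj₁ a≤z rewrite ℤₚ.⊖-≥ a≤z = subst (λ u → (z ∸ a) * (z ∸ a) + 4 * (u * a) ≡ (u + a) * (u + a)) (m∸n+n≡m a≤z)
        (solve 2 (λ w a → w :* w :+ con 4 :* ((w :+ a) :* a) := (w :+ a :+ a) :* (w :+ a :+ a)) refl (z ∸ a) a)
      ... | inj₂ z≤a rewrite ℤₚ.∣⊖∣-≤ z≤a = subst (λ u → (a ∸ z) * (a ∸ z) + 4 * (z * u) ≡ (z + u) * (z + u)) (m∸n+n≡m z≤a)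
        (solve 2 (λ w z → w :* w :+ con 4 :* (z :* (w :+ z)) := (z :+ (w :+ z)) :* (z :+ (w :+ z))) refl (a ∸ z) z)

      area : 2 * M + 4 * (c * d) ≤ 4 * (z * a)
      area = +-cancelˡ-≤ (ℤ.∣ y ∣ * ℤ.∣ y ∣) _ _ (≤-trans (narrow MY≤) (≤-reflexive (sym (trans
        (cong (λ u → ℤ.∣ u ∣ * ℤ.∣ u ∣ + 4 * (z * a)) y≡z-a)
        (trans (difference-square z a) (cong (λ u → u * u) z+a≡t))))))

  -- The number of cross edges

  2∣n²+n : ∀ n → 2 ∣ n * n + n
  2∣n²+n zero    = divides 0 refl
  2∣n²+n (suc n) = subst (2 ∣_)
    (solve 1 (λ n → n :* n :+ n :+ con 2 :* (con 1 :+ n) := (con 1 :+ n) :* (con 1 :+ n) :+ (con 1 :+ n)) refl n)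
    (∣m∣n⇒∣m+n (2∣n²+n n) (m∣m*n (suc n)))

  module _ (c z a m d Σ ρ g : ℕ) (z+a+2m+1≡g : z + a + (2 * m + 1) ≡ g) where
    private
      -- X is the part of the formula for `total D + p` that does not involve the cross edges.
      ℓ n p X M : ℕ
      ℓ = suc m
      n = suc (c + g) + d
      p = c + z
      X = p * p + 4 * ℓ * p + 2 * ℓ * m
      M = g + 2 * ℓ

    edge-count : 2 ∣ Σ → ρ ≤ 2 * M → 2 * M + 4 * (c * d) ≤ 4 * (z * a) →
      2 * Σ + 2 * ℓ + M + M * a ≡ 2 * (n * c) + g * (1 + (c + g) + c) + M * z + ρ →
      ∃[ e ] Σ + p ≡ X + 2 * e × c * (a + d) ≤ e × e ≤ p * a
    edge-count 2∣Σ ρ≤2M area relation = e , trans Σ+p≡ (cong (λ u → X + u) f≡2e)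
      , *-cancelˡ-≤ 2 (≤-trans lower (≤-reflexive f≡2e)) , *-cancelˡ-≤ 2 (≤-trans (≤-reflexive (sym f≡2e)) upper)
      where
      -- With 2e = Σ + p - X this says 4e = 2pa + 2c(a + d) + (ρ - M), that is, e differs from the
      -- midpoint of its interval by (ρ - M)/4.
      centred : 2 * (Σ + p) + M ≡ 2 * X + 2 * (p * a) + 2 * (c * (a + d)) + ρ
      centred = +-cancelʳ-≡ (2 * ℓ + M * a) _ _ (trans
        (solve 4 (λ S p M w → con 2 :* (S :+ p) :+ M :+ w := con 2 :* S :+ w :+ M :+ con 2 :* p) refl Σ p M (2 * ℓ + M * a))
        (trans (cong (_+ 2 * p) (trans (solve 4 (λ S l M w → con 2 :* S :+ (l :+ w) :+ M := con 2 :* S :+ l :+ M :+ w) refl Σ (2 * ℓ) M (M * a)) relation))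
        (subst (λ g → 2 * ((suc (c + g) + d) * c) + g * (1 + (c + g) + c) + (g + 2 * ℓ) * z + ρ + 2 * p
            ≡ 2 * X + 2 * (p * a) + 2 * (c * (a + d)) + ρ + (2 * ℓ + (g + 2 * ℓ) * a)) z+a+2m+1≡g
          (solve 6 (λ c z a m d r → let l = con 1 :+ m ; g = z :+ a :+ (con 2 :* m :+ con 1) ; p = c :+ z ; M = g :+ con 2 :* l in
            con 2 :* ((con 1 :+ (c :+ g) :+ d) :* c) :+ g :* (con 1 :+ (c :+ g) :+ c) :+ M :* z :+ r :+ con 2 :* p
            := con 2 :* (p :* p :+ con 4 :* l :* p :+ con 2 :* l :* m) :+ con 2 :* (p :* a) :+ con 2 :* (c :* (a :+ d)) :+ r
               :+ (con 2 :* l :+ M :* a)) refl c z a m d ρ))))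

      M+cross≤ : M + 2 * (c * (a + d)) ≤ 2 * (p * a)
      M+cross≤ = *-cancelˡ-≤ 2 (≤-trans
        (≤-reflexive (solve 4 (λ M c a d → con 2 :* (M :+ con 2 :* (c :* (a :+ d))) := con 2 :* M :+ con 4 :* (c :* d) :+ con 4 :* (c :* a)) refl M c a d))
        (≤-trans (+-monoˡ-≤ (4 * (c * a)) area)
        (≤-reflexive (solve 3 (λ c z a → con 4 :* (z :* a) :+ con 4 :* (c :* a) := con 2 :* (con 2 :* ((c :+ z) :* a))) refl c z a))))

      X+cross≤ : X + 2 * (c * (a + d)) ≤ Σ + p
      X+cross≤ = *-cancelˡ-≤ 2 (+-cancelʳ-≤ M _ _ (begin
        2 * (X + 2 * (c * (a + d))) + M
          ≡⟨ solve 3 (λ X w M → con 2 :* (X :+ con 2 :* w) :+ M := con 2 :* X :+ (M :+ con 2 :* w) :+ con 2 :* w) refl X (c * (a + d)) M ⟩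
        2 * X + (M + 2 * (c * (a + d))) + 2 * (c * (a + d))
          ≤⟨ +-monoˡ-≤ (2 * (c * (a + d))) (+-monoʳ-≤ (2 * X) M+cross≤) ⟩
        2 * X + 2 * (p * a) + 2 * (c * (a + d))
          ≤⟨ m≤m+n _ ρ ⟩
        2 * X + 2 * (p * a) + 2 * (c * (a + d)) + ρ
          ≡⟨ sym centred ⟩
        2 * (Σ + p) + M ∎))
        where open ≤-Reasoning

      ≤X+cross : Σ + p ≤ X + 2 * (p * a)
      ≤X+cross = *-cancelˡ-≤ 2 (+-cancelʳ-≤ M _ _ (begin
        2 * (Σ + p) + M
          ≡⟨ centred ⟩
        2 * X + 2 * (p * a) + 2 * (c * (a + d)) + ρ
          ≤⟨ +-monoʳ-≤ (2 * X + 2 * (p * a) + 2 * (c * (a + d))) ρ≤2M ⟩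
        2 * X + 2 * (p * a) + 2 * (c * (a + d)) + 2 * M
          ≡⟨ solve 4 (λ X u w M → con 2 :* X :+ con 2 :* u :+ con 2 :* w :+ con 2 :* M
               := con 2 :* X :+ con 2 :* u :+ M :+ (M :+ con 2 :* w)) refl X (p * a) (c * (a + d)) M ⟩
        2 * X + 2 * (p * a) + M + (M + 2 * (c * (a + d)))
          ≤⟨ +-monoʳ-≤ (2 * X + 2 * (p * a) + M) M+cross≤ ⟩
        2 * X + 2 * (p * a) + M + 2 * (p * a)
          ≡⟨ solve 3 (λ X u M → con 2 :* X :+ con 2 :* u :+ M :+ con 2 :* u := con 2 :* (X :+ con 2 :* u) :+ M) refl X (p * a) M ⟩
        2 * (X + 2 * (p * a)) + M ∎))
        where open ≤-Reasoning

      f : ℕ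
      f = Σ + p ∸ X

      Σ+p≡ : Σ + p ≡ X + f
      Σ+p≡ = sym (m+[n∸m]≡n (m+n≤o⇒m≤o X X+cross≤))

      -- p² + p is even, so for even Σ the numbers Σ + p and X have equal parity; this makes e an
      -- integer.
      2∣f : 2 ∣ f
      2∣f = ∣m+n∣m⇒∣n (subst (2 ∣_) total≡ (∣m∣n⇒∣m+n 2∣Σ (m∣m*n p))) (∣m∣n⇒∣m+n (2∣n²+n p) (m∣m*n (2 * ℓ * p + ℓ * m)))
        where
        total≡ : Σ + 2 * p ≡ p * p + p + 2 * (2 * ℓ * p + ℓ * m) + f
        total≡ = trans (solve 2 (λ S p → S :+ con 2 :* p := S :+ p :+ p) refl Σ p) (trans (cong (_+ p) Σ+p≡)
          (solve 4 (λ p l m f → p :* p :+ con 4 :* l :* p :+ con 2 :* l :* m :+ f :+ p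
            := p :* p :+ p :+ con 2 :* (con 2 :* l :* p :+ l :* m) :+ f) refl p ℓ m f))

      e : ℕ
      e = quotient 2∣f

      f≡2e : f ≡ 2 * e
      f≡2e = m∣n⇒n≡m*quotient 2∣f

      lower : 2 * (c * (a + d)) ≤ f
      lower = +-cancelˡ-≤ X _ _ (≤-trans X+cross≤ (≤-reflexive Σ+p≡))
      upper : f ≤ 2 * (p * a)
      upper = +-cancelˡ-≤ X _ _ (≤-trans (≤-reflexive (sym Σ+p≡)) ≤X+cross)

  ∣-∣≡∣-∣ : ∀ a b → ∣ a - b ∣ ≡ ℤ.∣ + a ℤ.- + b ∣
  ∣-∣≡∣-∣ a b with ≤-total a b
  ... | inj₁ a≤b = trans (m≤n⇒∣m-n∣≡n∸m a≤b) (sym (trans (cong ℤ.∣_∣ (ℤₚ.m-n≡m⊖n a b)) (ℤₚ.∣⊖∣-≤ a≤b)))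
  ... | inj₂ b≤a = trans (trans (∣-∣-comm a b) (m≤n⇒∣m-n∣≡n∸m b≤a))
    (sym (cong ℤ.∣_∣ (trans (ℤₚ.m-n≡m⊖n a b) (ℤₚ.⊖-≥ b≤a))))

  parameters : ∀ c g d Σ R m .{{_ : NonZero g}} → 3 ≤ R → 2 * suc m ≤ R → 2 ∣ Σ →
    let N = ∣ 2 * Σ - (2 * ((suc (c + g) + d) * c) + g * (1 + (c + g) + c)) ∣ in
    N * N + 3 * R * g * (suc g * suc g) + 4 * (g * g) * (c * d) ≤ (g * g) * (suc g * suc g) →
    ∃[ z ] ∃[ a ] ∃[ e ] z + a + (2 * m + 1) ≡ g ×
      Σ + (c + z) ≡ (c + z) * (c + z) + 4 * suc m * (c + z) + 2 * suc m * m + 2 * e ×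
      c * (a + d) ≤ e × e ≤ (c + z) * a
  parameters c g d Σ R m 3≤R 2ℓ≤R 2∣Σ key =
    let A = 2 * Σ
        B = 2 * ((suc (c + g) + d) * c) + g * (1 + (c + g) + c)
        (z , a , ρ , g≡ , ρ≤2M , relation , area) = rounding c g d R ∣ A - B ∣ m 3≤R 2ℓ≤R key A B (∣-∣≡∣-∣ A B)
        (e , total≡ , lower , upper) = edge-count c z a m d Σ ρ g g≡ 2∣Σ ρ≤2M area relation
    in z , a , e , g≡ , total≡ , lower , upper

open import Data.Bool using (true; false; if_then_else_)
open import Data.Fin as Fin using (Fin; zero; suc)
open import Data.Integer as ℤ using (+_)
import Data.Integer.Properties as ℤₚ
open import Data.Nat as ℕ using (ℕ; suc)
open import Data.Nat.Divisibility using (_∣_)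
import Data.Nat.Properties as ℕₚ
import Data.Nat.Solver as ℕS
open import Data.Product using (∃-syntax; _×_; _,_; proj₁; proj₂)
open import Data.Rational as ℚ using (ℚ; 0ℚ; 1ℚ; ½)
import Data.Rational.Properties as ℚₚ
open import Data.Rational.Solver using (module +-*-Solver)
open import Data.Rational.Unnormalised using (mkℚᵘ; *≤*)
import Data.Rational.Unnormalised.Properties as ℚᵘₚ
open import Data.Sum using (inj₁; inj₂)
open import Function using (_∘_)
open import Relation.Binary.PropositionalEquality
open import Relation.Nullary using (does; yes; no; contradiction)
open import Relation.Nullary.Decidable using (dec-true)
open import Defs
open Graphs
open Arithmetic
open +-*-Solver using (solve; _:=_; _:+_; _:*_; _:-_; :-_; con)
module ℕ-Solver = ℕS.+-*-Solver
open ℕ-Solver using () renaming (_:+_ to _⊞_; _:*_ to _⊠_; _:=_ to _⩴_)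

-- Inequalities between rational approximations

infix 4 _≤ℚ_
_≤ℚ_ : ℚ → ℚ → Set
_≤ℚ_ = ℚ._≤_

slack : ∀ {p q} → p ≤ℚ q → 0ℚ ≤ℚ q ℚ.- p
slack {p} {q} h = subst (_≤ℚ q ℚ.- p) (ℚₚ.+-inverseʳ p) (ℚₚ.+-monoˡ-≤ (ℚ.- p) h)

-- Reduces an inequality to a certificate: the difference is written as a sum of products of
-- nonnegative quantities, and the ring solver checks the identity.
by-slack : ∀ {p q d} → 0ℚ ≤ℚ d → p ℚ.+ d ≡ q → p ≤ℚ q
by-slack {p} {q} {d} 0≤d eq = subst₂ _≤ℚ_ (ℚₚ.+-identityʳ p) eq (ℚₚ.+-monoʳ-≤ p 0≤d)

infixl 6 _⊕_
_⊕_ : ∀ {p q} → 0ℚ ≤ℚ p → 0ℚ ≤ℚ q → 0ℚ ≤ℚ p ℚ.+ q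
_⊕_ = ℚₚ.+-mono-≤

infixl 7 _⊗_
_⊗_ : ∀ {p q} → 0ℚ ≤ℚ p → 0ℚ ≤ℚ q → 0ℚ ≤ℚ p ℚ.* q
_⊗_ = 0≤*≤

0≤1 : 0ℚ ≤ℚ 1ℚ
0≤1 = ℚₚ.<⇒≤ 0<1

-- If b < a, then η = (a - b)/(C + 1) is positive and leaves Cη < a - b. The denominator is C + 1
-- because C may vanish.
≤-from-errors : ∀ {a b C} → 0ℚ ≤ℚ C → (∀ η → 0ℚ ℚ.< η → a ≤ℚ b ℚ.+ C ℚ.* η) → a ≤ℚ b
≤-from-errors {a} {b} {C} 0≤C h with a ℚₚ.≤? b
... | yes a≤b = a≤b
... | no  a≰b = contradiction (ℚₚ.<-≤-trans 0<η (by-slack (slack (h η 0<η)) collapse)) (ℚₚ.<-irrefl refl)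
  where
  0<C+1 : 0ℚ ℚ.< C ℚ.+ 1ℚ
  0<C+1 = ℚₚ.<-≤-trans 0<1 (subst (_≤ℚ C ℚ.+ 1ℚ) (ℚₚ.+-identityˡ 1ℚ) (ℚₚ.+-monoˡ-≤ 1ℚ 0≤C))
  i η : ℚ
  i = inv (C ℚ.+ 1ℚ) 0<C+1
  η = (a ℚ.- b) ℚ.* i
  0<η : 0ℚ ℚ.< η
  0<η = 0<*< (subst (ℚ._< a ℚ.- b) (ℚₚ.+-inverseʳ b) (ℚₚ.+-monoˡ-< (ℚ.- b) (ℚₚ.≰⇒> a≰b))) (inv-pos _ 0<C+1)
  collapse : η ℚ.+ (b ℚ.+ C ℚ.* η ℚ.- a) ≡ 0ℚ
  collapse = trans
    (solve 4 (λ a b C i → (a :- b) :* i :+ (b :+ C :* ((a :- b) :* i) :- a) := (a :- b) :* ((C :+ con 1ℚ) :* i) :- (a :- b)) refl a b C i)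
    (trans (cong (λ u → (a ℚ.- b) ℚ.* u ℚ.- (a ℚ.- b)) (*-inv (C ℚ.+ 1ℚ) 0<C+1))
      (solve 2 (λ a b → (a :- b) :* con 1ℚ :- (a :- b) := con 0ℚ) refl a b))

module _ {g G Q x κ E β ε s u η : ℚ}
  (0≤g : 0ℚ ≤ℚ g) (0≤G : 0ℚ ≤ℚ G) (0≤Q : 0ℚ ≤ℚ Q) (0≤x : 0ℚ ≤ℚ x) (0≤s : 0ℚ ≤ℚ s) (0≤u : 0ℚ ≤ℚ u) (0≤η : 0ℚ ≤ℚ η)
  (0≤ε : 0ℚ ≤ℚ ε) (ε≤E : ε ≤ℚ E) (u≤η : u ≤ℚ η) (u≤1 : u ≤ℚ 1ℚ) (s≤G : s ≤ℚ G)
  (s²≤Q : s ℚ.* s ≤ℚ Q) (Q≤ : Q ≤ℚ (s ℚ.+ u) ℚ.* (s ℚ.+ u)) (x≤ : x ≤ℚ (1ℚ ℚ.- ε) ℚ.* s ℚ.+ η)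
  (βG²≤ : β ℚ.* (G ℚ.* G) ≤ℚ Q ℚ.+ η) (ε-def : ε ℚ.* (β ℚ.* g) ≡ κ) where
  private
    W : ℚ
    W = E ℚ.* (G ℚ.+ G ℚ.+ 1ℚ)

    0≤E : 0ℚ ≤ℚ E
    0≤E = ℚₚ.≤-trans 0≤ε ε≤E

    0≤2G+1 : 0ℚ ≤ℚ G ℚ.+ G ℚ.+ 1ℚ
    0≤2G+1 = 0≤G ⊕ 0≤G ⊕ 0≤1

    square-bound : x ℚ.* x ≤ℚ (1ℚ ℚ.- ε) ℚ.* Q ℚ.+ (x ℚ.+ G ℚ.+ W) ℚ.* η
    -- The approximations of 1 - ε may be negative even though the hypotheses force ε ≤ 1.
    square-bound with ℚₚ.≤-total ε 1ℚ
    ... | inj₁ ε≤1 = by-slack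
      (slack ε≤1 ⊗ slack s²≤Q ⊕ 0≤ε ⊗ slack ε≤1 ⊗ (0≤s ⊗ 0≤s) ⊕ 0≤x ⊗ slack x≤ ⊕ slack ε≤1 ⊗ 0≤s ⊗ slack x≤
        ⊕ slack s≤G ⊗ 0≤η ⊕ 0≤ε ⊗ 0≤s ⊗ 0≤η ⊕ 0≤E ⊗ 0≤2G+1 ⊗ 0≤η)
      (solve 7 (λ e Q s x n G E → x :* x :+
          ((con 1ℚ :- e) :* (Q :- s :* s) :+ e :* (con 1ℚ :- e) :* (s :* s) :+ x :* ((con 1ℚ :- e) :* s :+ n :- x)
            :+ (con 1ℚ :- e) :* s :* ((con 1ℚ :- e) :* s :+ n :- x)
            :+ (G :- s) :* n :+ e :* s :* n :+ E :* (G :+ G :+ con 1ℚ) :* n)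
          := (con 1ℚ :- e) :* Q :+ (x :+ G :+ E :* (G :+ G :+ con 1ℚ)) :* n) refl ε Q s x η G E)
    -- Now x + (ε - 1)s ≤ η, so x² ≤ xη and (ε - 1)s² ≤ Gη. Replacing s² by Q ≤ (s + u)² costs at
    -- most E(2G + 1)η, which is the origin of `W`.
    ... | inj₂ 1≤ε = by-slack
      (slack 1≤ε ⊗ slack Q≤ ⊕ 0≤G ⊗ slack x≤ ⊕ 0≤G ⊗ 0≤x ⊕ slack 1≤ε ⊗ 0≤s ⊗ slack s≤G
        ⊕ 0≤x ⊗ slack x≤ ⊕ 0≤x ⊗ slack 1≤ε ⊗ 0≤s
        ⊕ 0≤E ⊗ 0≤2G+1 ⊗ slack u≤η ⊕ (slack ε≤E ⊕ 0≤1) ⊗ 0≤2G+1 ⊗ 0≤u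
        ⊕ slack 1≤ε ⊗ 0≤u ⊗ (slack s≤G ⊕ slack s≤G) ⊕ slack 1≤ε ⊗ 0≤u ⊗ slack u≤1)
      (solve 8 (λ e Q s x n G E u → x :* x :+
          ((e :- con 1ℚ) :* ((s :+ u) :* (s :+ u) :- Q) :+ G :* ((con 1ℚ :- e) :* s :+ n :- x) :+ G :* x
            :+ (e :- con 1ℚ) :* s :* (G :- s)
            :+ x :* ((con 1ℚ :- e) :* s :+ n :- x) :+ x :* (e :- con 1ℚ) :* s
            :+ E :* (G :+ G :+ con 1ℚ) :* (n :- u) :+ (E :- e :+ con 1ℚ) :* (G :+ G :+ con 1ℚ) :* u
            :+ (e :- con 1ℚ) :* u :* ((G :- s) :+ (G :- s)) :+ (e :- con 1ℚ) :* u :* (con 1ℚ :- u))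
          := (con 1ℚ :- e) :* Q :+ (x :+ G :+ E :* (G :+ G :+ con 1ℚ)) :* n) refl ε Q s x η G E u)

  -- Adds g times `square-bound` to εg times the first hypothesis, so that εQ is traded for εβG².
  -- The coefficient of η involves `E` in place of ε: it has to stay fixed while the index of the
  -- approximation grows with the precision.
  approximate : g ℚ.* (x ℚ.* x) ℚ.+ κ ℚ.* (G ℚ.* G) ≤ℚ g ℚ.* Q ℚ.+ (g ℚ.* (x ℚ.+ G ℚ.+ W) ℚ.+ E ℚ.* g) ℚ.* η
  approximate = subst (λ κ → g ℚ.* (x ℚ.* x) ℚ.+ κ ℚ.* (G ℚ.* G) ≤ℚ g ℚ.* Q ℚ.+ (g ℚ.* (x ℚ.+ G ℚ.+ W) ℚ.+ E ℚ.* g) ℚ.* η) ε-def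
    (by-slack (0≤g ⊗ slack square-bound ⊕ 0≤ε ⊗ 0≤g ⊗ slack βG²≤ ⊕ slack ε≤E ⊗ 0≤g ⊗ 0≤η)
      (solve 9 (λ g x e b G Q W n E → g :* (x :* x) :+ e :* (b :* g) :* (G :* G)
          :+ (g :* ((con 1ℚ :- e) :* Q :+ (x :+ G :+ W) :* n :- x :* x) :+ e :* g :* (Q :+ n :- b :* (G :* G)) :+ (E :- e) :* g :* n)
        := g :* Q :+ (g :* (x :+ G :+ W) :+ E :* g) :* n) refl g x ε β G Q W η E))

module _ (x : ℝ) (0<x : 0ℝ < x) where
  private
    δ = proj₁ 0<x
    0<δ = proj₁ (proj₂ 0<x)

    0<⊔ : ∀ k → 0ℚ ℚ.< seq x k ℚ.⊔ δ
    0<⊔ k = ℚₚ.<-≤-trans 0<δ (ℚₚ.p≤q⊔p (seq x k) δ)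

  below : ∀ {k} → proj₁ (proj₂ (proj₂ 0<x)) ℕ.≤ k → δ ≤ℚ seq x k
  below {k} N≤k = subst (_≤ℚ seq x k) (ℚₚ.+-identityˡ δ) (proj₂ (proj₂ (proj₂ 0<x)) N≤k)

  -- From the index of the positivity witness on, the cutoff at δ inside `recip` is inactive.
  recip-inverse : ∀ {k} → proj₁ (proj₂ (proj₂ 0<x)) ℕ.≤ k → seq x k ℚ.* seq (recip x 0<x) k ≡ 1ℚ
  recip-inverse {k} N≤k = trans (cong (ℚ._* seq (recip x 0<x) k) (sym (ℚₚ.p≥q⇒p⊔q≡p (below N≤k))))
    (*-inv (seq x k ℚ.⊔ δ) (0<⊔ k))

  recip-nonneg : ∀ k → 0ℚ ≤ℚ seq (recip x 0<x) k
  recip-nonneg k = ℚₚ.<⇒≤ (inv-pos (seq x k ℚ.⊔ δ) (0<⊔ k))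

  recip-upper : ∀ {k} → proj₁ (proj₂ (proj₂ 0<x)) ℕ.≤ k → seq (recip x 0<x) k ≤ℚ inv δ 0<δ
  recip-upper {k} N≤k = by-slack (ℚₚ.<⇒≤ (inv-pos δ 0<δ) ⊗ recip-nonneg k ⊗ slack (below N≤k))
    (trans (solve 4 (λ r i y d → r :+ i :* r :* (y :- d) := i :* (y :* r) :+ r :* (con 1ℚ :- d :* i)) refl r i y δ)
      (trans (cong₂ (λ a b → i ℚ.* a ℚ.+ r ℚ.* (1ℚ ℚ.- b)) (recip-inverse N≤k) (*-inv δ 0<δ))
        (solve 2 (λ i r → i :* con 1ℚ :+ r :* (con 1ℚ :- con 1ℚ) := i) refl i r)))
    where
    r = seq (recip x 0<x) k
    i = inv δ 0<δ
    y = seq x k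

ι-∸ : ∀ {a b} → a ℕ.≤ b → ι (b ℕ.∸ a) ≡ ι b ℚ.- ι a
ι-∸ {a} {b} a≤b = trans (solve 2 (λ u v → u := u :+ v :- v) refl (ι (b ℕ.∸ a)) (ι a))
  (cong (ℚ._- ι a) (trans (sym (ι-+ (b ℕ.∸ a) a)) (cong ι (ℕₚ.m∸n+n≡m a≤b))))

ι-∣-∣ : ∀ a b → ι ℕ.∣ a - b ∣ ≡ ℚ.∣ ι a ℚ.- ι b ∣
ι-∣-∣ a b with ℕₚ.≤-total b a
... | inj₁ b≤a = trans (cong ι (trans (ℕₚ.∣-∣-comm a b) (ℕₚ.m≤n⇒∣m-n∣≡n∸m b≤a)))
  (trans (ι-∸ b≤a) (sym (ℚₚ.0≤p⇒∣p∣≡p (slack (ι-mono b≤a)))))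
... | inj₂ a≤b = trans (cong ι (ℕₚ.m≤n⇒∣m-n∣≡n∸m a≤b)) (trans (ι-∸ a≤b)
  (trans (sym (ℚₚ.0≤p⇒∣p∣≡p (slack (ι-mono a≤b))))
    (trans (sym (ℚₚ.∣-p∣≡∣p∣ (ι b ℚ.- ι a))) (cong ℚ.∣_∣ (solve 2 (λ u v → :- (u :- v) := v :- u) refl (ι b) (ι a))))))

ι-cancel-≤ : ∀ {a b} → ι a ≤ℚ ι b → a ℕ.≤ b
ι-cancel-≤ {a} {b} h with a ℕₚ.≤? b
... | yes a≤b = a≤b
... | no  a≰b = contradiction (ℚₚ.<-≤-trans 0<1 (by-slack (slack (ℚₚ.≤-trans (ι-mono (ℕₚ.≰⇒> a≰b)) h))
    (trans (cong (λ u → 1ℚ ℚ.+ (ι b ℚ.- u)) (ι-+ 1 b)) (solve 1 (λ b → con 1ℚ :+ (b :- (con 1ℚ :+ b)) := con 0ℚ) refl (ι b)))))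
  (ℚₚ.<-irrefl refl)

-- The hypotheses as one inequality between natural numbers

module _ (n c₁ c g d Σ : ℕ) (c+g≡c₁ : c ℕ.+ g ≡ c₁) (1+c₁+d≡n : suc c₁ ℕ.+ d ≡ n) (c<c₁ : c ℕ.< c₁) (β : ℝ) (0<β : 0ℝ < β) (r : ℕ) where
  private
    A B N : ℕ
    A  = 2 ℕ.* Σ
    B  = 2 ℕ.* (n ℕ.* c) ℕ.+ g ℕ.* (1 ℕ.+ c₁ ℕ.+ c)
    N  = ℕ.∣ A - B ∣

    gap : ℝ
    gap = fromℕ c₁ - fromℕ c

    0<gap : 0ℝ < gap
    0<gap = diff-pos c c₁ c<c₁

    Q : ℝ
    Q = (gap + 1ℝ) ² - fromℕ 4 * fromℕ c * (fromℕ n - 1ℝ - fromℕ c₁)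

    ε : ℝ
    ε = (fromℕ 3 * (fromℕ r + fromℕ 3)) / (β * gap) [ *-pos β gap 0<β 0<gap ]

  key-inequality :
    fromℕ 4 * fromℕ c * (fromℕ n - 1ℝ - fromℕ c₁) ≤ (1ℝ - β) * (gap + 1ℝ) ² →
    ∣ (fromℕ Σ - fromℕ n * fromℕ c) / (gap * ½ℝ) [ *-pos gap ½ℝ 0<gap ½-pos ]
      - (1ℝ + fromℕ c₁ + fromℕ c) ∣ᴿ ≤ (1ℝ - ε) * √ Q →
    N ℕ.* N ℕ.+ 3 ℕ.* (r ℕ.+ 3) ℕ.* g ℕ.* (suc g ℕ.* suc g) ℕ.+ 4 ℕ.* (g ℕ.* g) ℕ.* (c ℕ.* d)
      ℕ.≤ (g ℕ.* g) ℕ.* (suc g ℕ.* suc g)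
  key-inequality hyp₁ hyp₂ = ι-cancel-≤ (subst₂ _≤ℚ_ (sym lhs-ι) (sym rhs-ι) scaled)
    where
    δβ δ′ γ G v q κ i E x C : ℚ
    δβ = proj₁ 0<β
    δ′ = proj₁ (*-pos β gap 0<β 0<gap)
    γ  = ι c₁ ℚ.- ι c
    G  = γ ℚ.+ 1ℚ
    v  = ι 4 ℚ.* ι c ℚ.* (ι n ℚ.- 1ℚ ℚ.- ι c₁)
    q  = G ℚ.* G ℚ.- v
    κ  = ι 3 ℚ.* (ι r ℚ.+ ι 3)
    i  = seq (recip gap 0<gap) 0
    -- δ′ bounds β times the gap from below at all late indices, so this bounds the approximations
    -- of ε uniformly.
    E  = κ ℚ.* inv δ′ (proj₁ (proj₂ (*-pos β gap 0<β 0<gap)))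
    x  = ι N ℚ.* i
    C  = γ ℚ.* (x ℚ.+ G ℚ.+ E ℚ.* (G ℚ.+ G ℚ.+ 1ℚ)) ℚ.+ E ℚ.* γ

    γ≡ : γ ≡ ι g
    γ≡ = trans (cong (ℚ._- ι c) (trans (cong ι (sym c+g≡c₁)) (ι-+ c g))) (solve 2 (λ c g → c :+ g :- c := g) refl (ι c) (ι g))

    d≡ : ι n ℚ.- 1ℚ ℚ.- ι c₁ ≡ ι d
    d≡ = trans (cong (λ u → u ℚ.- 1ℚ ℚ.- ι c₁) (trans (trans (cong ι (sym 1+c₁+d≡n)) (ι-+ (suc c₁) d)) (cong (ℚ._+ ι d) (ι-+ 1 c₁))))
      (solve 2 (λ c d → (con 1ℚ :+ c :+ d) :- con 1ℚ :- c := d) refl (ι c₁) (ι d))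

    G≡ : G ≡ ι (suc g)
    G≡ = trans (cong (ℚ._+ 1ℚ) γ≡) (trans (ℚₚ.+-comm (ι g) 1ℚ) (sym (ι-+ 1 g)))

    γi≡1 : γ ℚ.* i ≡ 1ℚ
    γi≡1 = recip-inverse gap 0<gap {0} ℕ.z≤n

    γx≡N : γ ℚ.* x ≡ ι N
    γx≡N = trans (solve 3 (λ g N i → g :* (N :* i) := N :* (g :* i)) refl γ (ι N) i)
      (trans (cong (ι N ℚ.*_) γi≡1) (ℚₚ.*-identityʳ _))

    0≤γ : 0ℚ ≤ℚ γ
    0≤γ = subst (0ℚ ≤ℚ_) (sym γ≡) (ι-nonneg g)

    0≤G : 0ℚ ≤ℚ G
    0≤G = 0≤γ ⊕ 0≤1

    0≤x : 0ℚ ≤ℚ x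
    0≤x = ι-nonneg N ⊗ recip-nonneg gap 0<gap 0

    0≤κ : 0ℚ ≤ℚ κ
    0≤κ = ι-nonneg 3 ⊗ (ι-nonneg r ⊕ ι-nonneg 3)

    0≤E : 0ℚ ≤ℚ E
    0≤E = 0≤κ ⊗ ℚₚ.<⇒≤ (inv-pos δ′ (proj₁ (proj₂ (*-pos β gap 0<β 0<gap))))

    0≤C : 0ℚ ≤ℚ C
    0≤C = 0≤γ ⊗ (0≤x ⊕ 0≤G ⊕ 0≤E ⊗ (0≤G ⊕ 0≤G ⊕ 0≤1)) ⊕ 0≤E ⊗ 0≤γ

    v≡ : v ≡ ι 4 ℚ.* ι c ℚ.* ι d
    v≡ = cong (ι 4 ℚ.* ι c ℚ.*_) d≡

    0≤v : 0ℚ ≤ℚ v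
    0≤v = subst (0ℚ ≤ℚ_) (sym v≡) (ι-nonneg 4 ⊗ ι-nonneg c ⊗ ι-nonneg d)

    Nβ Nε : ℕ
    Nβ = proj₁ (proj₂ (proj₂ 0<β))
    Nε = proj₁ (proj₂ (proj₂ (*-pos β gap 0<β 0<gap)))

    -- `√` cuts off at 0, so its square approximates Q only once Q is known to be nonnegative. The
    -- first hypothesis is used with tolerance δβ, the lower bound of β: since G ≥ 1, the tolerance
    -- is absorbed by βG².
    0≤q : 0ℚ ≤ℚ q
    0≤q =
      let 0<δβ = proj₁ (proj₂ 0<β)
          (N₁ , h₁) = hyp₁ δβ 0<δβ
          k = Nβ ℕ.+ N₁
      in subst (0ℚ ≤ℚ_)
        (solve 4 (λ b g v d → ((con 1ℚ :- b) :* ((g :+ con 1ℚ) :* (g :+ con 1ℚ)) :+ d :- v)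
            :+ (b :- d) :* ((g :+ con 1ℚ) :* (g :+ con 1ℚ)) :+ d :* (g :* g :+ (g :+ g))
          := (g :+ con 1ℚ) :* (g :+ con 1ℚ) :- v) refl (seq β k) γ v δβ)
        (slack (h₁ (ℕₚ.m≤n+m N₁ Nβ)) ⊕ slack (below β 0<β (ℕₚ.m≤m+n Nβ N₁)) ⊗ (0≤G ⊗ 0≤G)
          ⊕ ℚₚ.<⇒≤ 0<δβ ⊗ (0≤γ ⊗ 0≤γ ⊕ (0≤γ ⊕ 0≤γ)))

    -- Multiplication by the gap clears the denominator (c₁ - c)/2 and leaves `ι A ℚ.- ι B`, so the
    -- sequence is constant in k.
    deviation : ∀ k → ℚ.∣ (ι Σ ℚ.- ι n ℚ.* ι c) ℚ.* seq (recip (gap * ½ℝ) (*-pos gap ½ℝ 0<gap ½-pos)) k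
      ℚ.- (1ℚ ℚ.+ ι c₁ ℚ.+ ι c) ∣ ≡ x
    deviation k = trans (sym (ℚₚ.*-identityʳ _)) (trans (cong (ℚ.∣ y ∣ ℚ.*_) (sym γi≡1))
      (trans (sym (ℚₚ.*-assoc ℚ.∣ y ∣ γ i)) (cong (ℚ._* i) ∣y∣γ≡N)))
      where
      ρ y : ℚ
      ρ = seq (recip (gap * ½ℝ) (*-pos gap ½ℝ 0<gap ½-pos)) k
      y = (ι Σ ℚ.- ι n ℚ.* ι c) ℚ.* ρ ℚ.- (1ℚ ℚ.+ ι c₁ ℚ.+ ι c)

      A≡ : ι A ≡ ι 2 ℚ.* ι Σ
      A≡ = ι-* 2 Σ

      B≡ : ι B ≡ ι 2 ℚ.* (ι n ℚ.* ι c) ℚ.+ γ ℚ.* (1ℚ ℚ.+ ι c₁ ℚ.+ ι c)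
      B≡ = trans (ι-+ (2 ℕ.* (n ℕ.* c)) _) (cong₂ ℚ._+_
        (trans (ι-* 2 (n ℕ.* c)) (cong (ι 2 ℚ.*_) (ι-* n c)))
        (trans (ι-* g _) (cong₂ ℚ._*_ (sym γ≡) (trans (ι-+ (1 ℕ.+ c₁) c) (cong (ℚ._+ ι c) (ι-+ 1 c₁))))))

      yγ≡ : y ℚ.* γ ≡ ι A ℚ.- ι B
      yγ≡ = trans
        (solve 4 (λ w ρ s g → (w :* ρ :- s) :* g := con (ι 2) :* w :* ((g :* con ½) :* ρ) :- g :* s) refl
          (ι Σ ℚ.- ι n ℚ.* ι c) ρ (1ℚ ℚ.+ ι c₁ ℚ.+ ι c) γ)
        (trans (cong (λ u → ι 2 ℚ.* (ι Σ ℚ.- ι n ℚ.* ι c) ℚ.* u ℚ.- γ ℚ.* (1ℚ ℚ.+ ι c₁ ℚ.+ ι c))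
            (recip-inverse (gap * ½ℝ) (*-pos gap ½ℝ 0<gap ½-pos) {k} ℕ.z≤n))
          (trans (solve 3 (λ S nc w → con (ι 2) :* (S :- nc) :* con 1ℚ :- w := con (ι 2) :* S :- (con (ι 2) :* nc :+ w)) refl
            (ι Σ) (ι n ℚ.* ι c) (γ ℚ.* (1ℚ ℚ.+ ι c₁ ℚ.+ ι c))) (cong₂ ℚ._-_ (sym A≡) (sym B≡))))

      ∣y∣γ≡N : ℚ.∣ y ∣ ℚ.* γ ≡ ι N
      ∣y∣γ≡N = trans (cong (ℚ.∣ y ∣ ℚ.*_) (sym (ℚₚ.0≤p⇒∣p∣≡p 0≤γ)))
        (trans (sym (ℚₚ.∣p*q∣≡∣p∣*∣q∣ y γ)) (trans (cong ℚ.∣_∣ yγ≡) (sym (ι-∣-∣ A B))))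

    with-error : ∀ η → 0ℚ ℚ.< η → γ ℚ.* (x ℚ.* x) ℚ.+ κ ℚ.* (G ℚ.* G) ≤ℚ γ ℚ.* q ℚ.+ C ℚ.* η
    with-error η 0<η =
      let (N₁ , h₁) = hyp₁ η 0<η
          (N₂ , h₂) = hyp₂ η 0<η
          (N₃ , h₃) = archimedean η 0<η
          k = Nβ ℕ.+ (Nε ℕ.+ (N₁ ℕ.+ (N₂ ℕ.+ N₃)))
          Nε≤ = ℕₚ.≤-trans (ℕₚ.m≤m+n Nε _) (ℕₚ.m≤n+m _ Nβ)
          ≥₁ = ℕₚ.≤-trans (ℕₚ.m≤n+m (N₁ ℕ.+ (N₂ ℕ.+ N₃)) Nε) (ℕₚ.m≤n+m _ Nβ)
          N₁≤ = ℕₚ.≤-trans (ℕₚ.m≤m+n N₁ _) ≥₁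
          ≥₂ = ℕₚ.≤-trans (ℕₚ.m≤n+m (N₂ ℕ.+ N₃) N₁) ≥₁
          N₂≤ = ℕₚ.≤-trans (ℕₚ.m≤m+n N₂ _) ≥₂
          N₃≤ = ℕₚ.≤-trans (ℕₚ.m≤n+m N₃ N₂) ≥₂
          s = seq (√ Q) k
          q⊔0≡q = ℚₚ.p≥q⇒p⊔q≡p 0≤q
          s²≤q = subst (s ℚ.* s ≤ℚ_) q⊔0≡q (√≈-lower k (q ℚ.⊔ 0ℚ) (ℚₚ.p≤q⊔p q 0ℚ))
          q≤ = subst (_≤ℚ (s ℚ.+ 1/1+ k) ℚ.* (s ℚ.+ 1/1+ k)) q⊔0≡q (√≈-upper k (q ℚ.⊔ 0ℚ) (ℚₚ.p≤q⊔p q 0ℚ))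
          0≤s = √≈-nonneg k (q ℚ.⊔ 0ℚ)
          q≤G² = by-slack 0≤v (solve 2 (λ G v → G :- v :+ v := G) refl (G ℚ.* G) v)
      in approximate {γ} {G} {q} {x} {κ} {E} {seq β k} {seq ε k} {s} {1/1+ k} {η}
        0≤γ 0≤G 0≤q 0≤x 0≤s (ℚₚ.<⇒≤ (inv-pos _ (ι-pos k))) (ℚₚ.<⇒≤ 0<η)
        (0≤κ ⊗ recip-nonneg (β * gap) (*-pos β gap 0<β 0<gap) k)
        (ℚₚ.*-monoˡ-≤-nonNeg κ {{ℚ.nonNegative 0≤κ}} (recip-upper (β * gap) (*-pos β gap 0<β 0<gap) Nε≤))
        (ℚₚ.≤-trans (1/1+-anti N₃≤) h₃) (ℚₚ.≤-trans (1/1+-anti (ℕ.z≤n {k})) ℚₚ.≤-refl)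
        (square-cancel 0≤s 0≤G (ℚₚ.≤-trans s²≤q q≤G²)) s²≤q q≤
        (subst (_≤ℚ (1ℚ ℚ.- seq ε k) ℚ.* s ℚ.+ η) (deviation k) (h₂ N₂≤))
        (by-slack (slack (h₁ N₁≤)) (solve 4 (λ b G v n →
          b :* G :+ ((con 1ℚ :- b) :* G :+ n :- v) := G :- v :+ n) refl (seq β k) (G ℚ.* G) v η))
        (trans (solve 3 (λ κ ρ w → κ :* ρ :* w := κ :* (w :* ρ)) refl κ
            (seq (recip (β * gap) (*-pos β gap 0<β 0<gap)) k) (seq β k ℚ.* γ))
          (trans (cong (κ ℚ.*_) (recip-inverse (β * gap) (*-pos β gap 0<β 0<gap) Nε≤)) (ℚₚ.*-identityʳ κ)))

    scaled : ι N ℚ.* ι N ℚ.+ κ ℚ.* ι g ℚ.* (ι (suc g) ℚ.* ι (suc g)) ℚ.+ ι 4 ℚ.* (ι g ℚ.* ι g) ℚ.* (ι c ℚ.* ι d)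
      ≤ℚ (ι g ℚ.* ι g) ℚ.* (ι (suc g) ℚ.* ι (suc g))
    scaled = subst (λ γ → ι N ℚ.* ι N ℚ.+ κ ℚ.* γ ℚ.* (ι (suc g) ℚ.* ι (suc g)) ℚ.+ ι 4 ℚ.* (γ ℚ.* γ) ℚ.* (ι c ℚ.* ι d)
        ≤ℚ (γ ℚ.* γ) ℚ.* (ι (suc g) ℚ.* ι (suc g))) γ≡
      (subst (λ h → ι N ℚ.* ι N ℚ.+ κ ℚ.* γ ℚ.* (h ℚ.* h) ℚ.+ ι 4 ℚ.* (γ ℚ.* γ) ℚ.* (ι c ℚ.* ι d)
        ≤ℚ (γ ℚ.* γ) ℚ.* (h ℚ.* h)) G≡
      (subst (λ N → N ℚ.* N ℚ.+ κ ℚ.* γ ℚ.* (G ℚ.* G) ℚ.+ ι 4 ℚ.* (γ ℚ.* γ) ℚ.* (ι c ℚ.* ι d)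
        ≤ℚ (γ ℚ.* γ) ℚ.* (G ℚ.* G)) γx≡N
      (by-slack (0≤γ ⊗ slack (≤-from-errors {γ ℚ.* (x ℚ.* x) ℚ.+ κ ℚ.* (G ℚ.* G)} {γ ℚ.* q} {C} 0≤C with-error))
        (trans (cong (λ v → γ ℚ.* x ℚ.* (γ ℚ.* x) ℚ.+ κ ℚ.* γ ℚ.* (G ℚ.* G) ℚ.+ ι 4 ℚ.* (γ ℚ.* γ) ℚ.* (ι c ℚ.* ι d)
            ℚ.+ γ ℚ.* (γ ℚ.* (G ℚ.* G ℚ.- v) ℚ.- (γ ℚ.* (x ℚ.* x) ℚ.+ κ ℚ.* (G ℚ.* G)))) v≡)
          (solve 7 (λ γ x κ G f c d → γ :* x :* (γ :* x) :+ κ :* γ :* (G :* G) :+ f :* (γ :* γ) :* (c :* d)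
            :+ γ :* (γ :* (G :* G :- f :* c :* d) :- (γ :* (x :* x) :+ κ :* (G :* G)))
            := (γ :* γ) :* (G :* G)) refl γ x κ G (ι 4) (ι c) (ι d))))))

    rhs-ι : ι ((g ℕ.* g) ℕ.* (suc g ℕ.* suc g)) ≡ (ι g ℚ.* ι g) ℚ.* (ι (suc g) ℚ.* ι (suc g))
    rhs-ι = trans (ι-* (g ℕ.* g) _) (cong₂ ℚ._*_ (ι-* g g) (ι-* (suc g) (suc g)))

    lhs-ι : ι (N ℕ.* N ℕ.+ 3 ℕ.* (r ℕ.+ 3) ℕ.* g ℕ.* (suc g ℕ.* suc g) ℕ.+ 4 ℕ.* (g ℕ.* g) ℕ.* (c ℕ.* d))
      ≡ ι N ℚ.* ι N ℚ.+ κ ℚ.* ι g ℚ.* (ι (suc g) ℚ.* ι (suc g)) ℚ.+ ι 4 ℚ.* (ι g ℚ.* ι g) ℚ.* (ι c ℚ.* ι d)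
    lhs-ι = trans (ι-+ (N ℕ.* N ℕ.+ 3 ℕ.* (r ℕ.+ 3) ℕ.* g ℕ.* (suc g ℕ.* suc g)) _) (cong₂ ℚ._+_
      (trans (ι-+ (N ℕ.* N) _) (cong₂ ℚ._+_ (ι-* N N)
        (trans (ι-* (3 ℕ.* (r ℕ.+ 3) ℕ.* g) _) (cong₂ ℚ._*_
          (trans (ι-* (3 ℕ.* (r ℕ.+ 3)) g) (cong (ℚ._* ι g) (trans (ι-* 3 (r ℕ.+ 3)) (cong (ι 3 ℚ.*_) (ι-+ r 3)))))
          (ι-* (suc g) (suc g))))))
      (trans (ι-* (4 ℕ.* (g ℕ.* g)) _) (cong₂ ℚ._*_
        (trans (ι-* 4 (g ℕ.* g)) (cong (ι 4 ℚ.*_) (ι-* g g))) (ι-* c d))))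

-- Lower bounds for the sum over pairs, and assembly

ratio-lower : ∀ k a b .{{_ : ℕ.NonZero b}} → k ℕ.* b ℕ.≤ a → ι k ℚ.≤ (+ a ℚ./ b)
ratio-lower k a (suc b) k*b≤a = ℚₚ.toℚᵘ-cancel-≤
  (ℚᵘₚ.≤-respˡ-≃ (ℚᵘₚ.≃-sym (toℚᵘ-ι k)) (ℚᵘₚ.≤-respʳ-≃ (ℚᵘₚ.≃-sym (ℚₚ.toℚᵘ-fromℚᵘ (mkℚᵘ (+ a) b)))
    (*≤* (subst₂ ℤ._≤_ (ℤₚ.pos-* k (suc b)) (sym (ℤₚ.*-identityʳ (+ a))) (ℤ.+≤+ k*b≤a)))))

sumℚ-nonneg : ∀ {n} (f : Fin n → ℚ) → (∀ i → 0ℚ ℚ.≤ f i) → 0ℚ ℚ.≤ sumℚ f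
sumℚ-nonneg {ℕ.zero} f h = ℚₚ.≤-refl
sumℚ-nonneg {suc n}  f h = ℚₚ.+-mono-≤ (h zero) (sumℚ-nonneg (f ∘ suc) (h ∘ suc))

term≤sumℚ : ∀ {n} (f : Fin n → ℚ) → (∀ i → 0ℚ ℚ.≤ f i) → ∀ i → f i ℚ.≤ sumℚ f
term≤sumℚ f h zero    = subst (ℚ._≤ sumℚ f) (ℚₚ.+-identityʳ (f zero))
  (ℚₚ.+-monoʳ-≤ (f zero) (sumℚ-nonneg (f ∘ suc) (h ∘ suc)))
term≤sumℚ f h (suc i) = subst (ℚ._≤ sumℚ f) (ℚₚ.+-identityˡ (f (suc i)))
  (ℚₚ.+-mono-≤ (h zero) (term≤sumℚ (f ∘ suc) (h ∘ suc) i))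

if-nonneg : ∀ b {q} → 0ℚ ℚ.≤ q → 0ℚ ℚ.≤ (if b then q else 0ℚ)
if-nonneg true  0≤q = 0≤q
if-nonneg false _   = ℚₚ.≤-refl

term≤sum-pairs : ∀ {n} (f : Fin n → Fin n → ℚ) → (∀ i j → 0ℚ ℚ.≤ f i j) → ∀ {i j} → i Fin.< j →
  f i j ℚ.≤ sumℚ (λ i → sumℚ (λ j → if does (i Fin.<? j) then f i j else 0ℚ))
term≤sum-pairs {n} f 0≤f {i} {j} i<j = ℚₚ.≤-trans
  (ℚₚ.≤-reflexive (cong (λ b → if b then f i j else 0ℚ) (sym (dec-true (i Fin.<? j) i<j))))
  (ℚₚ.≤-trans (term≤sumℚ (term i) (term-nonneg i) j)
    (term≤sumℚ (λ i → sumℚ (term i)) (λ i → sumℚ-nonneg (term i) (term-nonneg i)) i))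
  where
  term : Fin n → Fin n → ℚ
  term i j = if does (i Fin.<? j) then f i j else 0ℚ

  term-nonneg : ∀ i j → 0ℚ ℚ.≤ term i j
  term-nonneg i j = if-nonneg (does (i Fin.<? j)) (0≤f i j)

-- A single pair carries the whole bound. The other terms are nonnegative, which is the case k = 0
-- of the same estimate for a ratio.
∂⁺⁺-lower : ∀ {n} (D : Fin n → ℕ) (γ : Graphic D) {i j} k → i Fin.< j →
  k ℕ.* ∣𝒢 D ∣ ℕ.≤ ∣𝒢 D +1[ i , j ] ∣ → ι k ℚ.≤ ∂⁺⁺ D γ
∂⁺⁺-lower {n} D γ {i} {j} k i<j h = ℚₚ.≤-trans (at-least k i j h)
  (term≤sum-pairs ratio (λ i j → at-least 0 i j ℕ.z≤n) i<j)
  where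
  ratio : Fin n → Fin n → ℚ
  ratio i j = (+ ∣𝒢 D +1[ i , j ] ∣ ℚ./ ∣𝒢 D ∣) {{graphic⇒nonZero γ}}

  at-least : ∀ k i j → k ℕ.* ∣𝒢 D ∣ ℕ.≤ ∣𝒢 D +1[ i , j ] ∣ → ι k ℚ.≤ ratio i j
  at-least k i j = ratio-lower k ∣𝒢 D +1[ i , j ] ∣ ∣𝒢 D ∣ {{graphic⇒nonZero γ}}

-- Every approximation of the root is already at most 2^m, since its square is at most 2^r ≤ (2^m)².
-- The comparison therefore holds from index 0 for every tolerance.
√≤fromℚ : ∀ r m q → r ℕ.≤ m ℕ.+ m → ι (2 ℕ.^ m) ℚ.≤ q → √ (fromℕ (2 ℕ.^ r)) ≤ fromℚ q
√≤fromℚ r m q r≤2m 2^m≤q ε 0<ε = 0 , λ {k} _ → ℚₚ.≤-trans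
  (square-cancel (√≈-nonneg k (ι (2 ℕ.^ r) ℚ.⊔ 0ℚ)) (ι-nonneg (2 ℕ.^ m)) (ℚₚ.≤-trans (√≈-lower k (ι (2 ℕ.^ r) ℚ.⊔ 0ℚ) (ℚₚ.p≤q⊔p (ι (2 ℕ.^ r)) 0ℚ))
    (ℚₚ.≤-trans (ℚₚ.≤-reflexive (ℚₚ.p≥q⇒p⊔q≡p (ι-nonneg (2 ℕ.^ r))))
      (subst (ι (2 ℕ.^ r) ℚ.≤_) (trans (cong ι (ℕₚ.^-distribˡ-+-* 2 m m)) (ι-* (2 ℕ.^ m) (2 ℕ.^ m)))
        (ι-mono (ℕₚ.^-monoʳ-≤ 2 r≤2m))))))
  (ℚₚ.≤-trans 2^m≤q (subst (ℚ._≤ q ℚ.+ ε) (ℚₚ.+-identityʳ q) (ℚₚ.+-monoʳ-≤ q (ℚₚ.<⇒≤ 0<ε))))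

-- The equation for g acts twice: it makes the four blocks add up to c + g + 1 + d vertices, and it
-- makes the degree bound p + (2m + 1) + a of the composed graph equal to c + g.
construction : ∀ c z a m d e g Σ → z ℕ.+ a ℕ.+ (2 ℕ.* m ℕ.+ 1) ≡ g → 0 ℕ.< c → 2 ∣ Σ →
  Σ ℕ.+ (c ℕ.+ z) ≡ (c ℕ.+ z) ℕ.* (c ℕ.+ z) ℕ.+ 4 ℕ.* suc m ℕ.* (c ℕ.+ z) ℕ.+ 2 ℕ.* suc m ℕ.* m ℕ.+ 2 ℕ.* e →
  c ℕ.* (a ℕ.+ d) ℕ.≤ e → e ℕ.≤ (c ℕ.+ z) ℕ.* a →
  ∃[ D ] 𝔻 (suc (c ℕ.+ g) ℕ.+ d) Σ (c ℕ.+ g) c D × (∃[ γ ] ι (2 ℕ.^ m) ℚ.≤ ∂⁺⁺ D γ)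
construction c z a m d e g Σ g≡ 0<c 2∣Σ total≡ c*q≤e e≤p*a =
  subst (λ n → ∃[ D ] 𝔻 n Σ c₁ c D × (∃[ γ ] ι (2 ℕ.^ m) ℚ.≤ ∂⁺⁺ D γ)) n≡
    (D , degrees , (graph , graph-realizes) ,
      ∂⁺⁺-lower D (graph , graph-realizes) (2 ℕ.^ m) (source<sink) (many-realizations))
  where
  c₁ p q : ℕ
  c₁ = c ℕ.+ g
  p  = c ℕ.+ z
  q  = a ℕ.+ d

  instance
    p≢0 : ℕ.NonZero (c ℕ.+ z)
    p≢0 = ℕ.>-nonZero (ℕₚ.≤-trans 0<c (ℕₚ.m≤m+n c z))

  e≤p*q : e ℕ.≤ p ℕ.* q
  e≤p*q = ℕₚ.≤-trans e≤p*a (ℕₚ.*-monoʳ-≤ p (ℕₚ.m≤m+n a d))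

  cross = balanced c z q e c*q≤e e≤p*q

  open Composition p m q cross

  n≡ : n ≡ suc c₁ ℕ.+ d
  n≡ = subst (λ g → p ℕ.+ (suc m ℕ.+ (suc m ℕ.+ (a ℕ.+ d))) ≡ suc (c ℕ.+ g) ℕ.+ d) g≡ (ℕ-Solver.solve 5 (λ c z a m d → c ⊞ z ⊞ (ℕ-Solver.con 1 ⊞ m ⊞ (ℕ-Solver.con 1 ⊞ m ⊞ (a ⊞ d)))
    ⩴ ℕ-Solver.con 1 ⊞ (c ⊞ (z ⊞ a ⊞ (ℕ-Solver.con 2 ⊠ m ⊞ ℕ-Solver.con 1))) ⊞ d) refl c z a m d)

  c₁≡ : p ℕ.+ (2 ℕ.* m ℕ.+ 1) ℕ.+ a ≡ c₁
  c₁≡ = subst (λ g → p ℕ.+ (2 ℕ.* m ℕ.+ 1) ℕ.+ a ≡ c ℕ.+ g) g≡ (ℕ-Solver.solve 4 (λ c z a m → c ⊞ z ⊞ (ℕ-Solver.con 2 ⊠ m ⊞ ℕ-Solver.con 1) ⊞ a ⩴ c ⊞ (z ⊞ a ⊞ (ℕ-Solver.con 2 ⊠ m ⊞ ℕ-Solver.con 1))) refl c z a m)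

  D≤c₁ : ∀ x → D x ℕ.≤ c₁
  D≤c₁ x = subst (D x ℕ.≤_) c₁≡ (D-upper (balanced-row c z q e c*q≤e e≤p*q e≤p*a) x)

  c≤D : ∀ x → c ℕ.≤ D x
  c≤D = D-lower (ℕₚ.m≤m+n c z) (balanced-column c z q e c*q≤e e≤p*q)

  total≡Σ : total D ≡ Σ
  total≡Σ = ℕₚ.+-cancelʳ-≡ p _ _ (trans (D-total)
    (trans (cong (λ e → p ℕ.* p ℕ.+ 4 ℕ.* suc m ℕ.* p ℕ.+ 2 ℕ.* suc m ℕ.* m ℕ.+ 2 ℕ.* e)
      (balanced-total c z q e c*q≤e e≤p*q)) (sym total≡)))

  degrees : 𝔻 n Σ c₁ c D
  degrees = record
    { isDegreeSequence = record
      { positive = λ x → ℕₚ.≤-trans 0<c (c≤D x)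
      ; ≤n-1     = λ x → ℕₚ.≤-trans (D≤c₁ x) (subst (λ n → c₁ ℕ.≤ n ℕ.∸ 1) (sym n≡) (ℕₚ.m≤m+n c₁ d))
      ; even     = subst (2 ∣_) (sym total≡Σ) 2∣Σ
      }
    ; upper   = D≤c₁
    ; lower   = c≤D
    ; total≡Σ = total≡Σ
    }

-- The origin of the shift in r + 3: the half graph has 2ℓ = 2⌈r/2⌉ + 2 vertices, and rounding up
-- costs one more when r is odd.
2⌈r/2⌉+2≤r+3 : ∀ r → 2 ℕ.* suc ℕ.⌈ r /2⌉ ℕ.≤ r ℕ.+ 3
2⌈r/2⌉+2≤r+3 r = ℕₚ.≤-trans
  (ℕₚ.≤-reflexive (ℕ-Solver.solve 1 (λ m → ℕ-Solver.con 2 ⊠ (ℕ-Solver.con 1 ⊞ m) ⩴ ℕ-Solver.con 2 ⊞ (m ⊞ m)) refl ℕ.⌈ r /2⌉))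
  (ℕₚ.≤-trans (ℕₚ.+-monoʳ-≤ 2 (ℕₚ.≤-trans (ℕₚ.+-monoʳ-≤ ℕ.⌈ r /2⌉ (ℕₚ.⌊n/2⌋≤⌈n/2⌉ (suc r)))
    (ℕₚ.≤-reflexive (ℕₚ.⌊n/2⌋+⌈n/2⌉≡n (suc r)))))
    (ℕₚ.≤-reflexive (ℕ-Solver.solve 1 (λ r → ℕ-Solver.con 3 ⊞ r ⩴ r ⊞ ℕ-Solver.con 3) refl r)))

r≤2⌈r/2⌉ : ∀ r → r ℕ.≤ ℕ.⌈ r /2⌉ ℕ.+ ℕ.⌈ r /2⌉
r≤2⌈r/2⌉ r = subst (ℕ._≤ ℕ.⌈ r /2⌉ ℕ.+ ℕ.⌈ r /2⌉) (ℕₚ.⌊n/2⌋+⌈n/2⌉≡n r)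
  (ℕₚ.+-monoˡ-≤ ℕ.⌈ r /2⌉ (ℕₚ.⌊n/2⌋≤⌈n/2⌉ r))

dense-sequence : ∀ n c₁ c g d Σ r → c ℕ.+ g ≡ c₁ → suc c₁ ℕ.+ d ≡ n → c ℕ.< c₁ → 0 ℕ.< c → 2 ∣ Σ →
  let N = ℕ.∣ 2 ℕ.* Σ - (2 ℕ.* (n ℕ.* c) ℕ.+ g ℕ.* (1 ℕ.+ c₁ ℕ.+ c)) ∣ in
  N ℕ.* N ℕ.+ 3 ℕ.* (r ℕ.+ 3) ℕ.* g ℕ.* (suc g ℕ.* suc g) ℕ.+ 4 ℕ.* (g ℕ.* g) ℕ.* (c ℕ.* d)
    ℕ.≤ (g ℕ.* g) ℕ.* (suc g ℕ.* suc g) →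
  ∃[ D ] 𝔻 n Σ c₁ c D × (∃[ γ ] ι (2 ℕ.^ ℕ.⌈ r /2⌉) ℚ.≤ ∂⁺⁺ D γ)
dense-sequence _ _ c g d Σ r refl refl c<c₁ 0<c 2∣Σ key =
  let (z , a , e , g≡ , total≡ , lower , upper) =
        parameters c g d Σ (r ℕ.+ 3) ℕ.⌈ r /2⌉ {{g≢0}} (ℕₚ.m≤n+m 3 r) (2⌈r/2⌉+2≤r+3 r) 2∣Σ key
  in construction c z a ℕ.⌈ r /2⌉ d e g Σ g≡ 0<c 2∣Σ total≡ lower upper
  where
  g≢0 : ℕ.NonZero g
  g≢0 = ℕ.>-nonZero (ℕₚ.+-cancelˡ-< c 0 g (subst (ℕ._< c ℕ.+ g) (sym (ℕₚ.+-identityʳ c)) c<c₁))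

theorem1p6 : (n c₁ c₂ Σ : ℕ) → c₁ ℕ.< n → (c₂<c₁ : c₂ ℕ.< c₁) → 0 ℕ.< c₂ → 0 ℕ.< Σ → 2 ∣ Σ →
    (β : ℝ) (0<β : 0ℝ < β) (r : ℕ) →
    let gap   = fromℕ c₁ - fromℕ c₂
        0<gap = diff-pos c₂ c₁ c₂<c₁
        Q     = (gap + 1ℝ) ² - fromℕ 4 * fromℕ c₂ * (fromℕ n - 1ℝ - fromℕ c₁)
        ε     = (fromℕ 3 * (fromℕ r + fromℕ 3)) / (β * gap) [ *-pos β gap 0<β 0<gap ]
    in
    fromℕ 4 * fromℕ c₂ * (fromℕ n - 1ℝ - fromℕ c₁) ≤ (1ℝ - β) * (gap + 1ℝ) ² →
    ∣ (fromℕ Σ - fromℕ n * fromℕ c₂) / (gap * ½ℝ) [ *-pos gap ½ℝ 0<gap ½-pos ]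
      - (1ℝ + fromℕ c₁ + fromℕ c₂) ∣ᴿ ≤ (1ℝ - ε) * √ Q →
    ∃[ D ] 𝔻 n Σ c₁ c₂ D × (∃[ g ] √ (fromℕ (2 ℕ.^ r)) ≤ fromℚ (∂⁺⁺ D g))
theorem1p6 n c₁ c Σ c₁<n c<c₁ 0<c _ 2∣Σ β 0<β r hyp₁ hyp₂ =
  let (g , c+g≡c₁)   = ℕₚ.m≤n⇒∃[o]m+o≡n (ℕₚ.<⇒≤ c<c₁)
      (d , 1+c₁+d≡n) = ℕₚ.m≤n⇒∃[o]m+o≡n c₁<n
      (D , degrees , γ , bound) = dense-sequence n c₁ c g d Σ r c+g≡c₁ 1+c₁+d≡n c<c₁ 0<c 2∣Σ
        (key-inequality n c₁ c g d Σ c+g≡c₁ 1+c₁+d≡n c<c₁ β 0<β r hyp₁ hyp₂)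
  in D , degrees , γ , √≤fromℚ r ℕ.⌈ r /2⌉ (∂⁺⁺ D γ) (r≤2⌈r/2⌉ r) bound
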